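{- Let $m\geq 3$ be an integer and write $[m/2]$ for the integer part of $m/2$. Let $\phi(x)\in \mathbb{Z}[x]$ be a monic polynomial which is irreducible modulo every prime $\leq m$. Let $a_{[m/2]}\in\mathbb{Z}$ and suppose $a_0(x), \dots, a_{[m/2]-1}(x)\in \mathbb{Z}[x]$ satisfy: (i) $\deg a_i(x) < \deg \phi(x)$ for $0\leq i\leq [m/2]-1$; (ii) the content of the polynomial $a_{[m/2]}a_0(x)$ is not divisible by any prime $\leq m$. Define $$H^{\phi}_m(x)= a_{[m/2]}\phi(x)^m + \sum_{j=1}^{[m/2]}\binom{m}{2j}u_{2j}\,a_{[m/2]-j}(x)\,\phi(x)^{m-2j}.$$ Then $H^{\phi}_m(x)$ is irreducible over $\mathbb{Q}$ if $m$ is even, and $H^{\phi}_m(x)$ equals $\phi(x)$ times a polynomial irreducible over $\mathbb{Q}$ if $m$ is odd with $m\neq 3^u$ for every integer $u\geq 2$.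
   Context: For each non-negative integer $j$, $u_j$ denotes the product of the odd positive integers $\leq j$ (so $u_0=u_2=1$, $u_4=3$, ...). A polynomial in $\mathbb{Z}[x]$ is irreducible modulo a prime $p$ if its reduction modulo $p$ is irreducible in $(\mathbb{Z}/p\mathbb{Z})[x]$. The content of a polynomial in $\mathbb{Z}[x]$ is the greatest common divisor of its coefficients. -}

module Defs where

open import Algebra.Bundles using (RawSemiring)
import Algebra.Definitions.RawSemiring as SemiringDefs
open import Data.Fin.Base using (toℕ)
open import Data.Integer.Base as ℤ using (ℤ; +_; 0ℤ; 1ℤ)
import Data.Integer.Divisibility as ℤ
import Data.Integer.Properties as ℤ
open import Data.List.Base using (List; []; _∷_; map; foldr; filter; upTo)
open import Data.Nat.Base as ℕ using (ℕ; zero; suc; _∸_; _<_; ⌊_/2⌋)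
open import Data.Nat.Combinatorics using (_C_)
open import Data.Nat.Divisibility using (_∣?_)
open import Data.Nat.GCD using (gcd)
open import Data.Nat.ListAction using (product)
open import Data.Product.Base using (∃; _×_)
import Data.Rational.Base as ℚ
open import Level using (Level; 0ℓ)
open import Relation.Binary.Construct.Add.Infimum.Strict _<_ public using (_<₋_)
open import Relation.Binary.PropositionalEquality.Core using (_≡_)
open import Relation.Nullary.Construct.Add.Infimum using (_₋; ⊥₋; [_])
open import Relation.Nullary.Decidable.Core using (yes; no; ¬?)

-- The polynomial ring R[x].  The list c₀ ∷ c₁ ∷ … ∷ cₙ ∷ [] represents
-- c₀ + c₁x + … + cₙxⁿ; trailing zeros are allowed, so polynomials are
-- compared coefficientwise and not as lists.

module Polynomial {c ℓ : Level} (R : RawSemiring c ℓ) where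

  private module R = RawSemiring R

  Poly : Set c
  Poly = List R.Carrier

  coeff : Poly → ℕ → R.Carrier
  coeff []      _       = R.0#
  coeff (a ∷ f) zero    = a
  coeff (a ∷ f) (suc k) = coeff f k

  infix  4 _≈ₚ_
  infixl 6 _+ₚ_
  infixl 7 _*ₚ_
  infixr 7 _•_

  _≈ₚ_ : Poly → Poly → Set ℓ
  f ≈ₚ g = ∀ k → coeff f k R.≈ coeff g k

  _+ₚ_ : Poly → Poly → Poly
  []      +ₚ g       = g
  (a ∷ f) +ₚ []      = a ∷ f
  (a ∷ f) +ₚ (b ∷ g) = (a R.+ b) ∷ (f +ₚ g)

  _•_ : R.Carrier → Poly → Poly
  a • f = map (a R.*_) f

  _*ₚ_ : Poly → Poly → Poly
  []      *ₚ g = []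
  (a ∷ f) *ₚ g = (a • g) +ₚ (R.0# ∷ (f *ₚ g))

  polynomialRing : RawSemiring c ℓ
  polynomialRing = record
    { Carrier = Poly
    ; _≈_     = _≈ₚ_
    ; _+_     = _+ₚ_
    ; _*_     = _*ₚ_
    ; 0#      = []
    ; 1#      = R.1# ∷ []
    }

  open SemiringDefs polynomialRing public using (_^_; sum; Irreducible)

-- ℤ/pℤ as the setoid quotient of ℤ by congruence modulo p.

ℤ/_ : ℕ → RawSemiring 0ℓ 0ℓ
ℤ/ p = record
  { Carrier = ℤ
  ; _≈_     = λ a b → + p ℤ.∣ a ℤ.- b
  ; _+_     = ℤ._+_
  ; _*_     = ℤ._*_
  ; 0#      = 0ℤ
  ; 1#      = 1ℤ
  }

module ℤ[x] = Polynomial ℤ.+-*-rawSemiring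
module ℚ[x] = Polynomial ℚ.+-*-rawSemiring

open ℤ[x] using (_+ₚ_; _^_; sum; coeff)
open ℤ[x] public using (_≈ₚ_; _*ₚ_; _•_)
  renaming (Poly to ℤPoly)

-- Reduction modulo p does not change the representing integers, only the
-- equality by which coefficients are compared.

IrreducibleMod : ℕ → ℤPoly → Set
IrreducibleMod p f = Polynomial.Irreducible (ℤ/ p) f

IrreducibleOverℚ : ℤPoly → Set
IrreducibleOverℚ f = ℚ[x].Irreducible (map (λ a → a ℚ./ 1) f)

-- The zero polynomial has degree ⊥₋ (that is, -∞).

deg : ℤPoly → ℕ ₋
deg []      = ⊥₋
deg (a ∷ f) with deg f
... | [ n ] = [ suc n ]
... | ⊥₋ with a ℤ.≟ 0ℤ
...   | yes _ = ⊥₋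
...   | no  _ = [ 0 ]

Monic : ℤPoly → Set
Monic f = ∃ λ n → deg f ≡ [ n ] × coeff f n ≡ 1ℤ

content : ℤPoly → ℕ
content = foldr (λ a d → gcd ℤ.∣ a ∣ d) 0

u : ℕ → ℕ
u j = product (filter (λ i → ¬? (2 ∣? i)) (upTo (suc j)))

-- H m φ c a is the polynomial H^φ_m with c the integer a_[m/2] and a i the
-- polynomial a_i; only the values a i with i < [m/2] are used.  The
-- summation index i : Fin [m/2] corresponds to j = i + 1.

H : ℕ → ℤPoly → ℤ → (ℕ → ℤPoly) → ℤPoly
H m φ c a = c • (φ ^ m) +ₚ sum {⌊ m /2⌋} λ i → term (suc (toℕ i))
  where
  term : ℕ → ℤPoly
  term j = + ((m C (2 ℕ.* j)) ℕ.* u (2 ℕ.* j))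
         • (a (⌊ m /2⌋ ∸ j) *ₚ φ ^ (m ∸ 2 ℕ.* j))

{-# OPTIONS --safe #-}
module Submission where

-- Put n = [m/2] and b_j = C(m,2j) u_{2j}.  Up to the factor φ for odd m, H is
-- F = Σ_j b_j a_{n-j} φ^{2(n-j)}.  Suppose that F has a factor of degree δ with
-- 0 < δ ≤ n deg φ, and choose t with 2(t-1) deg φ < δ ≤ 2t deg φ.  A sharpening of
-- Sylvester's theorem provides a prime p > 2t dividing C(m,2t); it divides b_j for all
-- j ≥ t, so that φ divides the factor modulo p.  By Legendre's bound on the order of p in
-- u_{2i}, all slopes of the φ-Newton polygon of F at p are less than the inverse of the
-- φ-degree of the factor, which contradicts that φ divides it modulo p.
--
-- Sylvester's theorem is proved as by Erdős: if all prime factors of C(m,k) are at most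
-- k+1, then counting them gives m² ≤ k³; for large k the bound 4^x for the product of the
-- primes up to x makes C(m,k) too small, and for small k a prime in [m-k+2,m] is exhibited.

open import Algebra.Bundles using (CommutativeRing; CommutativeSemigroup; Semiring)

-- The order g of p in u_{2i} satisfies g (p - 1) < 2i, a strict bound. For even m it keeps the
-- slopes just below 1 / (p - 1), so that p > 2t suffices. For odd m the divisibility behind the
-- bound involves u_{2i+1}; the strictness is spent on the extra 1, and the slope 1 / (p - 1) only
-- excludes φ-degrees up to p - 2. This is why Sylvester's theorem is sharpened from p > 2t to p >
-- 2t + 1, and where the powers of 3 drop out: for t = 1 and m > 3 the prime is a divisor p ≥ 5 of
-- m. Sylvester's theorem requires 4t ≤ m, whereas t runs up to (n + 1) / 2. For t ≥ 2 the one
-- missing case is 2t = n + 1, where a prime between 2t and 4t divides C(m,2t). A bound on the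
-- slopes is encoded as w / W by two integer weights, W for p and w for φ. No polygon is built:
-- elements are compared with the ideals (p^a, φ^b), and the product of the least monomials of two
-- factors is shown to survive in their product.

module Arithmetic where

  open import Data.Bool.Base using (Bool; true; false; if_then_else_; T; _∧_)
  open import Data.Bool.Properties using (T-∧)
  open import Data.Empty using (⊥)
  open import Data.List.Base using (List; []; _∷_; filter; upTo)
  open import Data.List.Properties using (upTo-∷ʳ; filter-++; filter-accept; filter-reject)
  open import Data.List.Relation.Unary.All using (All; []; _∷_; all?)
  open import Data.List.Relation.Unary.Any using (Any; here; there; any?)
  open import Data.Nat.Base
  -- In the library _C_ binds weaker than _*_.
  open import Data.Nat.Combinatorics renaming (_C_ to infixl 8 _C_)
  open import Data.Nat.Combinatorics.Base using (_P′_)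
  open import Data.Nat.Divisibility
  open import Data.Nat.DivMod using (_/_; _%_; m≡m%n+[m/n]*n; m%n<n; m/n*n≤m; m/n*n≡m)
  open import Data.Nat.Induction using (<-rec)
  open import Data.Nat.LCM using (lcm; m∣lcm[m,n]; n∣lcm[m,n]; lcm-least)
  open import Data.Nat.ListAction using (product)
  open import Data.Nat.ListAction.Properties using (product-++)
  open import Data.Nat.Primality
  open import Data.Nat.Properties
  open import Data.Nat.Tactic.RingSolver using (solve-∀)
  open import Data.Product.Base using (∃; ∃₂; _×_; _,_; proj₁; proj₂)
  open import Data.Sum.Base using (_⊎_; inj₁; inj₂)
  open import Data.Unit.Base using (tt)
  open import Defs using (u)
  open import Function.Base using (_∘_)
  open import Function.Bundles using (module Equivalence)
  open import Relation.Binary.PropositionalEquality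
  open import Relation.Nullary using (¬_; Dec; yes; no; contradiction)
  open import Relation.Nullary.Decidable using (from-yes; ¬?; _×-dec_; _→-dec_)

  -- Prime powers and binomial coefficients

  prime>1 : ∀ {p} → Prime p → 1 < p
  prime>1 {p} pr = nonTrivial⇒n>1 p {{prime⇒nonTrivial pr}}

  prime>0 : ∀ {p} → Prime p → 0 < p
  prime>0 pr = <-trans z<s (prime>1 pr)

  prime∤1 : ∀ {p} → Prime p → p ∤ 1
  prime∤1 pr p∣1 = <⇒≢ (prime>1 pr) (sym (∣1⇒≡1 p∣1))

  ∣⇒≤′ : ∀ {d n} → 0 < n → d ∣ n → d ≤ n
  ∣⇒≤′ n>0 = ∣⇒≤ {{>-nonZero n>0}}

  n!>0 : ∀ n → 0 < n !
  n!>0 n = >-nonZero⁻¹ (n !) {{n !≢0}}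

  prime∣!⇒≤ : ∀ {p} → Prime p → ∀ n → p ∣ n ! → p ≤ n
  prime∣!⇒≤ pr zero p∣ = contradiction p∣ (prime∤1 pr)
  prime∣!⇒≤ pr (suc n) p∣ with euclidsLemma (suc n) (n !) pr p∣
  ... | inj₁ p∣1+n = ∣⇒≤ p∣1+n
  ... | inj₂ p∣n!  = m≤n⇒m≤1+n (prime∣!⇒≤ pr n p∣n!)

  ∣! : ∀ {d n} → 0 < d → d ≤ n → d ∣ n !
  ∣! {suc d} _ d≤n = ∣-trans (m∣m*n (d !)) (m≤n⇒m!∣n! d≤n)

  prime-split : ∀ {p} → Prime p → ∀ n → 0 < n → ∃₂ λ e n′ → n ≡ p ^ e * n′ × p ∤ n′
  prime-split {p} pr = <-rec _ go
    where
    instance _ = prime⇒nonTrivial pr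
    go : ∀ n → (∀ {i} → i < n → 0 < i → ∃₂ λ e n′ → i ≡ p ^ e * n′ × p ∤ n′) →
         0 < n → ∃₂ λ e n′ → n ≡ p ^ e * n′ × p ∤ n′
    go n rec n>0 with p ∣? n
    ... | no p∤n = 0 , n , sym (+-identityʳ n) , p∤n
    ... | yes p∣n@(divides q n≡qp) with rec (quotient-< p∣n {{it}} {{>-nonZero n>0}}) q>0
      where
      it = prime⇒nonTrivial pr
      q>0 : 0 < q
      q>0 = n≢0⇒n>0 (λ { refl → <⇒≢ n>0 (sym n≡qp) })
    ...   | e , n′ , q≡ , p∤n′ = suc e , n′ , eq , p∤n′
      where
      eq : n ≡ p * p ^ e * n′
      eq = trans n≡qp (trans (cong (_* p) q≡) (rearr (p ^ e) n′ p))
        where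
        rearr : ∀ x y z → x * y * z ≡ z * x * y
        rearr = solve-∀

  ^-∣-mono : ∀ p {a b} → a ≤ b → p ^ a ∣ p ^ b
  ^-∣-mono p {a} {b} a≤b = divides (p ^ (b ∸ a))
    (trans (cong (p ^_) (sym (m∸n+n≡m a≤b))) (^-distribˡ-+-* p (b ∸ a) a))

  prime^-cancelʳ : ∀ {p} → Prime p → ∀ e a {b} → p ∤ b → p ^ e ∣ a * b → p ^ e ∣ a
  prime^-cancelʳ pr zero a p∤b d = 1∣ a
  prime^-cancelʳ {p} pr (suc e) a {b} p∤b d with euclidsLemma a b pr (m*n∣⇒m∣ p (p ^ e) d)
  ... | inj₂ p∣b = contradiction p∣b p∤b
  ... | inj₁ (divides q refl) = subst (p * p ^ e ∣_) (*-comm p q) (*-monoʳ-∣ p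
      (prime^-cancelʳ pr e q p∤b (*-cancelˡ-∣ p (subst (p * p ^ e ∣_) (rearr q p b) d))))
    where
    instance _ = prime⇒nonZero pr
    rearr : ∀ q p b → q * p * b ≡ p * (q * b)
    rearr = solve-∀

  prime^-∣-≤ : ∀ {p} → Prime p → ∀ e f {x} → p ∤ x → p ^ e ∣ p ^ f * x → e ≤ f
  prime^-∣-≤ {p} pr e f {x} p∤x d with e ≤? f
  ... | yes e≤f = e≤f
  ... | no e≰f = contradiction (prime^-cancelʳ pr e (p ^ f) p∤x d)
    (λ d′ → <⇒≱ (^-monoʳ-< p nt (≰⇒> e≰f)) (∣⇒≤ {{m^n≢0 p f {{prime⇒nonZero pr}}}} d′))
    where nt = prime>1 pr

  -- The p-part of lcm a b is the larger of the p-parts of a and b.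
  prime^∣lcm : ∀ {p} → Prime p → ∀ e {a b} → 0 < a → 0 < b → p ^ e ∣ lcm a b → p ^ e ∣ a ⊎ p ^ e ∣ b
  prime^∣lcm {p} pr e {a} {b} a>0 b>0 d
    with prime-split pr a a>0 | prime-split pr b b>0
  ... | i , a′ , refl , p∤a′ | j , b′ , refl , p∤b′ = result
    where
    p∤a′b′ : p ∤ a′ * b′
    p∤a′b′ q with euclidsLemma a′ b′ pr q
    ... | inj₁ x = p∤a′ x
    ... | inj₂ x = p∤b′ x
    bound : ∀ k → i ≤ k → j ≤ k → e ≤ k
    bound k i≤k j≤k = prime^-∣-≤ pr e k p∤a′b′ (∣-trans d (lcm-least
      (*-pres-∣ (^-∣-mono p i≤k) (m∣m*n b′)) (*-pres-∣ (^-∣-mono p j≤k) (n∣m*n a′))))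
    result : p ^ e ∣ p ^ i * a′ ⊎ p ^ e ∣ p ^ j * b′
    result with ≤-total i j
    ... | inj₁ i≤j = inj₂ (∣m⇒∣m*n b′ (^-∣-mono p (bound j i≤j ≤-refl)))
    ... | inj₂ j≤i = inj₁ (∣m⇒∣m*n a′ (^-∣-mono p (bound i ≤-refl j≤i)))

  nCk*k!*[n∸k]!≡n! : ∀ {n k} → k ≤ n → n C k * (k ! * (n ∸ k) !) ≡ n !
  nCk*k!*[n∸k]!≡n! {n} {k} k≤n = trans (cong (_* (k ! * (n ∸ k) !)) (nCk≡n!/k![n-k]! k≤n))
    (m/n*n≡m {{k !* (n ∸ k) !≢0}} (k![n∸k]!∣n! k≤n))

  C-factorial : ∀ i k → (k + i) C k * (k ! * i !) ≡ (k + i) !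
  C-factorial i k = subst (λ z → (k + i) C k * (k ! * z !) ≡ (k + i) !) (m+n∸m≡n k i)
    (nCk*k!*[n∸k]!≡n! (m≤m+n k i))

  nCk>0 : ∀ {n k} → k ≤ n → 0 < n C k
  nCk>0 {n} {k} k≤n = n≢0⇒n>0 λ eq → <⇒≢ (n!>0 n)
    (trans (sym (cong (_* (k ! * (n ∸ k) !)) eq)) (nCk*k!*[n∸k]!≡n! k≤n))

  -- The upper index n is written `k + suc i`, so that n - k is `suc i` and no truncated subtraction
  -- occurs.
  [1+k]*nC[1+k] : ∀ k i → suc k * (k + suc i) C suc k ≡ suc i * (k + suc i) C k
  [1+k]*nC[1+k] k i = *-cancelʳ-≡ _ _ (k ! * i !) {{k !* i !≢0}} (begin
    suc k * A * (k ! * i !)             ≡⟨ r₁ (suc k) A (k !) (i !) ⟩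
    A * (suc k ! * i !)                 ≡⟨ cong (λ z → z C suc k * (suc k ! * i !)) (+-suc k i) ⟩
    (suc k + i) C suc k * (suc k ! * i !) ≡⟨ C-factorial i (suc k) ⟩
    (suc k + i) !                       ≡⟨ cong _! (sym (+-suc k i)) ⟩
    (k + suc i) !                       ≡⟨ sym (C-factorial (suc i) k) ⟩
    B * (k ! * suc i !)                 ≡⟨ r₂ (suc i) B (k !) (i !) ⟩
    suc i * B * (k ! * i !)             ∎)
    where
    open ≡-Reasoning
    A = (k + suc i) C suc k
    B = (k + suc i) C k
    r₁ : ∀ s a x y → s * a * (x * y) ≡ a * (s * x * y)
    r₁ = solve-∀
    r₂ : ∀ s a x y → a * (x * (s * y)) ≡ s * a * (x * y)
    r₂ = solve-∀

  [1+i]*[1+n]Ck : ∀ k i → suc i * (k + suc i) C k ≡ (k + suc i) * (k + i) C k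
  [1+i]*[1+n]Ck k i = *-cancelʳ-≡ _ _ (k ! * i !) {{k !* i !≢0}} (begin
    suc i * B * (k ! * i !)             ≡⟨ sym (r₂ (suc i) B (k !) (i !)) ⟩
    B * (k ! * suc i !)                 ≡⟨ C-factorial (suc i) k ⟩
    (k + suc i) !                       ≡⟨ cong _! (+-suc k i) ⟩
    suc (k + i) * (k + i) !             ≡⟨ cong (suc (k + i) *_) (sym (C-factorial i k)) ⟩
    suc (k + i) * (D * (k ! * i !))     ≡⟨ sym (*-assoc (suc (k + i)) D (k ! * i !)) ⟩
    suc (k + i) * D * (k ! * i !)       ≡⟨ cong (λ z → z * D * (k ! * i !)) (sym (+-suc k i)) ⟩
    (k + suc i) * D * (k ! * i !)       ∎)
    where
    open ≡-Reasoning
    B = (k + suc i) C k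
    D = (k + i) C k
    r₂ : ∀ s a x y → a * (x * (s * y)) ≡ s * a * (x * y)
    r₂ = solve-∀

  lcm-upto : ℕ → ℕ
  lcm-upto zero    = 1
  lcm-upto (suc n) = lcm (suc n) (lcm-upto n)

  ∣lcm-upto : ∀ n {d} → 0 < d → d ≤ n → d ∣ lcm-upto n
  ∣lcm-upto zero (s≤s _) ()
  ∣lcm-upto (suc n) d>0 d≤ with m≤n⇒m<n∨m≡n d≤
  ... | inj₁ d<  = ∣-trans (∣lcm-upto n d>0 (s≤s⁻¹ d<)) (n∣lcm[m,n] (suc n) (lcm-upto n))
  ... | inj₂ refl = m∣lcm[m,n] (suc n) (lcm-upto n)

  lcm-upto>0 : ∀ n → 0 < lcm-upto n
  lcm-upto>0 zero    = z<s
  lcm-upto>0 (suc n) = n≢0⇒n>0 λ eq → <⇒≢ (*-mono-< (z<s {n}) (lcm-upto>0 n))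
    (sym (0∣⇒≡0 (subst (_∣ suc n * lcm-upto n) eq
      (lcm-least (m∣m*n (lcm-upto n)) (n∣m*n (suc n))))))

  prime^∣lcm-upto : ∀ {p} → Prime p → ∀ e n → 0 < n → p ^ e ∣ lcm-upto n → p ^ e ≤ n
  prime^∣lcm-upto pr e (suc n) _ d with prime^∣lcm pr e z<s (lcm-upto>0 n) d
  ... | inj₁ x = ∣⇒≤ x
  ... | inj₂ y with n
  ...   | zero  = ∣⇒≤′ z<s y
  ...   | suc _ = m≤n⇒m≤1+n (prime^∣lcm-upto pr e _ z<s y)

  -- Leibniz's harmonic triangle: with D n k = k * n C k,
  -- 1 / D n (1+k) = 1 / D (n-1) k − 1 / D n k.
  leibniz-step : ∀ k n′ L → 0 < L → k < suc n′ → k * n′ C k ∣ L → k * suc n′ C k ∣ L → suc k * suc n′ C suc k ∣ L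
  leibniz-step k n′ L L>0 k<n A∣L B∣L = result
    where
    n = suc n′
    i = n ∸ suc k
    n≡ : n ≡ k + suc i
    n≡ = trans (sym (m+[n∸m]≡n k<n)) (sym (+-suc k i))
    n′≡ : n′ ≡ k + i
    n′≡ = suc-injective (trans n≡ (+-suc k i))
    A B D : ℕ
    A = k * n′ C k
    B = k * n C k
    D = suc k * n C suc k
    x = quotient A∣L
    y = quotient B∣L
    D≡ : D ≡ suc i * n C k
    D≡ = subst (λ z → suc k * z C suc k ≡ suc i * z C k) (sym n≡) ([1+k]*nC[1+k] k i)
    up : suc i * n C k ≡ n * n′ C k
    up = subst₂ (λ z w → suc i * z C k ≡ z * w C k) (sym n≡) (sym n′≡) ([1+i]*[1+n]Ck k i)
    ABD : A * (B + D) ≡ B * D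
    ABD = begin
      k * n′ C k * (k * n C k + D)          ≡⟨ cong (λ z → k * n′ C k * (k * n C k + z)) D≡ ⟩
      k * n′ C k * (k * n C k + suc i * n C k) ≡⟨ r₁ k (suc i) (n′ C k) (n C k) ⟩
      k * n C k * ((k + suc i) * n′ C k)    ≡⟨ cong (λ z → k * n C k * (z * n′ C k)) (sym n≡) ⟩
      k * n C k * (n * n′ C k)              ≡⟨ cong (k * n C k *_) (sym up) ⟩
      k * n C k * (suc i * n C k)           ≡⟨ cong (B *_) (sym D≡) ⟩
      B * D                                 ∎
      where
      open ≡-Reasoning
      r₁ : ∀ k s a b → k * a * (k * b + s * b) ≡ k * b * ((k + s) * a)
      r₁ = solve-∀
    L≡xA : L ≡ x * A
    L≡xA = m∣n⇒n≡quotient*m A∣L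
    L≡yB : L ≡ y * B
    L≡yB = m∣n⇒n≡quotient*m B∣L
    A>0 : 0 < A
    A>0 = n≢0⇒n>0 λ eq → <⇒≢ L>0 (sym (trans L≡xA (trans (cong (x *_) eq) (*-zeroʳ x))))
    B>0 : 0 < B
    B>0 = n≢0⇒n>0 λ eq → <⇒≢ L>0 (sym (trans L≡yB (trans (cong (y *_) eq) (*-zeroʳ y))))
    -- Multiplying 1/D = 1/A - 1/B by L gives L/D = x - y; this is that equation without division
    -- and subtraction.
    xD≡L+yD : x * D ≡ L + y * D
    xD≡L+yD = *-cancelʳ-≡ _ _ (A * B) {{m*n≢0 A B {{>-nonZero A>0}} {{>-nonZero B>0}}}} (begin
      x * D * (A * B)         ≡⟨ s₁ x D A B ⟩
      (x * A) * (B * D)       ≡⟨ cong₂ _*_ (sym L≡xA) (sym ABD) ⟩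
      L * (A * (B + D))       ≡⟨ s₂ L A B D ⟩
      L * (A * B) + L * (A * D) ≡⟨ cong (λ z → L * (A * B) + z * (A * D)) L≡yB ⟩
      L * (A * B) + y * B * (A * D) ≡⟨ s₃ L A B D y ⟩
      (L + y * D) * (A * B)   ∎)
      where
      open ≡-Reasoning
      s₁ : ∀ x D A B → x * D * (A * B) ≡ (x * A) * (B * D)
      s₁ = solve-∀
      s₂ : ∀ L A B D → L * (A * (B + D)) ≡ L * (A * B) + L * (A * D)
      s₂ = solve-∀
      s₃ : ∀ L A B D y → L * (A * B) + y * B * (A * D) ≡ (L + y * D) * (A * B)
      s₃ = solve-∀
    result : D ∣ L
    result = ∣m+n∣m⇒∣n (subst (D ∣_) (trans xD≡L+yD (+-comm L (y * D))) (n∣m*n x)) (n∣m*n y)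

  leibniz-triangle : ∀ k n L → 0 < L → 0 < k → k ≤ n → (∀ {d} → 0 < d → d ≤ n → d ∣ L) → k * n C k ∣ L
  leibniz-triangle (suc zero) n L L>0 _ k≤n h = subst (_∣ L)
    (trans (sym (nC1≡n n)) (sym (+-identityʳ (n C 1)))) (h k≤n ≤-refl)
  leibniz-triangle (suc (suc k′)) zero L L>0 _ () h
  leibniz-triangle (suc (suc k′)) (suc n′) L L>0 _ k<n h = leibniz-step (suc k′) n′ L L>0 k<n
    (leibniz-triangle (suc k′) n′ L L>0 z<s (s≤s⁻¹ k<n) (λ d>0 d≤ → h d>0 (m≤n⇒m≤1+n d≤)))
    (leibniz-triangle (suc k′) (suc n′) L L>0 z<s (<⇒≤ k<n) h)

  -- The product `k * n C k` divides lcm(1, ..., n), and a prime power dividing that lcm divides one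
  -- of 1, ..., n. This replaces the count of carries in Kummer's theorem.
  prime^∣nCk⇒≤ : ∀ {p} → Prime p → ∀ e {n k} → 0 < k → k ≤ n → p ^ e ∣ n C k → p ^ e ≤ n
  prime^∣nCk⇒≤ pr e {n} {k} k>0 k≤n d = prime^∣lcm-upto pr e n (<-≤-trans k>0 k≤n)
    (∣-trans d (∣-trans (n∣m*n k) (leibniz-triangle k n (lcm-upto n) (lcm-upto>0 n) k>0 k≤n (∣lcm-upto n))))

  prime∣nCk : ∀ {p} → Prime p → ∀ {n k} → k ≤ n → p ≤ n → k < p → n ∸ k < p → p ∣ n C k
  prime∣nCk {p} pr {n} {k} k≤n p≤n k<p n∸k<p
    with euclidsLemma (n C k) (k ! * (n ∸ k) !) pr
           (subst (p ∣_) (sym (nCk*k!*[n∸k]!≡n! k≤n)) (∣! (prime>0 pr) p≤n))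
  ... | inj₁ x = x
  ... | inj₂ y with euclidsLemma (k !) ((n ∸ k) !) pr y
  ...   | inj₁ z = contradiction (prime∣!⇒≤ pr k z) (<⇒≱ k<p)
  ...   | inj₂ z = contradiction (prime∣!⇒≤ pr (n ∸ k) z) (<⇒≱ n∸k<p)

  -- By (k+1) C(n,k+1) = (n-k) C(n,k), where p cannot divide k+1.
  prime∣nC[1+k] : ∀ {p} → Prime p → ∀ {n k} → suc k < p → p ∣ n C k → p ∣ n C suc k
  prime∣nC[1+k] {p} pr {n} {k} 1+k<p d with suc k ≤? n
  ... | no k≮n = subst (p ∣_) (sym (k>n⇒nCk≡0 (≰⇒> k≮n))) (p ∣0)
  ... | yes k<n with euclidsLemma (suc k) (n C suc k) pr (subst (p ∣_) (sym eq) (∣n⇒∣m*n (suc (n ∸ suc k)) d))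
    where
    n≡ : k + suc (n ∸ suc k) ≡ n
    n≡ = trans (+-suc k (n ∸ suc k)) (m+[n∸m]≡n k<n)
    eq : suc k * n C suc k ≡ suc (n ∸ suc k) * n C k
    eq = subst (λ z → suc k * z C suc k ≡ suc (n ∸ suc k) * z C k) n≡ ([1+k]*nC[1+k] k (n ∸ suc k))
  ...   | inj₁ x = contradiction (∣⇒≤ x) (<⇒≱ 1+k<p)
  ...   | inj₂ y = y

  prime∣nC-mono : ∀ {p} → Prime p → ∀ {n k j} → k ≤ j → j < p → p ∣ n C k → p ∣ n C j
  prime∣nC-mono {p} pr {n} {k} {j} k≤j j<p d = go (j ∸ k) j (m+[n∸m]≡n k≤j) j<p
    where
    go : ∀ i j → k + i ≡ j → j < p → p ∣ n C j
    go zero j refl j<p = subst (λ z → p ∣ n C z) (sym (+-identityʳ k)) d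
    go (suc i) j refl j<p = subst (λ z → p ∣ n C z) (sym (+-suc k i))
      (prime∣nC[1+k] pr (subst (_< p) (+-suc k i) j<p) (go i (k + i) refl (<-trans (+-monoʳ-< k (n<1+n i)) j<p)))

  -- Products over primes

  pick : {A : Set} → Dec A → ℕ → ℕ
  pick (yes _) x = x
  pick (no  _) x = 1

  pick-1 : {A : Set} (d : Dec A) → pick d 1 ≡ 1
  pick-1 (yes _) = refl
  pick-1 (no  _) = refl

  ∏ : (ℕ → ℕ) → ℕ → ℕ
  ∏ f zero    = 1
  ∏ f (suc n) = pick (prime? (suc n)) (f (suc n)) * ∏ f n

  π : ℕ → ℕ
  π zero    = 0
  π (suc n) with prime? (suc n)
  ... | yes _ = suc (π n)
  ... | no  _ = π n

  ∏-mono : ∀ {f g} n → (∀ p → Prime p → p ≤ n → f p ≤ g p) → ∏ f n ≤ ∏ g n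
  ∏-mono zero h = ≤-refl
  ∏-mono (suc n) h with prime? (suc n)
  ... | yes pr = *-mono-≤ (h (suc n) pr ≤-refl) (∏-mono n (λ p pr p≤ → h p pr (m≤n⇒m≤1+n p≤)))
  ... | no  _  = *-monoʳ-≤ 1 (∏-mono n (λ p pr p≤ → h p pr (m≤n⇒m≤1+n p≤)))

  ∏-* : ∀ f g n → ∏ (λ p → f p * g p) n ≡ ∏ f n * ∏ g n
  ∏-* f g zero = refl
  ∏-* f g (suc n) with prime? (suc n)
  ... | yes _ rewrite ∏-* f g n = r (f (suc n)) (g (suc n)) (∏ f n) (∏ g n)
    where
    r : ∀ a b x y → a * b * (x * y) ≡ a * x * (b * y)
    r = solve-∀
  ... | no _ rewrite ∏-* f g n = r (∏ f n) (∏ g n)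
    where
    r : ∀ x y → 1 * (x * y) ≡ 1 * x * (1 * y)
    r = solve-∀

  ∏-const : ∀ m n → ∏ (λ _ → m) n ≡ m ^ π n
  ∏-const m zero = refl
  ∏-const m (suc n) with prime? (suc n)
  ... | yes _ = cong (m *_) (∏-const m n)
  ... | no  _ = trans (+-identityʳ _) (∏-const m n)

  π≤n : ∀ n → π n ≤ n
  π≤n zero = z≤n
  π≤n (suc n) with prime? (suc n)
  ... | yes _ = s≤s (π≤n n)
  ... | no  _ = m≤n⇒m≤1+n (π≤n n)

  upto : ℕ → (ℕ → ℕ) → ℕ → ℕ
  upto c f p = pick (p ≤? c) (f p)

  upto-≤ : ∀ c {f p} → p ≤ c → upto c f p ≡ f p
  upto-≤ c {f} {p} p≤c with p ≤? c
  ... | yes _  = refl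
  ... | no p≰c = contradiction p≤c p≰c

  upto-> : ∀ c {f p} → c < p → upto c f p ≡ 1
  upto-> c {f} {p} c<p with p ≤? c
  ... | yes p≤c = contradiction c<p (≤⇒≯ p≤c)
  ... | no _    = refl

  upto≥1 : ∀ c {f p} → 1 ≤ f p → 1 ≤ upto c f p
  upto≥1 c {f} {p} 1≤f with p ≤? c
  ... | yes _ = 1≤f
  ... | no  _ = ≤-refl

  ∏≥1 : ∀ f n → (∀ p → 0 < p → 1 ≤ f p) → 1 ≤ ∏ f n
  ∏≥1 f zero h = ≤-refl
  ∏≥1 f (suc n) h with prime? (suc n)
  ... | yes _ = *-mono-≤ (h (suc n) z<s) (∏≥1 f n h)
  ... | no  _ = *-monoʳ-≤ 1 (∏≥1 f n h)

  ∏-monoʳ : ∀ f {m n} → (∀ p → 0 < p → 1 ≤ f p) → m ≤ n → ∏ f m ≤ ∏ f n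
  ∏-monoʳ f {m} {zero} h m≤n rewrite n≤0⇒n≡0 m≤n = ≤-refl
  ∏-monoʳ f {m} {suc n} h m≤n with m≤n⇒m<n∨m≡n m≤n
  ... | inj₂ refl = ≤-refl
  ... | inj₁ m<1+n = ≤-trans (∏-monoʳ f h (s≤s⁻¹ m<1+n)) step
    where
    step : ∏ f n ≤ ∏ f (suc n)
    step with prime? (suc n)
    ... | yes _ = ≤-trans (≤-reflexive (sym (*-identityˡ (∏ f n)))) (*-monoˡ-≤ (∏ f n) (h (suc n) z<s))
    ... | no  _ = ≤-reflexive (sym (*-identityˡ (∏ f n)))

  ∏-upto : ∀ c f n → (∀ p → 0 < p → 1 ≤ f p) → ∏ (upto c f) n ≤ ∏ f c
  ∏-upto c f zero h = ∏≥1 f c h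
  ∏-upto c f (suc n) h with ≤-<-connex (suc n) c
  ... | inj₁ 1+n≤c = ≤-trans (∏-mono (suc n) λ p _ p≤ → ≤-reflexive (upto-≤ c {f} (≤-trans p≤ 1+n≤c))) (∏-monoʳ f h 1+n≤c)
  ... | inj₂ c<1+n rewrite upto-> c {f} c<1+n | pick-1 (prime? (suc n)) =
    ≤-trans (≤-reflexive (*-identityˡ _)) (∏-upto c f n h)

  prime-divisor : ∀ N → 1 < N → ∃ λ p → Prime p × p ∣ N
  prime-divisor = <-rec _ go
    where
    go : ∀ N → (∀ {i} → i < N → 1 < i → ∃ λ p → Prime p × p ∣ i) → 1 < N → ∃ λ p → Prime p × p ∣ N
    go N rec 1<N with composite? N
    ... | no ¬c = N , ¬composite⇒prime {{n>1⇒nonTrivial 1<N}} ¬c , ∣-refl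
    ... | yes (hasNonTrivialDivisor {d} {{nt}} d<N d∣N) with rec d<N (nonTrivial⇒n>1 d {{nt}})
    ...   | p , pr , p∣d = p , pr , ∣-trans p∣d d∣N

  -- The primes are peeled off from n downwards: the p-part of N is at most `f p`, and the cofactor
  -- has only smaller prime divisors. At n = 0 no prime divisor is left, so N ≤ 1.
  ≤∏ : ∀ f n N → 0 < N → (∀ p → Prime p → p ∣ N → p ≤ n) →
       (∀ p e → Prime p → p ^ e ∣ N → p ^ e ≤ f p) → N ≤ ∏ f n
  ≤∏ f zero N N>0 small h with N ≤? 1
  ... | yes N≤1 = N≤1
  ... | no N≰1 with prime-divisor N (≰⇒> N≰1)
  ...   | p , pr , p∣N = contradiction (small p pr p∣N) (<⇒≱ (prime>0 pr))
  ≤∏ f (suc n) N N>0 small h with prime? (suc n)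
  ... | no ¬pr = ≤-trans (≤∏ f n N N>0 small′ h) (≤-reflexive (sym (*-identityˡ _)))
    where
    small′ : ∀ p → Prime p → p ∣ N → p ≤ n
    small′ p pr p∣N with m≤n⇒m<n∨m≡n (small p pr p∣N)
    ... | inj₁ p<1+n = s≤s⁻¹ p<1+n
    ... | inj₂ refl  = contradiction pr ¬pr
  ... | yes pr with prime-split pr N N>0
  ...   | e , N′ , refl , q∤N′ = *-mono-≤ (h (suc n) e pr (m∣m*n N′))
    (≤∏ f n N′ N′>0 small′ (λ p e′ pr′ d → h p e′ pr′ (∣n⇒∣m*n (suc n ^ e) d)))
    where
    N′>0 : 0 < N′
    N′>0 = n≢0⇒n>0 λ { refl → <⇒≢ N>0 (sym (*-zeroʳ (suc n ^ e))) }
    small′ : ∀ p → Prime p → p ∣ N′ → p ≤ n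
    small′ p pr p∣N′ with m≤n⇒m<n∨m≡n (small p pr (∣n⇒∣m*n (suc n ^ e) p∣N′))
    ... | inj₁ p<1+n = s≤s⁻¹ p<1+n
    ... | inj₂ refl  = contradiction p∣N′ q∤N′

  -- A sum of two neighbours reproduces itself under Pascal's rule, so no summation over a whole row
  -- is needed. In the odd row 2j+1 the two middle entries are equal, which gives the bound 4^j
  -- below.
  nCk+nC[1+k]≤2^n : ∀ n k → n C k + n C suc k ≤ 2 ^ n
  nCk+nC[1+k]≤2^n zero zero = ≤-refl
  nCk+nC[1+k]≤2^n zero (suc k) = z≤n
  nCk+nC[1+k]≤2^n (suc n) zero = begin
    1 + suc n C 1                ≡⟨ cong (1 +_) (sym (nCk+nC[k+1]≡[n+1]C[k+1] n 0)) ⟩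
    1 + (1 + n C 1)              ≤⟨ +-monoˡ-≤ (1 + n C 1) (>-nonZero⁻¹ (2 ^ n) {{m^n≢0 2 n}}) ⟩
    2 ^ n + (n C 0 + n C 1)      ≤⟨ +-monoʳ-≤ (2 ^ n) (nCk+nC[1+k]≤2^n n 0) ⟩
    2 ^ n + 2 ^ n                ≡⟨ cong (2 ^ n +_) (sym (+-identityʳ (2 ^ n))) ⟩
    2 ^ suc n                    ∎
    where open ≤-Reasoning
  nCk+nC[1+k]≤2^n (suc n) (suc k) = begin
    suc n C suc k + suc n C suc (suc k)
      ≡⟨ sym (cong₂ _+_ (nCk+nC[k+1]≡[n+1]C[k+1] n k) (nCk+nC[k+1]≡[n+1]C[k+1] n (suc k))) ⟩
    (n C k + n C suc k) + (n C suc k + n C suc (suc k))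
      ≤⟨ +-mono-≤ (nCk+nC[1+k]≤2^n n k) (nCk+nC[1+k]≤2^n n (suc k)) ⟩
    2 ^ n + 2 ^ n                ≡⟨ cong (2 ^ n +_) (sym (+-identityʳ (2 ^ n))) ⟩
    2 ^ suc n                    ∎
    where open ≤-Reasoning

  [1+2j]Cj≤4^j : ∀ j → (j + suc j) C j ≤ 4 ^ j
  [1+2j]Cj≤4^j j = *-cancelˡ-≤ 2 (begin
    2 * n C j               ≡⟨ cong (n C j +_) (+-identityʳ (n C j)) ⟩
    n C j + n C j           ≡⟨ cong (n C j +_) symm ⟩
    n C j + n C suc j       ≤⟨ nCk+nC[1+k]≤2^n n j ⟩
    2 ^ n                   ≡⟨ cong (2 ^_) (+-suc j j) ⟩
    2 * 2 ^ (j + j)         ≡⟨ cong (λ z → 2 * 2 ^ (j + z)) (sym (+-identityʳ j)) ⟩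
    2 * 2 ^ (2 * j)         ≡⟨ cong (2 *_) (sym (^-*-assoc 2 2 j)) ⟩
    2 * 4 ^ j               ∎)
    where
    open ≤-Reasoning
    n = j + suc j
    symm : n C j ≡ n C suc j
    symm = trans (nCk≡nC[n∸k] (m≤m+n j (suc j))) (cong (n C_) (m+n∸m≡n j (suc j)))

  -- Q is the product of the primes in (a, y + a]. The bound on its prime divisors is carried along
  -- because it makes each new prime coprime to the Q built so far.
  ∏-block : ∀ N a y → 0 < N → (∀ p → Prime p → a < p → p ≤ y + a → p ∣ N) →
            ∃ λ Q → ∏ (λ p → p) (y + a) ≡ Q * ∏ (λ p → p) a × Q ∣ N × (∀ p → Prime p → p ∣ Q → p ≤ y + a)
  ∏-block N a zero N>0 h = 1 , sym (*-identityˡ _) , 1∣ N , λ p pr d → contradiction d (prime∤1 pr)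
  ∏-block N a (suc y) N>0 h with ∏-block N a y N>0 (λ p pr a<p p≤ → h p pr a<p (m≤n⇒m≤1+n p≤))
  ... | Q , eq , Q∣N , small with prime? (suc y + a)
  ...   | no _ = Q , trans (*-identityˡ _) eq , Q∣N , λ p pr d → m≤n⇒m≤1+n (small p pr d)
  ...   | yes pr = q * Q , trans (cong (q *_) eq) (sym (*-assoc q Q _)) , qQ∣N Q∣N , small′
    where
    q = suc y + a
    q∤Q : q ∤ Q
    q∤Q d = <⇒≱ (n<1+n (y + a)) (small q pr d)
    qQ∣N : Q ∣ N → q * Q ∣ N
    qQ∣N (divides z N≡zQ) with euclidsLemma z Q pr (subst (q ∣_) N≡zQ (h q pr (s≤s (m≤n+m a y)) ≤-refl))
    ... | inj₁ q∣z = subst (q * Q ∣_) (sym N≡zQ) (*-monoˡ-∣ Q q∣z)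
    ... | inj₂ q∣Q = contradiction q∣Q q∤Q
    small′ : ∀ p → Prime p → p ∣ q * Q → p ≤ q
    small′ p pr′ d with euclidsLemma q Q pr′ d
    ... | inj₁ x = ∣⇒≤ x
    ... | inj₂ x = m≤n⇒m≤1+n (small p pr′ x)

  even⊎odd : ∀ n → ∃ λ j → n ≡ j + j ⊎ n ≡ j + suc j
  even⊎odd zero = 0 , inj₁ refl
  even⊎odd (suc n) with even⊎odd n
  ... | j , inj₁ refl = j , inj₂ (sym (+-suc j j))
  ... | j , inj₂ refl = suc j , inj₁ refl

  -- The induction of Erdős: an even n > 2 contributes no prime, and for n = 2j+1 the primes in
  -- (j+1, 2j+1] divide C(2j+1,j) ≤ 4^j, while those up to j+1 are covered by induction.
  primorial≤4^n : ∀ n → ∏ (λ p → p) n ≤ 4 ^ n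
  primorial≤4^n = <-rec _ go
    where
    open ≤-Reasoning
    go : ∀ n → (∀ {i} → i < n → ∏ (λ p → p) i ≤ 4 ^ i) → ∏ (λ p → p) n ≤ 4 ^ n
    go n rec with even⊎odd n
    ... | zero , inj₁ refl = ≤-refl
    ... | suc zero , inj₁ refl = s≤s (s≤s z≤n)
    ... | zero , inj₂ refl = s≤s z≤n
    ... | suc (suc j) , inj₁ refl = step (prime? (suc (suc j) + suc (suc j)))
      where
      n-1 = suc j + suc (suc j)
      step : (d : Dec (Prime (suc n-1))) → pick d (suc n-1) * ∏ (λ p → p) n-1 ≤ 4 ^ suc n-1
      step (no _) = begin
        1 * ∏ (λ p → p) n-1 ≡⟨ *-identityˡ _ ⟩
        ∏ (λ p → p) n-1     ≤⟨ rec ≤-refl ⟩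
        4 ^ n-1             ≤⟨ m≤n*m (4 ^ n-1) 4 ⟩
        4 ^ suc n-1         ∎
      step (yes pr) = contradiction (prime⇒irreducible pr 2∣) λ { (inj₁ ()) ; (inj₂ e) → m+1+n≢0 j (sym (suc-injective (suc-injective e))) }
        where
        2∣ : 2 ∣ suc (suc j) + suc (suc j)
        2∣ = divides (suc (suc j)) (trans (cong (suc (suc j) +_) (sym (+-identityʳ _))) (*-comm 2 (suc (suc j))))
    ... | suc j , inj₂ refl = bound
      where
      a = suc (suc j)
      N = (suc j + a) C suc j
      h : ∀ p → Prime p → a < p → p ≤ suc j + a → p ∣ N
      h p pr a<p p≤ = prime∣nCk pr (m≤m+n (suc j) a) p≤ (<-trans (n<1+n (suc j)) a<p)
        (subst (_< p) (sym (m+n∸m≡n (suc j) a)) a<p)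
      bound : ∏ (λ p → p) (suc j + a) ≤ 4 ^ (suc j + a)
      bound with ∏-block N a (suc j) (nCk>0 (m≤m+n (suc j) a)) h
      ... | Q , eq , Q∣N , _ = begin
        ∏ (λ p → p) (suc j + a) ≡⟨ eq ⟩
        Q * ∏ (λ p → p) a       ≤⟨ *-mono-≤ (≤-trans (∣⇒≤′ (nCk>0 (m≤m+n (suc j) a)) Q∣N) ([1+2j]Cj≤4^j (suc j))) (rec (s≤s (m≤n+m a j))) ⟩
        4 ^ suc j * 4 ^ a       ≡⟨ sym (^-distribˡ-+-* 4 (suc j) a) ⟩
        4 ^ (suc j + a)         ∎

  π-step : ∀ n → ¬ Prime (suc n) → π (suc n) ≡ π n
  π-step n ¬p with prime? (suc n)
  ... | yes p = contradiction p ¬p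
  ... | no _ = refl

  π-suc≤ : ∀ n → π (suc n) ≤ suc (π n)
  π-suc≤ n with prime? (suc n)
  ... | yes _ = ≤-refl
  ... | no  _ = n≤1+n (π n)

  -- k^k * (m P′ j) dominates termwise since k (m − i) ≥ m (k − i).
  ^-P′ : ∀ {m k} j → j ≤ k → k ≤ m → m ^ j * (k P′ j) ≤ k ^ j * (m P′ j)
  ^-P′ zero _ _ = ≤-refl
  ^-P′ {m} {k} (suc j) j<k k≤m = begin
    m * m ^ j * ((k ∸ j) * (k P′ j))    ≡⟨ r m (m ^ j) (k ∸ j) (k P′ j) ⟩
    m * (k ∸ j) * (m ^ j * (k P′ j))    ≤⟨ *-mono-≤ term (^-P′ j (<⇒≤ j<k) k≤m) ⟩
    k * (m ∸ j) * (k ^ j * (m P′ j))    ≡⟨ sym (r k (k ^ j) (m ∸ j) (m P′ j)) ⟩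
    k * k ^ j * ((m ∸ j) * (m P′ j))    ∎
    where
    open ≤-Reasoning
    r : ∀ m x a b → m * x * (a * b) ≡ m * a * (x * b)
    r = solve-∀
    term : m * (k ∸ j) ≤ k * (m ∸ j)
    term = begin
      m * (k ∸ j)      ≡⟨ *-distribˡ-∸ m k j ⟩
      m * k ∸ m * j    ≤⟨ ∸-monoʳ-≤ (m * k) (*-monoˡ-≤ j k≤m) ⟩
      m * k ∸ k * j    ≡⟨ cong (_∸ k * j) (*-comm m k) ⟩
      k * m ∸ k * j    ≡⟨ sym (*-distribˡ-∸ k m j) ⟩
      k * (m ∸ j)      ∎

  P′-factorial : ∀ {m} j → j ≤ m → (m P′ j) * (m ∸ j) ! ≡ m !
  P′-factorial zero _ = *-identityˡ _
  P′-factorial {m} (suc j) j<m = begin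
    (m ∸ j) * (m P′ j) * (m ∸ suc j) !   ≡⟨ r (m ∸ j) (m P′ j) ((m ∸ suc j) !) ⟩
    (m P′ j) * ((m ∸ j) * (m ∸ suc j) !) ≡⟨ cong ((m P′ j) *_) ([n-k]*[n-k-1]!≡[n-k]! j<m) ⟩
    (m P′ j) * (m ∸ j) !                 ≡⟨ P′-factorial j (<⇒≤ j<m) ⟩
    m !                                  ∎
    where
    open ≡-Reasoning
    r : ∀ a b c → a * b * c ≡ b * (a * c)
    r = solve-∀

  nCk*k!≡nP′k : ∀ {n k} → k ≤ n → n C k * k ! ≡ n P′ k
  nCk*k!≡nP′k {n} {k} k≤n = *-cancelʳ-≡ _ _ ((n ∸ k) !) {{(n ∸ k) !≢0}}
    (trans (*-assoc (n C k) (k !) _) (trans (nCk*k!*[n∸k]!≡n! k≤n) (sym (P′-factorial k k≤n))))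

  m^k≤k^k*mCk : ∀ {m k} → k ≤ m → m ^ k ≤ k ^ k * m C k
  m^k≤k^k*mCk {m} {k} k≤m = *-cancelʳ-≤ _ _ (k !) {{k !≢0}} (begin
    m ^ k * k !            ≡⟨ cong (m ^ k *_) (sym kP′k) ⟩
    m ^ k * (k P′ k)       ≤⟨ ^-P′ k ≤-refl k≤m ⟩
    k ^ k * (m P′ k)       ≡⟨ cong (k ^ k *_) (sym (nCk*k!≡nP′k k≤m)) ⟩
    k ^ k * (m C k * k !)  ≡⟨ sym (*-assoc (k ^ k) (m C k) (k !)) ⟩
    k ^ k * m C k * k !    ∎)
    where
    open ≤-Reasoning
    kP′k : k P′ k ≡ k !
    kP′k = trans (sym (*-identityʳ _)) (trans (cong (λ z → (k P′ k) * z !) (sym (n∸n≡0 k))) (P′-factorial k ≤-refl))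

  prime∣nP′k : ∀ {p m k i} → i < k → p ∣ m ∸ i → p ∣ m P′ k
  prime∣nP′k {p} {m} {suc k} {i} i<1+k d with m≤n⇒m<n∨m≡n (s≤s⁻¹ i<1+k)
  ... | inj₁ i<k  = ∣n⇒∣m*n (m ∸ k) (prime∣nP′k i<k d)
  ... | inj₂ refl = ∣m⇒∣m*n (m P′ k) d

  prime∣m∸i⇒∣mCk : ∀ {p m k i} → Prime p → k ≤ m → k < p → i < k → p ∣ m ∸ i → p ∣ m C k
  prime∣m∸i⇒∣mCk {p} {m} {k} pr k≤m k<p i<k d
    with euclidsLemma (m C k) (k !) pr (subst (p ∣_) (sym (nCk*k!≡nP′k k≤m)) (prime∣nP′k i<k d))
  ... | inj₁ x = x
  ... | inj₂ y = contradiction (prime∣!⇒≤ pr k y) (<⇒≱ k<p)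

  -- Induction by (k+1) C(2k+2,k+1) = 2 (2k+1) C(2k,k); replacing the factor 2k by 2k+1 is the only
  -- loss.
  4^k≤2k*2kCk : ∀ k → 0 < k → 4 ^ k ≤ 2 * k * (k + k) C k
  4^k≤2k*2kCk (suc zero) _ = ≤-refl
  4^k≤2k*2kCk (suc k@(suc k′)) _ = *-cancelˡ-≤ (suc k) (begin
    suc k * (4 * 4 ^ k)                  ≤⟨ *-monoʳ-≤ (suc k) (*-monoʳ-≤ 4 (4^k≤2k*2kCk k z<s)) ⟩
    suc k * (4 * (2 * k * A))            ≤⟨ *-monoʳ-≤ (suc k) (*-monoʳ-≤ 4 (*-monoˡ-≤ A (n≤1+n (2 * k)))) ⟩
    suc k * (4 * (suc (2 * k) * A))      ≡⟨ r₁ (suc k) k A ⟩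
    suc k * (4 * ((k + suc k) * A))      ≡⟨ cong (λ z → suc k * (4 * z)) (sym e₁) ⟩
    suc k * (4 * (suc k * B))            ≡⟨ r₂ (suc k) B ⟩
    2 * suc k * ((suc k + suc k) * B)    ≡⟨ cong (2 * suc k *_) (sym e₂) ⟩
    2 * suc k * (suc k * D)              ≡⟨ r₃ (suc k) D ⟩
    suc k * (2 * suc k * D)              ∎)
    where
    open ≤-Reasoning
    A = (k + k) C k
    B = (k + suc k) C k
    D = (suc k + suc k) C suc k
    r₁ : ∀ s k A → s * (4 * (suc (2 * k) * A)) ≡ s * (4 * ((k + suc k) * A))
    r₁ = solve-∀
    r₂ : ∀ s B → s * (4 * (s * B)) ≡ 2 * s * ((s + s) * B)
    r₂ = solve-∀
    r₃ : ∀ s D → 2 * s * (s * D) ≡ s * (2 * s * D)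
    r₃ = solve-∀
    e₁ : suc k * B ≡ (k + suc k) * A
    e₁ = [1+i]*[1+n]Ck k k
    e₂ : suc k * D ≡ (suc k + suc k) * B
    e₂ = trans ([1+i]*[1+n]Ck (suc k) k) (cong ((suc k + suc k) *_)
      (trans (nCk≡nC[n∸k] (m≤m+n (suc k) k)) (cong₂ _C_ (sym (+-suc k k)) (m+n∸m≡n (suc k) k))))

  C-monoˡ : ∀ k i → (k + i) C k ≤ (k + suc i) C k
  C-monoˡ k i = *-cancelˡ-≤ (suc i) (begin
    suc i * (k + i) C k         ≤⟨ *-monoˡ-≤ ((k + i) C k) (m≤n+m (suc i) k) ⟩
    (k + suc i) * (k + i) C k   ≡⟨ sym ([1+i]*[1+n]Ck k i) ⟩
    suc i * (k + suc i) C k     ∎)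
    where open ≤-Reasoning

  C-mono-≤ : ∀ k {i j} → i ≤ j → (k + i) C k ≤ (k + j) C k
  C-mono-≤ k {i} {j} i≤j = go j i≤j
    where
    go : ∀ j → i ≤ j → (k + i) C k ≤ (k + j) C k
    go zero i≤0 rewrite n≤0⇒n≡0 i≤0 = ≤-refl
    go (suc j) i≤ with m≤n⇒m<n∨m≡n i≤
    ... | inj₁ i<  = ≤-trans (go j (s≤s⁻¹ i<)) (C-monoˡ k j)
    ... | inj₂ refl = ≤-refl

  -- (m+1) C k / m C k = (m+1) / (m+1−k) ≥ 3/2 as long as m+1 ≤ 3k.
  3^d*2kCk≤ : ∀ k d → d ≤ k → 3 ^ d * (k + k) C k ≤ 2 ^ d * (k + (k + d)) C k
  3^d*2kCk≤ k zero _ = ≤-reflexive (cong (λ z → 1 * (k + z) C k) (sym (+-identityʳ k)))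
  3^d*2kCk≤ k (suc d) d<k = *-cancelˡ-≤ (suc (k + d)) (begin
    suc (k + d) * (3 * 3 ^ d * A)             ≡⟨ r₁ (suc (k + d)) (3 ^ d) A ⟩
    3 * suc (k + d) * (3 ^ d * A)             ≤⟨ *-mono-≤ ineq (3^d*2kCk≤ k d (<⇒≤ d<k)) ⟩
    2 * (k + suc (k + d)) * (2 ^ d * B)       ≡⟨ r₂ (k + suc (k + d)) (2 ^ d) B ⟩
    2 * 2 ^ d * ((k + suc (k + d)) * B)       ≡⟨ cong (2 * 2 ^ d *_) (sym ([1+i]*[1+n]Ck k (k + d))) ⟩
    2 * 2 ^ d * (suc (k + d) * (k + suc (k + d)) C k)
       ≡⟨ r₃ (2 * 2 ^ d) (suc (k + d)) ((k + suc (k + d)) C k) ⟩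
    suc (k + d) * (2 * 2 ^ d * (k + suc (k + d)) C k)
       ≡⟨ cong (λ z → suc (k + d) * (2 * 2 ^ d * (k + z) C k)) (sym (+-suc k d)) ⟩
    suc (k + d) * (2 * 2 ^ d * (k + (k + suc d)) C k) ∎)
    where
    open ≤-Reasoning
    A = (k + k) C k
    B = (k + (k + d)) C k
    r₁ : ∀ s t A → s * (3 * t * A) ≡ 3 * s * (t * A)
    r₁ = solve-∀
    r₂ : ∀ s t A → 2 * s * (t * A) ≡ 2 * t * (s * A)
    r₂ = solve-∀
    r₃ : ∀ t s A → t * (s * A) ≡ s * (t * A)
    r₃ = solve-∀
    ineq : 3 * suc (k + d) ≤ 2 * (k + suc (k + d))
    ineq = begin
      3 * suc (k + d)                    ≡⟨ s₁ k d ⟩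
      2 * suc k + 2 * d + (k + suc d)    ≤⟨ +-monoʳ-≤ (2 * suc k + 2 * d) (+-monoʳ-≤ k d<k) ⟩
      2 * suc k + 2 * d + (k + k)        ≡⟨ s₂ k d ⟩
      2 * (k + suc (k + d))              ∎
      where
      s₁ : ∀ k d → 3 * suc (k + d) ≡ 2 * suc k + 2 * d + (k + suc d)
      s₁ = solve-∀
      s₂ : ∀ k d → 2 * suc k + 2 * d + (k + k) ≡ 2 * (k + suc (k + d))
      s₂ = solve-∀

  -- Prime factors of binomial coefficients

  -- One step of Legendre's formula: the multiples of p up to qp contribute p^q q!, and w collects
  -- the other factors. The prime is written `suc p′` so that p - 1 is `p′`.
  !-split : ∀ p′ → Prime (suc p′) → ∀ q r → r < suc p′ →
            ∃ λ w → (r + q * suc p′) ! ≡ suc p′ ^ q * (q ! * w) × suc p′ ∤ w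
  !-split p′ pr zero zero r<p = 1 , refl , prime∤1 pr
  !-split p′ pr (suc q) zero r<p with !-split p′ pr q p′ ≤-refl
  ... | w , eq , p∤w = w , trans (cong (suc (p′ + q * suc p′) *_) eq) (rearr p′ q (suc p′ ^ q) (q !) w) , p∤w
    where
    rearr : ∀ p′ q P Q w → (suc q * suc p′) * (P * (Q * w)) ≡ suc p′ * P * (suc q * Q * w)
    rearr = solve-∀
  !-split p′ pr q (suc r) 1+r<p with !-split p′ pr q r (<-trans (n<1+n r) 1+r<p)
  ... | w , eq , p∤w = suc (r + q * suc p′) * w ,
        trans (cong (suc (r + q * suc p′) *_) eq) (rearr (suc (r + q * suc p′)) (suc p′ ^ q) (q !) w) , p∤
    where
    rearr : ∀ x P Q w → x * (P * (Q * w)) ≡ P * (Q * (x * w))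
    rearr = solve-∀
    p∤ : suc p′ ∤ suc (r + q * suc p′) * w
    p∤ d with euclidsLemma (suc (r + q * suc p′)) w pr d
    ... | inj₁ x = >⇒∤ 1+r<p (∣m+n∣m⇒∣n (subst (suc p′ ∣_) (+-comm (suc r) (q * suc p′)) x) (n∣m*n q))
    ... | inj₂ x = p∤w x

  -- Legendre's formula gives (p - 1) v(M!) = M minus the digit sum of M, which is positive. Digit
  -- sums are avoided by v(M!) = q + v(q!) for q = M / p: by induction (p - 1) (q + v(q!)) < (p - 1)
  -- q + q = qp ≤ M.
  prime^∣!⇒< : ∀ p′ → Prime (suc p′) → ∀ M g → 0 < M → suc p′ ^ g ∣ M ! → g * p′ < M
  prime^∣!⇒< p′ pr = <-rec _ go
    where
    p = suc p′
    go : ∀ M → (∀ {i} → i < M → ∀ g → 0 < i → p ^ g ∣ i ! → g * p′ < i) → ∀ g → 0 < M → p ^ g ∣ M ! → g * p′ < M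
    go M rec g M>0 d with !-split p′ pr (M / p) (M % p) (m%n<n M p)
    ... | w , eq , p∤w = bound (M / p) refl
      where
      q = M / p
      M≡ : M ≡ M % p + q * p
      M≡ = m≡m%n+[m/n]*n M p
      d′ : p ^ g ∣ p ^ q * q !
      d′ = prime^-cancelʳ pr g (p ^ q * q !) p∤w (subst (p ^ g ∣_)
        (trans (cong _! M≡) (trans eq (sym (*-assoc (p ^ q) (q !) w)))) d)
      qp≤M : q * p ≤ M
      qp≤M = subst (q * p ≤_) (sym M≡) (m≤n+m (q * p) (M % p))
      bound : ∀ q₀ → q ≡ q₀ → g * p′ < M
      bound zero q≡0 with prime^-∣-≤ pr g 0 (prime∤1 pr) (subst (λ z → p ^ g ∣ p ^ z * z !) q≡0 d′)
      ... | z≤n = M>0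
      bound (suc q₀) q≡ with g ≤? q
      ... | yes g≤q = begin-strict
        g * p′  ≤⟨ *-monoˡ-≤ p′ g≤q ⟩
        q * p′  <⟨ *-monoʳ-< q {{subst NonZero (sym q≡) _}} (n<1+n p′) ⟩
        q * p   ≤⟨ qp≤M ⟩
        M       ∎
        where open ≤-Reasoning
      ... | no g≰q = begin-strict
        g * p′                  ≡⟨ cong (_* p′) (sym g≡) ⟩
        (q + g′) * p′           ≡⟨ *-distribʳ-+ p′ q g′ ⟩
        q * p′ + g′ * p′        <⟨ +-monoʳ-< (q * p′) (rec q<M g′ q>0 g′∣) ⟩
        q * p′ + q              ≡⟨ trans (+-comm (q * p′) q) (sym (*-suc q p′)) ⟩
        q * p                   ≤⟨ qp≤M ⟩
        M                       ∎
        where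
        open ≤-Reasoning
        g′ = g ∸ q
        g≡ : q + g′ ≡ g
        g≡ = m+[n∸m]≡n (<⇒≤ (≰⇒> g≰q))
        q>0 : 0 < q
        q>0 = subst (0 <_) (sym q≡) z<s
        q<M : q < M
        q<M = <-≤-trans (subst (_< q * p) (*-identityʳ q) (*-monoʳ-< q {{>-nonZero q>0}} (prime>1 pr))) qp≤M
        g′∣ : p ^ g′ ∣ q !
        g′∣ = *-cancelˡ-∣ (p ^ q) {{m^n≢0 p q}} (subst (_∣ p ^ q * q !) (trans (cong (p ^_) (sym g≡)) (^-distribˡ-+-* p q g′)) d′)

  -- Since m / p < 3 ≤ p, the prime p divides m! at most twice. It already divides both k! and
  -- (m-k)!, so nothing is left for the binomial coefficient.
  prime∤mCk : ∀ {p m k} → Prime p → 3 ≤ p → p ≤ k → k + k ≤ m → m < 3 * p → p ∤ m C k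
  prime∤mCk {p@(suc p′)} {m} {k} pr 3≤p p≤k 2k≤m m<3p d with !-split p′ pr (m / p) (m % p) (m%n<n m p)
  ... | w , eq , p∤w = contradiction (prime^-∣-≤ pr 3 (m / p) p∤ p³∣) (<⇒≱ q<3)
    where
    q = m / p
    k≤m : k ≤ m
    k≤m = ≤-trans (m≤m+n k k) 2k≤m
    p≤m∸k : p ≤ m ∸ k
    p≤m∸k = ≤-trans p≤k (subst (_≤ m ∸ k) (m+n∸m≡n k k) (∸-monoˡ-≤ k 2k≤m))
    M≡ : m ≡ m % p + q * p
    M≡ = m≡m%n+[m/n]*n m p
    q<3 : q < 3
    q<3 = *-cancelʳ-< p q 3 (≤-<-trans (subst (q * p ≤_) (sym M≡) (m≤n+m (q * p) (m % p))) m<3p)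
    p³∣ : p ^ 3 ∣ p ^ q * (q ! * w)
    p³∣ = subst (p ^ 3 ∣_) (trans (nCk*k!*[n∸k]!≡n! k≤m) (trans (cong _! M≡) eq))
      (subst (_∣ m C k * (k ! * (m ∸ k) !)) (cong (λ z → p * (p * z)) (sym (*-identityʳ p)))
        (*-pres-∣ d (*-pres-∣ (∣! z<s p≤k) (∣! z<s p≤m∸k))))
    p∤ : p ∤ q ! * w
    p∤ x with euclidsLemma (q !) w pr x
    ... | inj₁ y = <⇒≱ (<-≤-trans q<3 3≤p) (prime∣!⇒≤ pr q y)
    ... | inj₂ y = p∤w y

  root : ∀ e m → ∃ λ s → s ^ suc e ≤ m × m < suc s ^ suc e
  root e zero = 0 , z≤n , m^n>0 1 (suc e)
  root e (suc m) with root e m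
  ... | s , lo , hi with suc s ^ suc e ≤? suc m
  ...   | yes le = suc s , le , ≤-<-trans hi (^-monoˡ-< (suc e) (n<1+n (suc s)))
  ...   | no  gt = s , m≤n⇒m≤1+n lo , ≰⇒> gt

  ^-cancelˡ-≤ : ∀ e {a b} → 0 < e → a ^ e ≤ b ^ e → a ≤ b
  ^-cancelˡ-≤ e {a} {b} e>0 le with a ≤? b
  ... | yes a≤b = a≤b
  ... | no a≰b = contradiction le (<⇒≱ (^-monoˡ-< e {{>-nonZero e>0}} (≰⇒> a≰b)))

  ^-cancelˡ-< : ∀ e {a b} → a ^ e < b ^ e → a < b
  ^-cancelˡ-< e {a} {b} lt with suc a ≤? b
  ... | yes a<b = a<b
  ... | no a≮b = contradiction lt (≤⇒≯ (^-monoˡ-≤ e (≮⇒≥ a≮b)))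

  ^-cancelʳ-< : ∀ p {e f} → 1 < p → p ^ e < p ^ f → e < f
  ^-cancelʳ-< p {e} {f} 1<p lt with suc e ≤? f
  ... | yes e<f = e<f
  ... | no e≮f = contradiction lt (≤⇒≯ (^-monoʳ-≤ p {{>-nonZero (<-trans z<s 1<p)}} (≮⇒≥ e≮f)))

  -- Consequences of all prime factors of C(m,k) being at most k + 1

  module _ {m k : ℕ} (k>0 : 0 < k) (2k≤m : k + k ≤ m) (small : ∀ p → Prime p → p ∣ m C k → p ≤ suc k) where

    private
      k≤m : k ≤ m
      k≤m = ≤-trans (m≤m+n k k) 2k≤m
      N>0 : 0 < m C k
      N>0 = nCk>0 k≤m
      p^e≤m : ∀ p e → Prime p → p ^ e ∣ m C k → p ^ e ≤ m
      p^e≤m p e pr d = prime^∣nCk⇒≤ pr e k>0 k≤m d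
      m>0 : 0 < m
      m>0 = <-≤-trans k>0 k≤m

    mCk≤m^π : m C k ≤ m ^ π (suc k)
    mCk≤m^π = subst (m C k ≤_) (∏-const m (suc k)) (≤∏ (λ _ → m) (suc k) (m C k) N>0 small p^e≤m)

    -- Cubing m^k ≤ k^k C(m,k) ≤ k^k m^π and using 3π ≤ k gives m^(3k) ≤ k^(3k) m^k; then m^k is
    -- cancelled and a k-th root taken.
    m²≤k³ : 3 * π (suc k) ≤ k → m ^ 2 ≤ k ^ 3
    m²≤k³ 3π≤k = ^-cancelˡ-≤ k k>0 (*-cancelˡ-≤ (m ^ k) {{m^n≢0 m k {{>-nonZero m>0}}}} (begin
      m ^ k * (m ^ 2) ^ k            ≡⟨ cong (m ^ k *_) (^-*-assoc m 2 k) ⟩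
      m ^ k * m ^ (2 * k)            ≡⟨ sym (^-distribˡ-+-* m k (2 * k)) ⟩
      m ^ (3 * k)                    ≡⟨ cong (m ^_) (*-comm 3 k) ⟩
      m ^ (k * 3)                    ≡⟨ sym (^-*-assoc m k 3) ⟩
      (m ^ k) ^ 3                    ≤⟨ ^-monoˡ-≤ 3 (≤-trans (m^k≤k^k*mCk k≤m) (*-monoʳ-≤ (k ^ k) mCk≤m^π)) ⟩
      (k ^ k * m ^ π (suc k)) ^ 3    ≡⟨ cube (k ^ k) (m ^ π (suc k)) ⟩
      (m ^ π (suc k)) ^ 3 * (k ^ k) ^ 3 ≡⟨ cong₂ _*_ (^-*-assoc m (π (suc k)) 3) (^-*-assoc k k 3) ⟩
      m ^ (π (suc k) * 3) * k ^ (k * 3) ≤⟨ *-monoˡ-≤ (k ^ (k * 3)) (^-monoʳ-≤ m {{>-nonZero m>0}} (subst (_≤ k) (*-comm 3 (π (suc k))) 3π≤k)) ⟩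
      m ^ k * k ^ (k * 3)            ≡⟨ cong (λ z → m ^ k * k ^ z) (*-comm k 3) ⟩
      m ^ k * k ^ (3 * k)            ≡⟨ cong (m ^ k *_) (sym (^-*-assoc k 3 k)) ⟩
      m ^ k * (k ^ 3) ^ k            ∎))
      where
      open ≤-Reasoning
      cube : ∀ a b → (a * b) * ((a * b) * ((a * b) * 1)) ≡ (b * (b * (b * 1))) * (a * (a * (a * 1)))
      cube = solve-∀

    module _ {c s X : ℕ} (m<[1+c]³ : m < suc c ^ 3) (m<[1+s]² : m < suc s ^ 2) (s≤k : s ≤ k)
             (excluded : ∀ p → Prime p → p ≤ k → p ∣ m C k → p ≤ X) where

      private
        top : ℕ → ℕ
        top p with p ≤? k
        ... | yes _ = 1
        ... | no  _ = p

        a₁ a₂ a₃ : ℕ → ℕ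
        a₁ = upto c (λ _ → m)
        a₂ = upto s (λ q → q)
        a₃ = upto X (λ q → q)

        top≥1 : ∀ p → 0 < p → 1 ≤ top p
        top≥1 p p>0 with p ≤? k
        ... | yes _ = ≤-refl
        ... | no  _ = p>0

        top≡ : ∀ p → k < p → top p ≡ p
        top≡ p k<p with p ≤? k
        ... | yes p≤k = contradiction k<p (≤⇒≯ p≤k)
        ... | no  _   = refl

        top≤1 : ∀ p → p ≤ k → top p ≤ 1
        top≤1 p p≤k with p ≤? k
        ... | yes _  = ≤-refl
        ... | no p≰k = contradiction p≤k p≰k

        -- A bound for the p-part of C(m,k), which is at most m. Below c this is the bound used; for
        -- c < p the cube of p exceeds m, so p^2 suffices, and for s < p even p does. One factor p
        -- comes from `a₃`, the second from `a₂`. The factor `top` serves the prime k + 1, the only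
        -- one possible beyond k.
        g : ℕ → ℕ
        g p = a₁ p * (a₂ p * (a₃ p * top p))

        prod4 : ∀ {x y z w a b c d} → x ≤ a → y ≤ b → z ≤ c → w ≤ d → x * (y * (z * w)) ≤ a * (b * (c * d))
        prod4 p q r t = *-mono-≤ p (*-mono-≤ q (*-mono-≤ r t))

        ≤g : ∀ p {x y z w} → x ≤ a₁ p → y ≤ a₂ p → z ≤ a₃ p → w ≤ top p → x * (y * (z * w)) ≤ g p
        ≤g p = prod4

        1≤a₁ : ∀ p → 1 ≤ a₁ p
        1≤a₁ p = upto≥1 c {λ _ → m} m>0

        1≤a₂ : ∀ p → 0 < p → 1 ≤ a₂ p
        1≤a₂ p = upto≥1 s {λ q → q}

        1≤a₃ : ∀ p → 0 < p → 1 ≤ a₃ p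
        1≤a₃ p = upto≥1 X {λ q → q}

        m≤a₁ : ∀ p → p ≤ c → m ≤ a₁ p
        m≤a₁ p p≤c = ≤-reflexive (sym (upto-≤ c {λ _ → m} p≤c))

        p≤a₂ : ∀ p → p ≤ s → p ≤ a₂ p
        p≤a₂ p p≤s = ≤-reflexive (sym (upto-≤ s {λ q → q} p≤s))

        p≤a₃ : ∀ p → p ≤ X → p ≤ a₃ p
        p≤a₃ p p≤X = ≤-reflexive (sym (upto-≤ X {λ q → q} p≤X))

        e<3 : ∀ p e → Prime p → c < p → p ^ e ∣ m C k → e < 3
        e<3 p e pr c<p d = ^-cancelʳ-< p (prime>1 pr)
          (≤-<-trans (p^e≤m p e pr d) (<-≤-trans m<[1+c]³ (^-monoˡ-≤ 3 c<p)))

        e<2 : ∀ p e → Prime p → s < p → p ^ e ∣ m C k → e < 2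
        e<2 p e pr s<p d = ^-cancelʳ-< p (prime>1 pr)
          (≤-<-trans (p^e≤m p e pr d) (<-≤-trans m<[1+s]² (^-monoˡ-≤ 2 s<p)))

        p^e≤g : ∀ p e → Prime p → p ^ e ∣ m C k → p ^ e ≤ g p
        p^e≤g p zero pr d = ≤g p (1≤a₁ p) (1≤a₂ p (prime>0 pr)) (1≤a₃ p (prime>0 pr)) (top≥1 p (prime>0 pr))
        p^e≤g p e@(suc e′) pr d with ≤-<-connex p k
        ... | inj₂ k<p = begin
          p ^ e                   ≤⟨ ^-monoʳ-≤ p {{>-nonZero (prime>0 pr)}} (s≤s⁻¹ (e<2 p e pr (≤-<-trans s≤k k<p) d)) ⟩
          p ^ 1                   ≡⟨ r p ⟩
          1 * (1 * (1 * p))       ≤⟨ ≤g p (1≤a₁ p) (1≤a₂ p (prime>0 pr)) (1≤a₃ p (prime>0 pr)) (≤-reflexive (sym (top≡ p k<p))) ⟩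
          g p                     ∎
          where
          open ≤-Reasoning
          r : ∀ p → p * 1 ≡ 1 * (1 * (1 * p))
          r = solve-∀
        ... | inj₁ p≤k with ≤-<-connex p c | ≤-<-connex p s | excluded p pr p≤k (∣-trans (m∣m*n (p ^ e′)) d)
        ...   | inj₁ p≤c | _ | _ = begin
          p ^ e                   ≤⟨ p^e≤m p e pr d ⟩
          m                       ≡⟨ sym (*-identityʳ m) ⟩
          m * (1 * (1 * 1))       ≤⟨ ≤g p (m≤a₁ p p≤c) (1≤a₂ p (prime>0 pr)) (1≤a₃ p (prime>0 pr)) (top≥1 p (prime>0 pr)) ⟩
          g p                     ∎
          where open ≤-Reasoning
        ...   | inj₂ c<p | inj₁ p≤s | p≤X = begin
          p ^ e                   ≤⟨ ^-monoʳ-≤ p {{>-nonZero (prime>0 pr)}} (s≤s⁻¹ (e<3 p e pr c<p d)) ⟩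
          p ^ 2                   ≡⟨ r p ⟩
          1 * (p * (p * 1))       ≤⟨ ≤g p (1≤a₁ p) (p≤a₂ p p≤s) (p≤a₃ p p≤X) (top≥1 p (prime>0 pr)) ⟩
          g p                     ∎
          where
          open ≤-Reasoning
          r : ∀ p → p * (p * 1) ≡ 1 * (p * (p * 1))
          r = solve-∀
        ...   | inj₂ c<p | inj₂ s<p | p≤X = begin
          p ^ e                   ≤⟨ ^-monoʳ-≤ p {{>-nonZero (prime>0 pr)}} (s≤s⁻¹ (e<2 p e pr s<p d)) ⟩
          p ^ 1                   ≡⟨ r p ⟩
          1 * (1 * (p * 1))       ≤⟨ ≤g p (1≤a₁ p) (1≤a₂ p (prime>0 pr)) (p≤a₃ p p≤X) (top≥1 p (prime>0 pr)) ⟩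
          g p                     ∎
          where
          open ≤-Reasoning
          r : ∀ p → p * 1 ≡ 1 * (1 * (p * 1))
          r = solve-∀

        ∏top : ∏ top (suc k) ≤ suc k
        ∏top = ≤-trans (*-mono-≤ {y = suc k} {v = 1} (pick≤ (prime? (suc k)))
          (subst (∏ top k ≤_) (trans (∏-const 1 k) (^-zeroˡ (π k))) (∏-mono k λ p _ p≤k → top≤1 p p≤k)))
          (≤-reflexive (*-identityʳ (suc k)))
          where
          pick≤ : (d : Dec (Prime (suc k))) → pick d (top (suc k)) ≤ suc k
          pick≤ (yes _) = ≤-reflexive (top≡ (suc k) ≤-refl)
          pick≤ (no  _) = s≤s z≤n

      mCk≤ : m C k ≤ m ^ c * (4 ^ s * (4 ^ X * suc k))
      mCk≤ = begin
        m C k             ≤⟨ ≤∏ g (suc k) (m C k) N>0 small p^e≤g ⟩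
        ∏ g (suc k)       ≡⟨ split ⟩
        ∏ a₁ (suc k) * (∏ a₂ (suc k) * (∏ a₃ (suc k) * ∏ top (suc k)))
                          ≤⟨ prod4 b₁ b₂ b₃ ∏top ⟩
        m ^ c * (4 ^ s * (4 ^ X * suc k)) ∎
        where
        open ≤-Reasoning
        split : ∏ g (suc k) ≡ ∏ a₁ (suc k) * (∏ a₂ (suc k) * (∏ a₃ (suc k) * ∏ top (suc k)))
        split = trans (∏-* a₁ (λ p → a₂ p * (a₃ p * top p)) (suc k)) (cong (∏ a₁ (suc k) *_)
          (trans (∏-* a₂ (λ p → a₃ p * top p) (suc k)) (cong (∏ a₂ (suc k) *_) (∏-* a₃ top (suc k)))))
        b₁ : ∏ a₁ (suc k) ≤ m ^ c
        b₁ = ≤-trans (∏-upto c (λ _ → m) (suc k) (λ _ _ → m>0))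
          (≤-trans (≤-reflexive (∏-const m c)) (^-monoʳ-≤ m {{>-nonZero m>0}} (π≤n c)))
        b₂ : ∏ a₂ (suc k) ≤ 4 ^ s
        b₂ = ≤-trans (∏-upto s (λ p → p) (suc k) (λ _ p>0 → p>0)) (primorial≤4^n s)
        b₃ : ∏ a₃ (suc k) ≤ 4 ^ X
        b₃ = ≤-trans (∏-upto X (λ p → p) (suc k) (λ _ p>0 → p>0)) (primorial≤4^n X)

  -- Certified primes up to a million

  trial : ℕ → ℕ → ℕ → Bool
  trial zero    d n = false
  trial (suc f) d n = if n <ᵇ suc d * suc d then true else
                      if n % suc d ≡ᵇ 0 then false else trial f (suc d) n

  -- Here f is fuel, and `suc d Rough n` records that no number from 2 to d divides n; once the next
  -- square exceeds n this means primality. The test is Boolean, so that it is checked by evaluation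
  -- on literals.
  trial⇒prime : ∀ f d n → .{{_ : NonTrivial n}} → T (trial f d n) → suc d Rough n → Prime n
  trial⇒prime (suc f) d n h r with n <ᵇ suc d * suc d in eq
  ... | true = rough∧square>⇒prime r (<ᵇ⇒< n (suc d * suc d) (subst T (sym eq) tt))
  ... | false with n % suc d ≡ᵇ 0 in eq′
  ...   | false = trial⇒prime f (suc d) n h (∤⇒rough-suc
            (λ d∣n → subst T eq′ (≡⇒≡ᵇ (n % suc d) 0 (n∣m⇒m%n≡0 n (suc d) d∣n))) r)

  -- The gap condition makes k > m − p whenever m² ≤ k³.
  linked : ℕ → List ℕ → Bool
  linked p []       = true
  linked p (q ∷ qs) = (1 <ᵇ q) ∧ (suc (q ∸ p) ^ 3 ≤ᵇ p ^ 2) ∧ trial 2000 1 q ∧ linked q qs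

  last : ℕ → List ℕ → ℕ
  last p []       = p
  last p (q ∷ qs) = last q qs

  linked-prime : ∀ p qs → Prime p → T (linked p qs) → ∀ m → p ≤ m → m < last p qs →
                 ∃ λ q → Prime q × q ≤ m × (2 + (m ∸ q)) ^ 3 ≤ q ^ 2
  linked-prime p [] pr h m p≤m m<p = contradiction m<p (≤⇒≯ p≤m)
  linked-prime p (q ∷ qs) pr h m p≤m m<l with T-∧ .Equivalence.to h
  ... | 1<q , h₁ with T-∧ .Equivalence.to h₁
  ... | gap , h₂ with T-∧ .Equivalence.to h₂
  ... | tr , h₃ with ≤-<-connex q m
  ...   | inj₁ q≤m = linked-prime q qs (trial⇒prime 2000 1 q {{n>1⇒nonTrivial (<ᵇ⇒< 1 q 1<q)}} tr 2-rough) h₃ m q≤m m<l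
  ...   | inj₂ m<q = p , pr , p≤m , ≤-trans (^-monoˡ-≤ 3 (s≤s le)) (≤ᵇ⇒≤ (suc (q ∸ p) ^ 3) (p ^ 2) gap)
    where
    le : suc (m ∸ p) ≤ q ∸ p
    le = subst (_≤ q ∸ p) (+-∸-assoc 1 p≤m) (∸-monoˡ-≤ p m<q)

  -- A chain that continues from 67 past 10^6. The admissible gaps grow like p^(2/3), so about three
  -- hundred primes are enough. The fuel 2000 in `linked` exceeds the square root of each of them.
  primes : List ℕ
  primes =
    79 ∷ 89 ∷ 107 ∷ 127 ∷ 151 ∷ 173 ∷ 199 ∷ 229 ∷ 263 ∷ 293 ∷ 331 ∷ 373 ∷ 421 ∷ 467 ∷ 523 ∷ 577 ∷ 643 ∷ 709 ∷
    787 ∷ 863 ∷ 947 ∷ 1039 ∷ 1129 ∷ 1231 ∷ 1327 ∷ 1439 ∷ 1559 ∷ 1669 ∷ 1801 ∷ 1933 ∷ 2087 ∷ 2243 ∷ 2411 ∷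
    2579 ∷ 2753 ∷ 2939 ∷ 3137 ∷ 3347 ∷ 3559 ∷ 3779 ∷ 4019 ∷ 4261 ∷ 4519 ∷ 4789 ∷ 5059 ∷ 5351 ∷ 5653 ∷ 5953 ∷
    6277 ∷ 6607 ∷ 6949 ∷ 7309 ∷ 7681 ∷ 8069 ∷ 8467 ∷ 8867 ∷ 9293 ∷ 9733 ∷ 10181 ∷ 10639 ∷ 11119 ∷ 11597 ∷
    12107 ∷ 12619 ∷ 13159 ∷ 13711 ∷ 14281 ∷ 14867 ∷ 15467 ∷ 16073 ∷ 16703 ∷ 17351 ∷ 18013 ∷ 18691 ∷ 19391 ∷
    20107 ∷ 20809 ∷ 21563 ∷ 22307 ∷ 23087 ∷ 23893 ∷ 24709 ∷ 25541 ∷ 26407 ∷ 27283 ∷ 28183 ∷ 29101 ∷ 30029 ∷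
    30983 ∷ 31963 ∷ 32969 ∷ 33967 ∷ 34981 ∷ 36037 ∷ 37123 ∷ 38231 ∷ 39359 ∷ 40507 ∷ 41681 ∷ 42863 ∷ 44071 ∷
    45317 ∷ 46573 ∷ 47857 ∷ 49171 ∷ 50503 ∷ 51859 ∷ 53239 ∷ 54647 ∷ 56081 ∷ 57529 ∷ 59011 ∷ 60521 ∷ 62057 ∷
    63617 ∷ 65203 ∷ 66821 ∷ 68449 ∷ 70121 ∷ 71809 ∷ 73529 ∷ 75277 ∷ 77047 ∷ 78853 ∷ 80687 ∷ 82549 ∷ 84443 ∷
    86357 ∷ 88301 ∷ 90281 ∷ 92269 ∷ 94309 ∷ 96377 ∷ 98473 ∷ 100591 ∷ 102701 ∷ 104891 ∷ 107101 ∷ 109331 ∷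
    111611 ∷ 113921 ∷ 116269 ∷ 118633 ∷ 121039 ∷ 123479 ∷ 125941 ∷ 128449 ∷ 130987 ∷ 133559 ∷ 136163 ∷ 138799 ∷
    141461 ∷ 144173 ∷ 146921 ∷ 149689 ∷ 152501 ∷ 155333 ∷ 158209 ∷ 161123 ∷ 164071 ∷ 167051 ∷ 170081 ∷ 173149 ∷
    176243 ∷ 179383 ∷ 182561 ∷ 185767 ∷ 189019 ∷ 192307 ∷ 195599 ∷ 198967 ∷ 202361 ∷ 205783 ∷ 209267 ∷ 212777 ∷
    216329 ∷ 219931 ∷ 223549 ∷ 227231 ∷ 230941 ∷ 234683 ∷ 238481 ∷ 242309 ∷ 246193 ∷ 250109 ∷ 254071 ∷ 258067 ∷
    262111 ∷ 266183 ∷ 270311 ∷ 274489 ∷ 278701 ∷ 282959 ∷ 287257 ∷ 291569 ∷ 295961 ∷ 300397 ∷ 304879 ∷ 309403 ∷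
    313969 ∷ 318581 ∷ 323243 ∷ 327941 ∷ 332687 ∷ 337487 ∷ 342319 ∷ 347209 ∷ 352133 ∷ 357109 ∷ 362137 ∷ 367207 ∷
    372313 ∷ 377477 ∷ 382693 ∷ 387953 ∷ 393271 ∷ 398627 ∷ 404029 ∷ 409483 ∷ 414991 ∷ 420551 ∷ 426163 ∷ 431807 ∷
    437509 ∷ 443263 ∷ 449051 ∷ 454907 ∷ 460813 ∷ 466777 ∷ 472793 ∷ 478853 ∷ 484951 ∷ 491083 ∷ 497303 ∷ 503563 ∷
    509879 ∷ 516253 ∷ 522679 ∷ 529157 ∷ 535697 ∷ 542281 ∷ 548927 ∷ 555593 ∷ 562349 ∷ 569159 ∷ 576019 ∷ 582937 ∷
    589903 ∷ 596933 ∷ 604013 ∷ 611147 ∷ 618347 ∷ 625591 ∷ 632897 ∷ 640267 ∷ 647693 ∷ 655157 ∷ 662693 ∷ 670279 ∷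
    677927 ∷ 685637 ∷ 693409 ∷ 701227 ∷ 709117 ∷ 717047 ∷ 725057 ∷ 733123 ∷ 741233 ∷ 749401 ∷ 757633 ∷ 765931 ∷
    774289 ∷ 782711 ∷ 791201 ∷ 799753 ∷ 808363 ∷ 817039 ∷ 825763 ∷ 834527 ∷ 843383 ∷ 852301 ∷ 861239 ∷ 870283 ∷
    879391 ∷ 888557 ∷ 897781 ∷ 907073 ∷ 916441 ∷ 925849 ∷ 935339 ∷ 944899 ∷ 954517 ∷ 964207 ∷ 973957 ∷ 983777 ∷
    993647 ∷ 1003601 ∷ []

  prime[67] : Prime 67
  prime[67] = trial⇒prime 100 1 67 tt 2-rough

  abstract
    -- The range is dictated by the use below: k ≥ 34 gives m ≥ 68, and k < 10^4 with m² ≤ k³ gives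
    -- m < 10^6. The block is abstract so that the evaluation of the chain is not repeated by later
    -- definitions.
    prime-near : ∀ m → 67 ≤ m → m < 1000000 → ∃ λ q → Prime q × q ≤ m × (2 + (m ∸ q)) ^ 3 ≤ q ^ 2
    prime-near m 67≤m m< = linked-prime 67 primes prime[67] tt m 67≤m (<-≤-trans m< (≤ᵇ⇒≤ 1000000 (last 67 primes) tt))

  -- Estimates

  ≤-by : ∀ {a b} c → b ≡ a + c → a ≤ b
  ≤-by {a} c refl = m≤m+n a c

  ^-sub : ∀ a b e → (a * b) ^ e ≡ a ^ e * b ^ e
  ^-sub a b zero = refl
  ^-sub a b (suc e) rewrite ^-sub a b e = r a b (a ^ e) (b ^ e)
    where
    r : ∀ a b x y → a * b * (x * y) ≡ a * x * (b * y)
    r = solve-∀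

  -- The hypothesis on X is 4^X ≤ 4^(m/3), cubed.
  3^k4^X≤ : ∀ {k d X} → 0 < k → d ≤ k → 3 * X ≤ k + (k + d) →
            3 ^ k * 4 ^ X ≤ 2 ^ k * (2 * k * (k + (k + d)) C k)
  3^k4^X≤ {k} {d} {X} k>0 d≤k 3X≤m = ^-cancelˡ-≤ 3 z<s (*-cancelˡ-≤ (8 ^ d) {{m^n≢0 8 d}} (begin
    8 ^ d * (3 ^ k * 4 ^ X) ^ 3
      ≡⟨ cong (8 ^ d *_) (trans (^-sub (3 ^ k) (4 ^ X) 3) (cong₂ _*_ (swap 3 k) (trans (^-*-assoc 4 X 3) (cong (4 ^_) (*-comm X 3))))) ⟩
    8 ^ d * (27 ^ k * 4 ^ (3 * X))
      ≤⟨ *-monoʳ-≤ (8 ^ d) (*-monoʳ-≤ (27 ^ k) (^-monoʳ-≤ 4 3X≤m)) ⟩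
    8 ^ d * (27 ^ k * 4 ^ (k + (k + d)))
      ≡⟨ cong₂ (λ x y → 8 ^ d * (x * y)) (split 27) (trans (^-distribˡ-+-* 4 k (k + d)) (cong (4 ^ k *_) (^-distribˡ-+-* 4 k d))) ⟩
    -- Of the k factors 27, d are matched by the growth 3^d of the binomial coefficient; the other e
    -- = k - d are bounded by 27 ≤ 32 = 8 * 4.
    8 ^ d * (27 ^ d * 27 ^ e * (4 ^ k * (4 ^ k * 4 ^ d)))
      ≤⟨ *-monoʳ-≤ (8 ^ d) (*-monoˡ-≤ (4 ^ k * (4 ^ k * 4 ^ d)) (*-monoʳ-≤ (27 ^ d) (^-monoˡ-≤ e (≤ᵇ⇒≤ 27 32 tt)))) ⟩
    8 ^ d * (27 ^ d * 32 ^ e * (4 ^ k * (4 ^ k * 4 ^ d)))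
      ≡⟨ cong (λ z → 8 ^ d * (27 ^ d * z * (4 ^ k * (4 ^ k * 4 ^ d)))) (^-sub 8 4 e) ⟩
    8 ^ d * (27 ^ d * (8 ^ e * 4 ^ e) * (4 ^ k * (4 ^ k * 4 ^ d)))
      ≡⟨ r₁ (8 ^ d) (27 ^ d) (8 ^ e) (4 ^ e) (4 ^ k) (4 ^ d) ⟩
    8 ^ d * 8 ^ e * (27 ^ d * (4 ^ k * (4 ^ k * (4 ^ d * 4 ^ e))))
      ≡⟨ cong₂ (λ x y → x * (27 ^ d * (4 ^ k * (4 ^ k * y)))) (sym (split 8)) (sym (split 4)) ⟩
    8 ^ k * (27 ^ d * (4 ^ k * (4 ^ k * 4 ^ k)))
      ≡⟨ cong₂ (λ x y → 8 ^ k * (x * y)) (sym (swap 3 d)) (cong (λ z → 4 ^ k * (4 ^ k * z)) (sym (*-identityʳ (4 ^ k)))) ⟩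
    8 ^ k * ((3 ^ d) ^ 3 * (4 ^ k) ^ 3)
      ≡⟨ cong (8 ^ k *_) (sym (^-sub (3 ^ d) (4 ^ k) 3)) ⟩
    8 ^ k * (3 ^ d * 4 ^ k) ^ 3
      ≤⟨ *-monoʳ-≤ (8 ^ k) (^-monoˡ-≤ 3 lower) ⟩
    8 ^ k * (2 ^ d * Z) ^ 3
      ≡⟨ cong₂ _*_ (sym (swap 2 k)) (trans (^-sub (2 ^ d) Z 3) (cong (_* Z ^ 3) (swap 2 d))) ⟩
    (2 ^ k) ^ 3 * (8 ^ d * Z ^ 3)
      ≡⟨ r₃ ((2 ^ k) ^ 3) (8 ^ d) (Z ^ 3) ⟩
    8 ^ d * ((2 ^ k) ^ 3 * Z ^ 3)
      ≡⟨ cong (8 ^ d *_) (sym (^-sub (2 ^ k) Z 3)) ⟩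
    8 ^ d * (2 ^ k * Z) ^ 3 ∎))
    where
    open ≤-Reasoning
    e = k ∸ d
    Z = 2 * k * (k + (k + d)) C k
    split : ∀ a → a ^ k ≡ a ^ d * a ^ e
    split a = trans (cong (a ^_) (sym (m+[n∸m]≡n d≤k))) (^-distribˡ-+-* a d e)
    swap : ∀ a n → (a ^ n) ^ 3 ≡ (a ^ 3) ^ n
    swap a n = trans (^-*-assoc a n 3) (trans (cong (a ^_) (*-comm n 3)) (sym (^-*-assoc a 3 n)))
    r₁ : ∀ a b c d e f → a * (b * (c * d) * (e * (e * f))) ≡ a * c * (b * (e * (e * (f * d))))
    r₁ = solve-∀
    r₂ : ∀ a b c → a * (2 * b * c) ≡ 2 * b * (a * c)
    r₂ = solve-∀
    r₃ : ∀ a b c → a * (b * c) ≡ b * (a * c)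
    r₃ = solve-∀
    lower : 3 ^ d * 4 ^ k ≤ 2 ^ d * Z
    lower = begin
      3 ^ d * 4 ^ k                          ≤⟨ *-monoʳ-≤ (3 ^ d) (4^k≤2k*2kCk k k>0) ⟩
      3 ^ d * (2 * k * (k + k) C k)          ≡⟨ r₂ (3 ^ d) k ((k + k) C k) ⟩
      2 * k * (3 ^ d * (k + k) C k)          ≤⟨ *-monoʳ-≤ (2 * k) (3^d*2kCk≤ k d d≤k) ⟩
      2 * k * (2 ^ d * (k + (k + d)) C k)    ≡⟨ sym (r₂ (2 ^ d) k ((k + (k + d)) C k)) ⟩
      2 ^ d * Z                              ∎

  -- Everything is bounded by powers of 2, using 2^19 ≤ 3^12 and (r+1)^2 ≤ 2^(r−3).
  3^k> : ∀ {k m s c r} → ∃ (λ z → 10 + z ≡ r) → r ^ 4 ≤ k → k ≤ suc r ^ 4 → s ≤ suc r ^ 3 → c ≤ suc r ^ 2 →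
         0 < m → m ≤ suc r ^ 6 → 2 ^ k * (2 * k * (m ^ c * (4 ^ s * suc k))) < 3 ^ k
  3^k> {k} {m} {s} {c} (z , refl) r⁴≤k k≤ s≤ c≤ m>0 m≤ = ^-cancelˡ-< 12 (begin-strict
    (2 ^ k * (2 * k * (m ^ c * (4 ^ s * suc k)))) ^ 12
      ≤⟨ ^-monoˡ-≤ 12 (*-monoʳ-≤ (2 ^ k) (*-mono-≤ (*-monoʳ-≤ 2 k≤2^) (*-mono-≤ mc≤ (*-mono-≤ 4s≤ 1+k≤2^)))) ⟩
    (2 ^ k * (2 * 2 ^ (2 * a) * (2 ^ (3 * a * (11 + z) ^ 2) * (2 ^ (2 * (11 + z) ^ 3) * 2 ^ (1 + 2 * a))))) ^ 12
      ≡⟨ cong (_^ 12) collect ⟩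
    (2 ^ (k + E)) ^ 12                ≡⟨ ^-*-assoc 2 (k + E) 12 ⟩
    2 ^ ((k + E) * 12)                <⟨ ^-monoʳ-< 2 ≤-refl exps ⟩
    2 ^ (19 * k)                      ≡⟨ sym (^-*-assoc 2 19 k) ⟩
    (2 ^ 19) ^ k                      ≤⟨ ^-monoˡ-≤ k (≤ᵇ⇒≤ (2 ^ 19) (3 ^ 12) tt) ⟩
    (3 ^ 12) ^ k                      ≡⟨ trans (^-*-assoc 3 12 k) (trans (cong (3 ^_) (*-comm 12 k)) (sym (^-*-assoc 3 k 12))) ⟩
    (3 ^ k) ^ 12                      ∎)
    where
    open ≤-Reasoning
    a = 7 + z
    E = 1 + 2 * a + (3 * a * (11 + z) ^ 2 + (2 * (11 + z) ^ 3 + (1 + 2 * a)))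
    sq : ∀ z → (11 + z) ^ 2 ≤ 2 ^ (7 + z)
    sq zero = ≤ᵇ⇒≤ 121 128 tt
    sq (suc z) = begin
      (12 + z) ^ 2          ≤⟨ ≤-by (z * z + 20 * z + 98) (r z) ⟩
      2 * (11 + z) ^ 2      ≤⟨ *-monoʳ-≤ 2 (sq z) ⟩
      2 ^ (8 + z)           ∎
      where
      r : ∀ z → 2 * ((11 + z) * ((11 + z) * 1)) ≡ (12 + z) * ((12 + z) * 1) + (z * z + 20 * z + 98)
      r = solve-∀
    pow : ∀ j → (11 + z) ^ (2 * j) ≤ 2 ^ (j * a)
    pow j = begin
      (11 + z) ^ (2 * j)     ≡⟨ sym (^-*-assoc (11 + z) 2 j) ⟩
      ((11 + z) ^ 2) ^ j     ≤⟨ ^-monoˡ-≤ j (sq z) ⟩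
      (2 ^ a) ^ j            ≡⟨ trans (^-*-assoc 2 a j) (cong (2 ^_) (*-comm a j)) ⟩
      2 ^ (j * a)            ∎
    k≤2^ : k ≤ 2 ^ (2 * a)
    k≤2^ = ≤-trans k≤ (pow 2)
    1+k≤2^ : suc k ≤ 2 ^ (1 + 2 * a)
    1+k≤2^ = begin
      1 + k                          ≤⟨ +-mono-≤ (m^n>0 2 (2 * a)) k≤2^ ⟩
      2 ^ (2 * a) + 2 ^ (2 * a)      ≡⟨ cong (2 ^ (2 * a) +_) (sym (+-identityʳ _)) ⟩
      2 ^ (1 + 2 * a)                ∎
    mc≤ : m ^ c ≤ 2 ^ (3 * a * (11 + z) ^ 2)
    mc≤ = begin
      m ^ c                          ≤⟨ ^-monoʳ-≤ m {{>-nonZero m>0}} c≤ ⟩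
      m ^ ((11 + z) ^ 2)             ≤⟨ ^-monoˡ-≤ ((11 + z) ^ 2) (≤-trans m≤ (pow 3)) ⟩
      (2 ^ (3 * a)) ^ ((11 + z) ^ 2) ≡⟨ ^-*-assoc 2 (3 * a) ((11 + z) ^ 2) ⟩
      2 ^ (3 * a * (11 + z) ^ 2)     ∎
    4s≤ : 4 ^ s ≤ 2 ^ (2 * (11 + z) ^ 3)
    4s≤ = ≤-trans (^-monoʳ-≤ 4 s≤) (≤-reflexive (^-*-assoc 2 2 ((11 + z) ^ 3)))
    collect : 2 ^ k * (2 ^ (1 + 2 * a) * (2 ^ (3 * a * (11 + z) ^ 2) * (2 ^ (2 * (11 + z) ^ 3) * 2 ^ (1 + 2 * a)))) ≡ 2 ^ (k + E)
    collect = sym (trans (^-distribˡ-+-* 2 k E) (cong (2 ^ k *_)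
      (trans (^-distribˡ-+-* 2 (1 + 2 * a) _) (cong (2 ^ (1 + 2 * a) *_)
      (trans (^-distribˡ-+-* 2 (3 * a * (11 + z) ^ 2) _) (cong (2 ^ (3 * a * (11 + z) ^ 2) *_)
      (^-distribˡ-+-* 2 (2 * (11 + z) ^ 3) (1 + 2 * a))))))))
    exps : (k + E) * 12 < 19 * k
    exps = begin-strict
      (k + E) * 12              ≡⟨ *-distribʳ-+ 12 k E ⟩
      -- This is 12 E < 7 r^4 ≤ 7 k: with r = 10 + z, the difference 7 r^4 - 12 E is a polynomial in
      -- z with positive coefficients.
      k * 12 + E * 12           <⟨ +-monoʳ-< (k * 12) (≤-trans (≤-by (7 * z ^ 4 + 220 * z ^ 3 + 2364 * z ^ 2 + 9340 * z + 7203) (poly z)) (*-monoʳ-≤ 7 r⁴≤k)) ⟩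
      k * 12 + 7 * k            ≡⟨ r k ⟩
      19 * k                    ∎
      where
      r : ∀ k → k * 12 + 7 * k ≡ 19 * k
      r = solve-∀
      poly : ∀ z → 7 * ((10 + z) * ((10 + z) * ((10 + z) * ((10 + z) * 1)))) ≡
        suc ((1 + 2 * (7 + z) + (3 * (7 + z) * ((11 + z) * ((11 + z) * 1)) + (2 * ((11 + z) * ((11 + z) * ((11 + z) * 1))) + (1 + 2 * (7 + z))))) * 12)
        + (7 * (z * (z * (z * (z * 1)))) + 220 * (z * (z * (z * 1))) + 2364 * (z * (z * 1)) + 9340 * z + 7203)
      poly = solve-∀

  ¬prime-* : ∀ a b → ¬ Prime ((2 + a) * (2 + b))
  ¬prime-* a b = composite⇒¬prime (composite-* a b)
    where
    composite-* : ∀ a b → Composite ((2 + a) * (2 + b))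
    composite-* a b = hasNonTrivialDivisor {divisor = 2 + a} (m<m*n (2 + a) (2 + b) (s≤s (s≤s z≤n))) (m∣m*n (2 + b))

  ¬prime≡ : ∀ {n} a b → n ≡ (2 + a) * (2 + b) → ¬ Prime n
  ¬prime≡ a b refl = ¬prime-* a b

  ¬prime[36+6q] : ∀ q → ¬ Prime (1 + (35 + 6 * q))
  ¬prime[36+6q] q = ¬prime≡ 0 (16 + 3 * q) (eq q)
    where
    eq : ∀ q → 1 + (35 + 6 * q) ≡ 2 * (2 + (16 + 3 * q))
    eq = solve-∀

  ¬prime[38+6q] : ∀ q → ¬ Prime (3 + (35 + 6 * q))
  ¬prime[38+6q] q = ¬prime≡ 0 (17 + 3 * q) (eq q)
    where
    eq : ∀ q → 3 + (35 + 6 * q) ≡ 2 * (2 + (17 + 3 * q))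
    eq = solve-∀

  ¬prime[39+6q] : ∀ q → ¬ Prime (4 + (35 + 6 * q))
  ¬prime[39+6q] q = ¬prime≡ 1 (11 + 2 * q) (eq q)
    where
    eq : ∀ q → 4 + (35 + 6 * q) ≡ 3 * (2 + (11 + 2 * q))
    eq = solve-∀

  ¬prime[40+6q] : ∀ q → ¬ Prime (5 + (35 + 6 * q))
  ¬prime[40+6q] q = ¬prime≡ 0 (18 + 3 * q) (eq q)
    where
    eq : ∀ q → 5 + (35 + 6 * q) ≡ 2 * (2 + (18 + 3 * q))
    eq = solve-∀

  -- Among six consecutive numbers beyond 3 only the two prime to 6 can be prime; the induction
  -- starts from π 35 = 11.
  π[35+6q]≤ : ∀ q → π (35 + 6 * q) ≤ 11 + 2 * q
  π[35+6q]≤ zero = ≤ᵇ⇒≤ (π 35) 11 tt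
  π[35+6q]≤ (suc q) = subst₂ (λ x y → π x ≤ y) (eq₁ q) (eq₂ q) (begin
    π (6 + b)                 ≤⟨ π-suc≤ (5 + b) ⟩
    suc (π (5 + b))           ≡⟨ cong suc (trans (π-step (4 + b) (¬prime[40+6q] q)) (trans (π-step (3 + b) (¬prime[39+6q] q)) (π-step (2 + b) (¬prime[38+6q] q)))) ⟩
    suc (π (2 + b))           ≤⟨ s≤s (π-suc≤ (1 + b)) ⟩
    2 + π (1 + b)             ≡⟨ cong (2 +_) (π-step b (¬prime[36+6q] q)) ⟩
    2 + π b                   ≤⟨ +-monoʳ-≤ 2 (π[35+6q]≤ q) ⟩
    2 + (11 + 2 * q)          ∎)
    where
    open ≤-Reasoning
    b = 35 + 6 * q
    eq₁ : ∀ q → 6 + (35 + 6 * q) ≡ 35 + 6 * suc q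
    eq₁ = solve-∀
    eq₂ : ∀ q → 2 + (11 + 2 * q) ≡ 11 + 2 * suc q
    eq₂ = solve-∀

  3π≤ : ∀ k → 34 ≤ k → 3 * π (suc k) ≤ k
  3π≤ k 34≤k = subst (λ z → 3 * π (suc z) ≤ z) k≡ (cases r (m%n<n (k ∸ 34) 6))
    where
    open ≤-Reasoning
    r = (k ∸ 34) % 6
    q = (k ∸ 34) / 6
    k≡ : r + (34 + 6 * q) ≡ k
    k≡ = trans (rearr r (6 * q)) (trans (cong (34 +_) (trans (cong (r +_) (*-comm 6 q)) (sym (m≡m%n+[m/n]*n (k ∸ 34) 6)))) (m+[n∸m]≡n 34≤k))
      where
      rearr : ∀ r x → r + (34 + x) ≡ 34 + (r + x)
      rearr = solve-∀
    B : ℕ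
    B = 35 + 6 * q
    low : π (1 + B) ≤ 11 + 2 * q
    low = subst (_≤ 11 + 2 * q) (sym (π-step B (¬prime[36+6q] q))) (π[35+6q]≤ q)
    high : π (2 + B) ≤ 12 + 2 * q
    high = ≤-trans (π-suc≤ (1 + B)) (s≤s low)
    high₃ : π (3 + B) ≤ 12 + 2 * q
    high₃ = subst (_≤ 12 + 2 * q) (sym (π-step (2 + B) (¬prime[38+6q] q))) high
    high₄ : π (4 + B) ≤ 12 + 2 * q
    high₄ = subst (_≤ 12 + 2 * q) (sym (π-step (3 + B) (¬prime[39+6q] q))) high₃
    high₅ : π (5 + B) ≤ 12 + 2 * q
    high₅ = subst (_≤ 12 + 2 * q) (sym (π-step (4 + B) (¬prime[40+6q] q))) high₄
    t₁ : ∀ q → 3 * (11 + 2 * q) ≡ 33 + 6 * q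
    t₁ = solve-∀
    t₂ : ∀ q → 3 * (12 + 2 * q) ≡ 36 + 6 * q
    t₂ = solve-∀
    fin : ∀ {x} → x ≤ 12 + 2 * q → ∀ i → 3 * x ≤ i + (36 + 6 * q)
    fin x≤ i = ≤-trans (*-monoʳ-≤ 3 x≤) (≤-trans (≤-reflexive (t₂ q)) (m≤n+m (36 + 6 * q) i))
    fin₀ : ∀ {x} → x ≤ 11 + 2 * q → ∀ i → 3 * x ≤ i + (33 + 6 * q)
    fin₀ x≤ i = ≤-trans (*-monoʳ-≤ 3 x≤) (≤-trans (≤-reflexive (t₁ q)) (m≤n+m (33 + 6 * q) i))
    cases : ∀ r → r < 6 → 3 * π (suc (r + (34 + 6 * q))) ≤ r + (34 + 6 * q)
    cases 0 _ = fin₀ (π[35+6q]≤ q) 1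
    cases 1 _ = fin₀ low 2
    cases 2 _ = fin high 0
    cases 3 _ = fin high₃ 1
    cases 4 _ = fin high₄ 2
    cases 5 _ = fin high₅ 3
    cases (suc (suc (suc (suc (suc (suc r)))))) r< = contradiction r< (≤⇒≯ (m≤m+n 6 r))

  -- Sylvester and Bertrand

  -- The predecessors of primes, so that the moduli are visibly nonzero.
  small-primes : List ℕ
  small-primes = 6 ∷ 10 ∷ 12 ∷ 16 ∷ 18 ∷ 22 ∷ 28 ∷ 30 ∷ 36 ∷ 40 ∷ 42 ∷ 46 ∷ 52 ∷ 58 ∷ 60 ∷ 66 ∷ 70 ∷ 72 ∷ 78 ∷ 82 ∷
    88 ∷ 96 ∷ 100 ∷ 102 ∷ 106 ∷ 108 ∷ 112 ∷ 126 ∷ 130 ∷ 136 ∷ 138 ∷ 148 ∷ 150 ∷ 156 ∷ 162 ∷ 166 ∷ 172 ∷ 178 ∷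
    180 ∷ 190 ∷ 192 ∷ 196 ∷ 198 ∷ 210 ∷ 222 ∷ 226 ∷ 228 ∷ 232 ∷ 238 ∷ 240 ∷ 250 ∷ []

  -- The remainder of m by `suc q` is less than k exactly when one of the k numbers m, m-1, ...,
  -- m-k+1 is a multiple of `suc q`. Together with `suc q` > k + 1 this produces the prime divisor
  -- wanted, by a test that never computes a binomial coefficient.
  Hit : ℕ → ℕ → ℕ → Set
  Hit m k q = 1 + k ≤ q × m % suc q < k

  hit? : ∀ m k q → Dec (Hit m k q)
  hit? m k q = (1 + k ≤? q) ×-dec (m % suc q <? k)

  abstract
    small-hit : ∀ {t} → t < 17 → 2 ≤ t → ∀ {m} → m < 257 → 4 * t ≤ m → Any (Hit m (t + t)) small-primes
    small-hit = from-yes (allUpTo? (λ t → (2 ≤? t) →-dec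
      allUpTo? (λ m → (4 * t ≤? m) →-dec any? (hit? m (t + t)) small-primes) 257) 17)

    small-primes-prime : All (λ q → Prime (suc q)) small-primes
    small-primes-prime = from-yes (all? (λ q → prime? (suc q)) small-primes)

    -- From m = 257 on, counting prime factors is enough for these t. The cutoff comes from t = 2,
    -- where π 5 = 3 leaves the inequality 4^4 = 256 < 257; below it `small-hit` searches
    -- exhaustively.
    small-power : ∀ {t} → t < 17 → 2 ≤ t → π (suc (t + t)) ≤ t + t × (t + t) ^ (t + t) < 257 ^ (t + t ∸ π (suc (t + t)))
    small-power = from-yes (allUpTo? (λ t → (2 ≤? t) →-dec
      ((π (suc (t + t)) ≤? t + t) ×-dec ((t + t) ^ (t + t) <? 257 ^ (t + t ∸ π (suc (t + t)))))) 17)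

  hit⇒∣C : ∀ {m k p} → Prime (suc p) → k ≤ m → Hit m k p → suc p ∣ m C k
  hit⇒∣C {m} {k} {p} pr k≤m (k<p , r<k) = prime∣m∸i⇒∣mCk pr k≤m (m≤n⇒m≤1+n k<p) r<k
    (divides (m / suc p) (trans (cong (_∸ m % suc p) (m≡m%n+[m/n]*n m (suc p))) (m+n∸m≡n (m % suc p) _)))

  find : ∀ {m k} qs → All (λ q → Prime (suc q)) qs → Any (Hit m k) qs → ∃ λ q → Prime (suc q) × Hit m k q
  find         (q ∷ qs) (pr ∷ prs) (here h)  = q , pr , h
  find {m} {k} (q ∷ qs) (pr ∷ prs) (there h) = find {m} {k} qs prs h

  -- The count behind `m²≤k³` with the exact value of π, since the estimate `3π≤` only starts at k =
  -- 34.
  m≤k^[k∸π] : ∀ {m k} → (k>0 : 0 < k) → k + k ≤ m → (∀ p → Prime p → p ∣ m C k → p ≤ suc k) →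
              π (suc k) ≤ k → m ^ (k ∸ π (suc k)) ≤ k ^ k
  m≤k^[k∸π] {m} {k} k>0 2k≤m small π≤k = *-cancelʳ-≤ _ _ (m ^ π (suc k)) {{m^n≢0 m (π (suc k)) {{>-nonZero m>0}}}} (begin
    m ^ (k ∸ π (suc k)) * m ^ π (suc k) ≡⟨ sym (^-distribˡ-+-* m (k ∸ π (suc k)) (π (suc k))) ⟩
    m ^ (k ∸ π (suc k) + π (suc k))     ≡⟨ cong (m ^_) (m∸n+n≡m π≤k) ⟩
    m ^ k                               ≤⟨ m^k≤k^k*mCk k≤m ⟩
    k ^ k * m C k                       ≤⟨ *-monoʳ-≤ (k ^ k) (mCk≤m^π k>0 2k≤m small) ⟩
    k ^ k * m ^ π (suc k)               ∎)
    where
    open ≤-Reasoning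
    k≤m : k ≤ m
    k≤m = ≤-trans (m≤m+n k k) 2k≤m
    m>0 : 0 < m
    m>0 = <-≤-trans k>0 k≤m

  ¬small-tiny : ∀ {m t} → t < 17 → 2 ≤ t → (t + t) + (t + t) ≤ m → ¬ (∀ p → Prime p → p ∣ m C (t + t) → p ≤ suc (t + t))
  ¬small-tiny {m} {t} t<17 2≤t 2k≤m small with ≤-<-connex 257 m
  ... | inj₁ 257≤m = <⇒≱ (small-power t<17 2≤t .proj₂) (≤-trans (^-monoˡ-≤ (t + t ∸ π (suc (t + t))) 257≤m)
    (m≤k^[k∸π] (<-≤-trans z<s (≤-trans 2≤t (m≤m+n t t))) 2k≤m small (small-power t<17 2≤t .proj₁)))
  ... | inj₂ m<257 with find {m} {t + t} small-primes small-primes-prime (small-hit t<17 2≤t m<257 (subst (_≤ m) (r t) 2k≤m))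
    where
    r : ∀ t → (t + t) + (t + t) ≡ 4 * t
    r = solve-∀
  ...   | q , pr , h = <⇒≱ (s≤s (h .proj₁)) (small (suc q) pr (hit⇒∣C pr (≤-trans (m≤m+n (t + t) (t + t)) 2k≤m) h))

  -- The prime q from `prime-near` satisfies (2 + (m - q))³ ≤ q² ≤ m² ≤ k³, hence 2 + (m - q) ≤ k.
  -- So q is one of the numbers m, ..., m-k+1, and 2k ≤ m makes it larger than k + 1.
  ¬small-mid : ∀ {m k} → 34 ≤ k → k < 10000 → k + k ≤ m → ¬ (∀ p → Prime p → p ∣ m C k → p ≤ suc k)
  ¬small-mid {m} {k} 34≤k k<10⁴ 2k≤m small =
    close (prime-near m (≤-trans (≤-trans (≤ᵇ⇒≤ 67 (34 + 34) tt) (+-mono-≤ 34≤k 34≤k)) 2k≤m) m<10⁶)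
    where
    open ≤-Reasoning
    m<10⁶ : m < 1000000
    m<10⁶ = ^-cancelˡ-< 2 (≤-<-trans (m²≤k³ (<-≤-trans z<s 34≤k) 2k≤m small (3π≤ k 34≤k))
      (<-≤-trans (^-monoˡ-< 3 k<10⁴) (≤ᵇ⇒≤ (10000 ^ 3) (1000000 ^ 2) tt)))
    close : (∃ λ q → Prime q × q ≤ m × (2 + (m ∸ q)) ^ 3 ≤ q ^ 2) → ⊥
    close (q , pr , q≤m , gap) = <⇒≱ 1+k<q (small q pr q∣)
      where
      i = m ∸ q
      2+i≤k : 2 + i ≤ k
      2+i≤k = ^-cancelˡ-≤ 3 z<s (≤-trans gap (≤-trans (^-monoˡ-≤ 2 q≤m) (m²≤k³ (<-≤-trans z<s 34≤k) 2k≤m small (3π≤ k 34≤k))))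
      1+k<q : suc k < q
      1+k<q = +-cancelʳ-≤ i (2 + k) q (begin
        2 + k + i       ≡⟨ r k i ⟩
        k + (2 + i)     ≤⟨ +-monoʳ-≤ k 2+i≤k ⟩
        k + k           ≤⟨ 2k≤m ⟩
        m               ≡⟨ sym (m+[n∸m]≡n q≤m) ⟩
        q + i           ∎)
        where
        r : ∀ k i → 2 + k + i ≡ k + (2 + i)
        r = solve-∀
      q∣ : q ∣ m C k
      q∣ = prime∣m∸i⇒∣mCk pr (≤-trans (m≤m+n k k) 2k≤m) (<-trans (n<1+n k) 1+k<q) (<-≤-trans (n<1+n i) (≤-trans (n≤1+n (suc i)) 2+i≤k))
        (subst (q ∣_) (sym (m∸[m∸n]≡n q≤m)) ∣-refl)

  -- Everything is measured by the fourth root r of k: from m² ≤ k³ < (r+1)^12 the square root s of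
  -- m is at most (r+1)^3 and the cube root c at most (r+1)^2. The factors m^c and 4^s then grow
  -- more slowly than (3/2)^k, which is what the lower bound `3^k4^X≤` has in excess of 4^X.
  ¬small-large : ∀ {m k} → 10000 ≤ k → k + k ≤ m → ¬ (∀ p → Prime p → p ∣ m C k → p ≤ suc k)
  ¬small-large {m} {k} 10⁴≤k 2k≤m small with root 3 k | root 1 m | root 2 m
  ... | r , r⁴≤k , k<[1+r]⁴ | s , s²≤m , m<[1+s]² | c , c³≤m , m<[1+c]³ = contradiction upper (<⇒≱ lower)
    where
    open ≤-Reasoning
    34≤k : 34 ≤ k
    34≤k = ≤-trans (≤ᵇ⇒≤ 34 10000 tt) 10⁴≤k
    k>0 : 0 < k
    k>0 = <-≤-trans z<s 34≤k
    k≤m : k ≤ m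
    k≤m = ≤-trans (m≤m+n k k) 2k≤m
    m² : m ^ 2 ≤ k ^ 3
    m² = m²≤k³ k>0 2k≤m small (3π≤ k 34≤k)
    10≤r : 10 ≤ r
    10≤r = s≤s⁻¹ (^-cancelˡ-< 4 (≤-<-trans 10⁴≤k k<[1+r]⁴))
    k³< : k ^ 3 < suc r ^ 12
    k³< = <-≤-trans (^-monoˡ-< 3 k<[1+r]⁴) (≤-reflexive (^-*-assoc (suc r) 4 3))
    via : ∀ x e f → e * f ≡ 12 → x ^ f ≤ m ^ 2 → x ≤ suc r ^ e
    via x e f ef≡ x^f≤ = <⇒≤ (^-cancelˡ-< f (≤-<-trans x^f≤ (≤-<-trans m² (<-≤-trans k³< (≤-reflexive (sym (trans (^-*-assoc (suc r) e f) (cong (suc r ^_) ef≡))))))))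
    s≤ : s ≤ suc r ^ 3
    s≤ = via s 3 4 refl (≤-trans (≤-reflexive (sym (^-*-assoc s 2 2))) (^-monoˡ-≤ 2 s²≤m))
    c≤ : c ≤ suc r ^ 2
    c≤ = via c 2 6 refl (≤-trans (≤-reflexive (sym (^-*-assoc c 3 2))) (^-monoˡ-≤ 2 c³≤m))
    m≤ : m ≤ suc r ^ 6
    m≤ = via m 6 2 refl ≤-refl
    s≤k : s ≤ k
    s≤k = ^-cancelˡ-≤ 4 z<s (begin
      s ^ 4       ≡⟨ sym (^-*-assoc s 2 2) ⟩
      (s ^ 2) ^ 2 ≤⟨ ^-monoˡ-≤ 2 s²≤m ⟩
      m ^ 2       ≤⟨ m² ⟩
      k ^ 3       ≤⟨ ^-monoʳ-≤ k {{>-nonZero k>0}} (n≤1+n 3) ⟩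
      k ^ 4       ∎)
    W = 2 * k * (m ^ c * (4 ^ s * suc k))
    lower : 2 ^ k * W < 3 ^ k
    lower = 3^k> {k} {m} {s} {c} (m≤n⇒∃[o]m+o≡n 10≤r) r⁴≤k (<⇒≤ k<[1+r]⁴) s≤ c≤ (<-≤-trans k>0 k≤m) m≤
    finish : ∀ X → 3 ^ k * 4 ^ X ≤ 2 ^ k * (2 * k * m C k) → (∀ p → Prime p → p ≤ k → p ∣ m C k → p ≤ X) → 3 ^ k ≤ 2 ^ k * W
    finish X lo excluded = *-cancelʳ-≤ _ _ (4 ^ X) {{m^n≢0 4 X}} (begin
      3 ^ k * 4 ^ X                 ≤⟨ lo ⟩
      2 ^ k * (2 * k * m C k)       ≤⟨ *-monoʳ-≤ (2 ^ k) (*-monoʳ-≤ (2 * k) (mCk≤ k>0 2k≤m small {c} {s} {X} m<[1+c]³ m<[1+s]² s≤k excluded)) ⟩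
      2 ^ k * (2 * k * (m ^ c * (4 ^ s * (4 ^ X * suc k)))) ≡⟨ rearr (2 ^ k) (2 * k) (m ^ c) (4 ^ s) (4 ^ X) (suc k) ⟩
      2 ^ k * W * 4 ^ X             ∎)
      where
      rearr : ∀ a b c d e f → a * (b * (c * (d * (e * f)))) ≡ a * (b * (c * (d * f))) * e
      rearr = solve-∀
    upper : 3 ^ k ≤ 2 ^ k * W
    upper with ≤-<-connex (k + (k + k)) m
    ... | inj₁ 3k≤m = finish k (≤-trans (3^k4^X≤ {k} {k} {k} k>0 ≤-refl (≤-reflexive (3k k)))
        (*-monoʳ-≤ (2 ^ k) (*-monoʳ-≤ (2 * k) (subst ((k + (k + k)) C k ≤_) (cong (_C k) (m+[n∸m]≡n k≤m))
          (C-mono-≤ k (subst (_≤ m ∸ k) (m+n∸m≡n k (k + k)) (∸-monoˡ-≤ k 3k≤m))))))) (λ p _ p≤k _ → p≤k)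
      where
      3k : ∀ k → 3 * k ≡ k + (k + k)
      3k = solve-∀
    ... | inj₂ m<3k = finish (m / 3) (subst (λ x → 3 ^ k * 4 ^ (m / 3) ≤ 2 ^ k * (2 * k * x C k)) m≡
          (3^k4^X≤ {k} {d} {m / 3} k>0 d≤k (subst (3 * (m / 3) ≤_) (sym m≡) 3X≤m))) excluded
      where
      d = m ∸ (k + k)
      m≡ : k + (k + d) ≡ m
      m≡ = trans (sym (+-assoc k k d)) (m+[n∸m]≡n 2k≤m)
      d≤k : d ≤ k
      d≤k = +-cancelˡ-≤ k _ _ (+-cancelˡ-≤ k _ _ (subst (_≤ k + (k + k)) (sym m≡) (<⇒≤ m<3k)))
      3X≤m : 3 * (m / 3) ≤ m
      3X≤m = subst (_≤ m) (*-comm (m / 3) 3) (m/n*n≤m m 3)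
      excluded : ∀ p → Prime p → p ≤ k → p ∣ m C k → p ≤ m / 3
      excluded p pr p≤k d with ≤-<-connex p (m / 3)
      ... | inj₁ p≤X = p≤X
      ... | inj₂ X<p = contradiction d (prime∤mCk pr 3≤p p≤k 2k≤m m<3p)
        where
        m<3p : m < 3 * p
        m<3p = begin-strict
          m                     ≡⟨ m≡m%n+[m/n]*n m 3 ⟩
          m % 3 + m / 3 * 3     <⟨ +-monoˡ-< (m / 3 * 3) (m%n<n m 3) ⟩
          3 + m / 3 * 3         ≤⟨ *-monoˡ-≤ 3 X<p ⟩
          p * 3                 ≡⟨ *-comm p 3 ⟩
          3 * p                 ∎
        3≤p : 3 ≤ p
        3≤p = *-cancelˡ-≤ 3 (≤-trans (≤-trans (≤ᵇ⇒≤ 9 34 tt) (≤-trans 34≤k k≤m)) (<⇒≤ m<3p))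

  -- Sylvester's theorem with "> k" sharpened to "> k + 1", for even k ≥ 4.
  sylvester : ∀ m t → 2 ≤ t → (t + t) + (t + t) ≤ m → ∃ λ p → Prime p × 2 + (t + t) ≤ p × p ∣ m C (t + t)
  sylvester m t 2≤t 2k≤m with anyUpTo? (λ p → prime? p ×-dec ((2 + (t + t) ≤? p) ×-dec (p ∣? m C (t + t)))) (suc m)
  ... | yes (p , _ , pr , ≤p , d) = p , pr , ≤p , d
  ... | no none = contradiction small ¬small
    where
    k = t + t
    small : ∀ p → Prime p → p ∣ m C k → p ≤ suc k
    small p pr d with ≤-<-connex p (suc k)
    ... | inj₁ p≤ = p≤
    ... | inj₂ <p = contradiction (p , s≤s p≤m , pr , <p , d) none
      where
      p≤m : p ≤ m
      p≤m = subst (_≤ m) (*-identityʳ p) (prime^∣nCk⇒≤ pr 1 (<-≤-trans z<s (≤-trans 2≤t (m≤m+n t t))) (≤-trans (m≤m+n k k) 2k≤m)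
        (subst (_∣ m C k) (sym (*-identityʳ p)) d))
    ¬small : ¬ (∀ p → Prime p → p ∣ m C k → p ≤ suc k)
    ¬small with ≤-<-connex 17 t | ≤-<-connex 10000 k
    ... | inj₂ t<17 | _ = ¬small-tiny t<17 2≤t 2k≤m
    ... | inj₁ 17≤t | inj₂ k< = ¬small-mid (+-mono-≤ 17≤t 17≤t) k< 2k≤m
    ... | inj₁ _ | inj₁ ≤k = ¬small-large ≤k 2k≤m

  -- The coefficients of H

  u-suc : ∀ n → u (suc n) ≡ u n * product (filter (λ i → ¬? (2 ∣? i)) (suc n ∷ []))
  u-suc n = trans (cong (product ∘ filter (λ i → ¬? (2 ∣? i))) (sym (upTo-∷ʳ (suc n))))
    (trans (cong product (filter-++ (λ i → ¬? (2 ∣? i)) (upTo (suc n)) (suc n ∷ [])))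
           (product-++ (filter (λ i → ¬? (2 ∣? i)) (upTo (suc n))) _))

  u-odd : ∀ n → 2 ∤ suc n → u (suc n) ≡ u n * suc n
  u-odd n odd = trans (u-suc n) (cong (u n *_)
    (trans (cong product (filter-accept (λ i → ¬? (2 ∣? i)) odd)) (*-identityʳ (suc n))))

  u-even : ∀ n → 2 ∣ suc n → u (suc n) ≡ u n
  u-even n even = trans (u-suc n) (trans (cong (u n *_)
    (cong product (filter-reject (λ i → ¬? (2 ∣? i)) (λ odd → odd even)))) (*-identityʳ (u n)))

  2∤1+2* : ∀ i → 2 ∤ suc (2 * i)
  2∤1+2* i d = contradiction (∣m+n∣m⇒∣n (subst (2 ∣_) (+-comm 1 (2 * i)) d) (m∣m*n i)) (λ x → prime∤1 prime[2] x)

  u[1+2i] : ∀ i → u (suc (2 * i)) ≡ u (2 * i) * suc (2 * i)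
  u[1+2i] i = u-odd (2 * i) (2∤1+2* i)

  2*suc : ∀ i → 2 * suc i ≡ suc (suc (2 * i))
  2*suc = solve-∀

  u[2+2i] : ∀ i → u (2 * suc i) ≡ u (2 * i) * suc (2 * i)
  u[2+2i] i = trans (cong u (2*suc i)) (trans (u-even (suc (2 * i)) (subst (2 ∣_) (2*suc i) (m∣m*n (suc i)))) (u[1+2i] i))

  u[2i]-factorial : ∀ i → u (2 * i) * (2 ^ i * i !) ≡ (2 * i) !
  u[2i]-factorial zero = refl
  u[2i]-factorial (suc i) = begin
    u (2 * suc i) * (2 * 2 ^ i * (suc i * i !))        ≡⟨ cong (_* (2 * 2 ^ i * (suc i * i !))) (u[2+2i] i) ⟩
    u (2 * i) * suc (2 * i) * (2 * 2 ^ i * (suc i * i !)) ≡⟨ rearr (u (2 * i)) i (2 ^ i) (i !) ⟩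
    (2 + 2 * i) * (suc (2 * i) * (u (2 * i) * (2 ^ i * i !))) ≡⟨ cong (λ z → (2 + 2 * i) * (suc (2 * i) * z)) (u[2i]-factorial i) ⟩
    (2 + 2 * i) !                                      ≡⟨ cong _! (sym (2*suc i)) ⟩
    (2 * suc i) !                                      ∎
    where
    open ≡-Reasoning
    rearr : ∀ a i x y → a * suc (2 * i) * (2 * x * (suc i * y)) ≡ (2 + 2 * i) * (suc (2 * i) * (a * (x * y)))
    rearr = solve-∀

  u[1+2i]-factorial : ∀ i → u (suc (2 * i)) * (2 ^ i * i !) ≡ (suc (2 * i)) !
  u[1+2i]-factorial i = trans (cong (_* (2 ^ i * i !)) (u[1+2i] i))
    (trans (rearr (u (2 * i)) (suc (2 * i)) (2 ^ i * i !)) (cong (suc (2 * i) *_) (u[2i]-factorial i)))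
    where
    rearr : ∀ a s x → a * s * x ≡ s * (a * x)
    rearr = solve-∀

  u-∣ : ∀ n → u n ∣ u (suc n)
  u-∣ n with 2 ∣? suc n
  ... | yes even = ∣-reflexive (sym (u-even n even))
  ... | no odd   = divides (suc n) (trans (u-odd n odd) (*-comm (u n) (suc n)))

  odd∣u : ∀ {p} n → 2 ∤ p → p ≤ n → p ∣ u n
  odd∣u zero odd p≤0 rewrite n≤0⇒n≡0 p≤0 = contradiction (2 ∣0) odd
  odd∣u (suc n) odd p≤ with m≤n⇒m<n∨m≡n p≤
  ... | inj₁ p<   = ∣-trans (odd∣u n odd (s≤s⁻¹ p<)) (u-∣ n)
  ... | inj₂ refl = divides (u n) (u-odd n odd)

  prime∤2 : ∀ {p} → Prime p → 2 < p → 2 ∤ p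
  prime∤2 pr 2<p d with prime⇒irreducible pr d
  ... | inj₁ ()
  ... | inj₂ refl = <-irrefl refl 2<p

  b : ℕ → ℕ → ℕ
  b m j = m C (2 * j) * u (2 * j)

  -- C(2n,2l) u(2l) u(2i) = C(n,i) u(2n) and C(2n+1,2l) u(2l) u(2i+1) = C(n,i) u(2n+1) for l + i = n.
  b-even : ∀ n l i → l + i ≡ n → b (2 * n) n ∣ b (2 * n) l * u (2 * i)
  b-even n l i refl = divides (n C l) (*-cancelʳ-≡ _ _ X {{X≢0}} (begin
    (2 * n) C (2 * l) * u (2 * l) * u (2 * i) * X
      ≡⟨ r₁ ((2 * n) C (2 * l)) (u (2 * l)) (u (2 * i)) (2 ^ l * l !) (2 ^ i * i !) ⟩
    (2 * n) C (2 * l) * (u (2 * l) * (2 ^ l * l !) * (u (2 * i) * (2 ^ i * i !)))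
      ≡⟨ cong₂ (λ x y → (2 * n) C (2 * l) * (x * y)) (u[2i]-factorial l) (u[2i]-factorial i) ⟩
    (2 * n) C (2 * l) * ((2 * l) ! * (2 * i) !)
      ≡⟨ cong (λ z → z C (2 * l) * ((2 * l) ! * (2 * i) !)) (*-distribˡ-+ 2 l i) ⟩
    (2 * l + 2 * i) C (2 * l) * ((2 * l) ! * (2 * i) !)
      ≡⟨ trans (C-factorial (2 * i) (2 * l)) (cong _! (sym (*-distribˡ-+ 2 l i))) ⟩
    (2 * n) !
      ≡⟨ sym (u[2i]-factorial n) ⟩
    u (2 * n) * (2 ^ n * n !)
      ≡⟨ cong₂ (λ x y → u (2 * n) * (x * y)) (^-distribˡ-+-* 2 l i) (sym (C-factorial i l)) ⟩
    u (2 * n) * (2 ^ l * 2 ^ i * (n C l * (l ! * i !)))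
      ≡⟨ r₂ (u (2 * n)) (2 ^ l) (2 ^ i) (n C l) (l !) (i !) ⟩
    n C l * (1 * u (2 * n)) * X
      ≡⟨ cong (λ z → n C l * (z * u (2 * n)) * X) (sym (nCn≡1 (2 * n))) ⟩
    n C l * b (2 * n) n * X ∎))
    where
    open ≡-Reasoning
    X = (2 ^ l * l !) * (2 ^ i * i !)
    X≢0 : NonZero X
    X≢0 = m*n≢0 _ _ {{m*n≢0 _ _ {{m^n≢0 2 l}} {{l !≢0}}}} {{m*n≢0 _ _ {{m^n≢0 2 i}} {{i !≢0}}}}
    r₁ : ∀ a b c x y → a * b * c * (x * y) ≡ a * (b * x * (c * y))
    r₁ = solve-∀
    r₂ : ∀ u a b c x y → u * (a * b * (c * (x * y))) ≡ c * (1 * u) * (a * x * (b * y))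
    r₂ = solve-∀

  b-odd : ∀ n l i → l + i ≡ n → b (suc (2 * n)) n ∣ b (suc (2 * n)) l * u (suc (2 * i))
  b-odd n l i refl = divides (n C l) (*-cancelʳ-≡ _ _ X {{X≢0}} (begin
    m C (2 * l) * u (2 * l) * u (suc (2 * i)) * X
      ≡⟨ r₁ (m C (2 * l)) (u (2 * l)) (u (suc (2 * i))) (2 ^ l * l !) (2 ^ i * i !) ⟩
    m C (2 * l) * (u (2 * l) * (2 ^ l * l !) * (u (suc (2 * i)) * (2 ^ i * i !)))
      ≡⟨ cong₂ (λ x y → m C (2 * l) * (x * y)) (u[2i]-factorial l) (u[1+2i]-factorial i) ⟩
    m C (2 * l) * ((2 * l) ! * (suc (2 * i)) !)
      ≡⟨ cong (λ z → z C (2 * l) * ((2 * l) ! * (suc (2 * i)) !)) m≡ ⟩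
    (2 * l + suc (2 * i)) C (2 * l) * ((2 * l) ! * (suc (2 * i)) !)
      ≡⟨ trans (C-factorial (suc (2 * i)) (2 * l)) (cong _! (sym m≡)) ⟩
    m !
      ≡⟨ sym (u[1+2i]-factorial n) ⟩
    u m * (2 ^ n * n !)
      ≡⟨ cong₂ (λ x y → u m * (x * y)) (^-distribˡ-+-* 2 l i) (sym (C-factorial i l)) ⟩
    u m * (2 ^ l * 2 ^ i * (n C l * (l ! * i !)))
      ≡⟨ r₂ (u m) (2 ^ l) (2 ^ i) (n C l) (l !) (i !) ⟩
    n C l * u m * X
      ≡⟨ cong (λ z → n C l * z * X) (sym bn) ⟩
    n C l * b m n * X ∎))
    where
    open ≡-Reasoning
    m = suc (2 * n)
    X = (2 ^ l * l !) * (2 ^ i * i !)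
    X≢0 : NonZero X
    X≢0 = m*n≢0 _ _ {{m*n≢0 _ _ {{m^n≢0 2 l}} {{l !≢0}}}} {{m*n≢0 _ _ {{m^n≢0 2 i}} {{i !≢0}}}}
    m≡ : suc (2 * (l + i)) ≡ 2 * l + suc (2 * i)
    m≡ = trans (cong suc (*-distribˡ-+ 2 l i)) (sym (+-suc (2 * l) (2 * i)))
    bn : b m n ≡ u m
    bn = trans (cong (_* u (2 * n)) (trans (nCk≡nC[n∸k] (n≤1+n (2 * n))) (trans (cong (m C_) (m+n∸n≡m 1 (2 * n))) (nC1≡n m))))
      (trans (*-comm m (u (2 * n))) (sym (u[1+2i] n)))
    r₁ : ∀ a b c x y → a * b * c * (x * y) ≡ a * (b * x * (c * y))
    r₁ = solve-∀
    r₂ : ∀ u a b c x y → u * (a * b * (c * (x * y))) ≡ c * u * (a * x * (b * y))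
    r₂ = solve-∀

  u>0 : ∀ n → 0 < u n
  u>0 zero = z<s
  u>0 (suc n) with 2 ∣? suc n
  ... | yes even = subst (0 <_) (sym (u-even n even)) (u>0 n)
  ... | no odd   = subst (0 <_) (sym (u-odd n odd)) (*-mono-< (u>0 n) (z<s {n}))

  b>0 : ∀ m j → 2 * j ≤ m → 0 < b m j
  b>0 m j 2j≤m = *-mono-< (nCk>0 2j≤m) (u>0 (2 * j))

  -- As long as 2j < p, divisibility passes from C(m,2t) to C(m,2j); from 2j ≥ p on, the odd prime p
  -- is a factor of u_{2j}.
  prime∣b : ∀ {p m t} → Prime p → 2 < p → t + t < p → p ∣ m C (t + t) → ∀ j → t ≤ j → p ∣ b m j
  prime∣b {p} {m} {t} pr 2<p 2t<p d j t≤j with ≤-<-connex p (2 * j)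
  ... | inj₁ p≤2j = ∣n⇒∣m*n (m C (2 * j)) (odd∣u (2 * j) (prime∤2 pr 2<p) p≤2j)
  ... | inj₂ 2j<p = ∣m⇒∣m*n (u (2 * j)) (prime∣nC-mono pr (subst (t + t ≤_) (cong (j +_) (sym (+-identityʳ j))) (+-mono-≤ t≤j t≤j)) 2j<p d)

  -- Turns `b-even` and `b-odd` into lower bounds for the order of p in b_j: with x = b_n, y = b_j
  -- and z a value of u, it is at least V minus the order g of p in z, and Legendre's bound applies
  -- to g because z divides a factorial.
  valuation-split : ∀ p′ → Prime (suc p′) → ∀ V {x y z} M → suc p′ ^ V ∣ x → x ∣ y * z → z ∣ M ! → 0 < M → 0 < z →
                    ∃₂ λ e g → suc p′ ^ e ∣ y × V ≤ e + g × g * p′ < M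
  valuation-split p′ pr V {x} {y} {z} M V∣x x∣yz z∣M! M>0 z>0 with prime-split pr z z>0
  ... | g , z′ , refl , p∤z′ = V ∸ g , g , e∣ , subst (V ≤_) (+-comm g (V ∸ g)) (m≤n+m∸n V g) , prime^∣!⇒< p′ pr M g M>0 (∣-trans (m∣m*n z′) z∣M!)
    where
    p = suc p′
    d : p ^ V ∣ y * p ^ g
    d = prime^-cancelʳ pr V (y * p ^ g) p∤z′ (subst (p ^ V ∣_) (sym (*-assoc y (p ^ g) z′)) (∣-trans V∣x x∣yz))
    e∣ : p ^ (V ∸ g) ∣ y
    e∣ with ≤-total V g
    ... | inj₁ V≤g = subst (λ n → p ^ n ∣ y) (sym (m≤n⇒m∸n≡0 V≤g)) (1∣ y)
    ... | inj₂ g≤V = *-cancelʳ-∣ (p ^ g) {{m^n≢0 p g}} (subst (_∣ y * p ^ g)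
      (trans (cong (p ^_) (sym (m∸n+n≡m g≤V))) (^-distribˡ-+-* p (V ∸ g) g)) d)

  -- The weights W of p and w of φ are such that, in the φ-adic expansion of H, the term of index 0
  -- has minimal weight, whereas a monic polynomial in φ of degree k ≤ min (2t) n has weight less than W.
  record Witness (β : ℕ → ℕ) (m n t : ℕ) : Set where
    field
      p       : ℕ
      p-prime : Prime p
      p≤m     : p ≤ m
      p∣β     : ∀ j → t ≤ j → p ∣ β j
      W w V   : ℕ
      light   : ∀ k → k ≤ t + t → k ≤ n → k * w < W
      V∣β     : p ^ V ∣ β n
      V∤β     : p ^ suc V ∤ β n
      heavy   : ∀ j i → j + i ≡ n → 0 < i → ∃ λ e → p ^ e ∣ β j × W * V ≤ W * e + w * (2 * i)

  -- The primes and weights for even and odd m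

  exact-power : ∀ {p} → Prime p → ∀ n → 0 < n → ∃ λ V → p ^ V ∣ n × p ^ suc V ∤ n
  exact-power {p} pr n n>0 with prime-split pr n n>0
  ... | V , n′ , refl , p∤n′ = V , m∣m*n n′ , λ d → <⇒≱ (n<1+n V) (prime^-∣-≤ pr (suc V) V p∤n′ d)

  p∣C⇒p≤m : ∀ {p m k} → Prime p → 0 < k → k ≤ m → p ∣ m C k → p ≤ m
  p∣C⇒p≤m {p} {m} {k} pr k>0 k≤m d = subst (_≤ m) (*-identityʳ p)
    (prime^∣nCk⇒≤ pr 1 k>0 k≤m (subst (_∣ m C k) (sym (*-identityʳ p)) d))

  -- From g (p - 1) ≤ 2i - 1 and 2i ≤ N follows N g (p - 1) ≤ (N - 1) 2i, so the slopes are at most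
  -- w / W = (N - 1) / (N (p - 1)). Being below 1 / (p - 1), this still makes φ-degree p - 1 light,
  -- which occurs when p = 2t + 1.
  witness-even : ∀ n t → 2 ≤ n → 1 ≤ t → t + t ≤ suc n → ∀ p → Prime p → t + t < p → p ∣ (2 * n) C (t + t) → Witness (b (2 * n)) (2 * n) n t
  witness-even n t 2≤n 1≤t 2t≤1+n (suc q) pr 2t<p d with exact-power pr (b (2 * n) n) (b>0 (2 * n) n ≤-refl)
  ... | V , V∣ , V∤ = record
    { p = suc q ; p-prime = pr
    ; p≤m = p∣C⇒p≤m pr (≤-trans 1≤t (m≤m+n t t)) 2t≤m d
    ; p∣β = prime∣b {t = t} pr (≤-<-trans (+-mono-≤ 1≤t 1≤t) 2t<p) 2t<p d
    ; W = q * N ; w = N ∸ 1 ; V = V ; light = light ; V∣β = V∣ ; V∤β = V∤ ; heavy = heavy }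
    where
    open ≤-Reasoning
    N = 2 * n
    N≡ : suc (N ∸ 1) ≡ N
    N≡ = m+[n∸m]≡n (≤-trans (≤-trans z<s 2≤n) (m≤m+n n (n + 0)))
    2t≤m : t + t ≤ 2 * n
    2t≤m = ≤-trans 2t≤1+n (+-mono-≤ (≤-trans (n≤1+n 1) 2≤n) (m≤m+n n 0))
    light : ∀ k → k ≤ t + t → k ≤ n → k * (N ∸ 1) < q * N
    light k k≤2t _ = begin-strict
      k * (N ∸ 1)   ≤⟨ *-monoˡ-≤ (N ∸ 1) (≤-trans k≤2t (s≤s⁻¹ 2t<p)) ⟩
      q * (N ∸ 1)   <⟨ *-monoʳ-< q {{>-nonZero q>0}} (subst (N ∸ 1 <_) N≡ (n<1+n (N ∸ 1))) ⟩
      q * N         ∎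
      where
      q>0 : 0 < q
      q>0 = <-≤-trans z<s (≤-trans (+-mono-≤ 1≤t 1≤t) (s≤s⁻¹ 2t<p))
    heavy : ∀ j i → j + i ≡ n → 0 < i → ∃ λ e → suc q ^ e ∣ b (2 * n) j × q * N * V ≤ q * N * e + (N ∸ 1) * (2 * i)
    heavy j i j+i≡n i>0 with valuation-split q pr V (2 * i) V∣ (b-even n j i j+i≡n)
                           (divides (2 ^ i * i !) (trans (sym (u[2i]-factorial i)) (*-comm (u (2 * i)) (2 ^ i * i !))))
                           (≤-trans i>0 (m≤m+n i (i + 0))) (u>0 (2 * i))
    ... | e , g , e∣ , V≤ , gq< = e , e∣ , (begin
      q * N * V                         ≤⟨ *-monoʳ-≤ (q * N) V≤ ⟩
      q * N * (e + g)                   ≡⟨ r₁ q N e g ⟩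
      q * N * e + N * (g * q)           ≤⟨ +-monoʳ-≤ (q * N * e) key ⟩
      q * N * e + (N ∸ 1) * (2 * i)     ∎)
      where
      r₁ : ∀ q N e g → q * N * (e + g) ≡ q * N * e + N * (g * q)
      r₁ = solve-∀
      key : N * (g * q) ≤ (N ∸ 1) * (2 * i)
      key = +-cancelʳ-≤ N (N * (g * q)) ((N ∸ 1) * (2 * i)) (begin
        N * (g * q) + N                 ≡⟨ trans (+-comm (N * (g * q)) N) (sym (*-suc N (g * q))) ⟩
        N * suc (g * q)                 ≤⟨ *-monoʳ-≤ N gq< ⟩
        N * (2 * i)                     ≡⟨ cong (_* (2 * i)) (sym N≡) ⟩
        2 * i + (N ∸ 1) * (2 * i)       ≤⟨ +-monoˡ-≤ ((N ∸ 1) * (2 * i)) (*-monoʳ-≤ 2 (subst (i ≤_) j+i≡n (m≤n+m i j))) ⟩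
        N + (N ∸ 1) * (2 * i)           ≡⟨ +-comm N _ ⟩
        (N ∸ 1) * (2 * i) + N           ∎)

  -- Legendre's bound for u_{2i+1} is g (p - 1) < 2i + 1, which leaves the slope 1 / (p - 1), that
  -- is W = p - 1 and w = 1. Lightness is strict, so the φ-degrees k in question must not exceed p -
  -- 2; hence the hypothesis `big`.
  witness-odd : ∀ n t → 1 ≤ t → t + t ≤ suc n → ∀ p → Prime p → t + t < p → (∀ k → k ≤ t + t → k ≤ n → 2 + k ≤ p) →
                p ∣ (suc (2 * n)) C (t + t) → Witness (b (suc (2 * n))) (suc (2 * n)) n t
  witness-odd n t 1≤t 2t≤1+n (suc q) pr 2t<p big d with exact-power pr (b (suc (2 * n)) n) (b>0 (suc (2 * n)) n (n≤1+n (2 * n)))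
  ... | V , V∣ , V∤ = record
    { p = suc q ; p-prime = pr
    ; p≤m = p∣C⇒p≤m pr (≤-trans 1≤t (m≤m+n t t)) (≤-trans 2t≤1+n (s≤s (m≤m+n n (n + 0)))) d
    ; p∣β = prime∣b {t = t} pr (≤-<-trans (+-mono-≤ 1≤t 1≤t) 2t<p) 2t<p d
    ; W = q ; w = 1 ; V = V
    ; light = λ k k≤2t k≤n → subst (_< q) (sym (*-identityʳ k)) (s≤s⁻¹ (big k k≤2t k≤n))
    ; V∣β = V∣ ; V∤β = V∤ ; heavy = heavy }
    where
    open ≤-Reasoning
    heavy : ∀ j i → j + i ≡ n → 0 < i → ∃ λ e → suc q ^ e ∣ b (suc (2 * n)) j × q * V ≤ q * e + 1 * (2 * i)
    heavy j i j+i≡n i>0 with valuation-split q pr V (suc (2 * i)) V∣ (b-odd n j i j+i≡n)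
                           (divides (2 ^ i * i !) (trans (sym (u[1+2i]-factorial i)) (*-comm (u (suc (2 * i))) (2 ^ i * i !))))
                           z<s (u>0 (suc (2 * i)))
    ... | e , g , e∣ , V≤ , gq< = e , e∣ , (begin
      q * V               ≤⟨ *-monoʳ-≤ q V≤ ⟩
      q * (e + g)         ≡⟨ r₁ q e g ⟩
      q * e + g * q       ≤⟨ +-monoʳ-≤ (q * e) (s≤s⁻¹ gq<) ⟩
      q * e + 2 * i       ≡⟨ cong (q * e +_) (sym (*-identityˡ (2 * i))) ⟩
      q * e + 1 * (2 * i) ∎)
      where
      r₁ : ∀ q e g → q * (e + g) ≡ q * e + g * q
      r₁ = solve-∀

  -- Sylvester's theorem for C(4t′,2t′) with t′ = t - 1 gives a prime p with 2t ≤ p ≤ 4t - 4, and p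
  -- = 2t is excluded by parity. For t = 2 this would need t′ = 1, so the prime 5 is given directly.
  bertrand : ∀ t → 2 ≤ t → ∃ λ p → Prime p × t + t < p × 2 + p ≤ (t + t) + (t + t)
  bertrand (suc (suc zero)) _ = 5 , from-yes (prime? 5) , ≤-refl , ≤ᵇ⇒≤ 7 8 tt
  bertrand (suc zero) (s≤s ())
  bertrand t@(suc t′@(suc (suc t″))) _ with sylvester ((t′ + t′) + (t′ + t′)) t′ (s≤s (s≤s z≤n)) ≤-refl
  ... | p , pr , k+2≤p , d = p , pr , ≤∧≢⇒< k≤p k≢p , subst (2 + p ≤_) (sym (4t t′)) (≤-trans (+-monoʳ-≤ 2 p≤) (m≤n+m _ 2))
    where
    4t : ∀ t′ → (suc t′ + suc t′) + (suc t′ + suc t′) ≡ 2 + (2 + ((t′ + t′) + (t′ + t′)))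
    4t = solve-∀
    k≤p : t + t ≤ p
    k≤p = subst (_≤ p) (cong suc (sym (+-suc t′ t′))) k+2≤p
    k≢p : t + t ≢ p
    k≢p refl with prime⇒irreducible pr {2} (divides t (trans (cong (t +_) (sym (+-identityʳ t))) (*-comm 2 t)))
    ... | inj₁ ()
    ... | inj₂ ()
    p≤ : p ≤ (t′ + t′) + (t′ + t′)
    p≤ = p∣C⇒p≤m pr z<s (m≤m+n (t′ + t′) (t′ + t′)) d

  Good : ℕ → ℕ → ℕ → Set
  Good m n t = ∃ λ p → Prime p × t + t < p × (∀ k → k ≤ t + t → k ≤ n → 2 + k ≤ p) × p ∣ m C (t + t)

  -- If 4t > m then 2t ≤ n + 1 forces 2t = n + 1. The prime p of `bertrand` lies in (2t, m] and
  -- exceeds m - 2t as well, so it divides C(m,2t); and k ≤ n gives k + 2 ≤ 2t + 1 ≤ p.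
  good : ∀ m n t → 2 ≤ t → t + t ≤ suc n → n + n ≤ m → m ≤ suc (n + n) → Good m n t
  good m n t 2≤t 2t≤1+n 2n≤m m≤ with ≤-<-connex ((t + t) + (t + t)) m
  ... | inj₁ 4t≤m with sylvester m t 2≤t 4t≤m
  ...   | p , pr , k+2≤p , d = p , pr , ≤-trans (n≤1+n _) k+2≤p , (λ k k≤2t _ → ≤-trans (+-monoʳ-≤ 2 k≤2t) k+2≤p) , d
  good m n t 2≤t 2t≤1+n 2n≤m m≤ | inj₂ m<4t with bertrand t 2≤t
  ... | p , pr , 2t<p , p+2≤4t = p , pr , 2t<p , (λ k _ k≤n → ≤-trans (s≤s (≤-trans (s≤s k≤n) 1+n≤2t)) 2t<p) ,
        prime∣nCk pr 2t≤m p≤m 2t<p m∸2t<p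
    where
    n<2t : n < t + t
    n<2t with ≤-<-connex (t + t) n
    ... | inj₁ 2t≤n = contradiction m<4t (≤⇒≯ (≤-trans (+-mono-≤ 2t≤n 2t≤n) 2n≤m))
    ... | inj₂ lt = lt
    1+n≤2t : suc n ≤ t + t
    1+n≤2t = n<2t
    1+n≡2t : suc n ≡ t + t
    1+n≡2t = ≤-antisym n<2t 2t≤1+n
    p≤m : p ≤ m
    p≤m = ≤-trans (s≤s⁻¹ (s≤s⁻¹ (subst (2 + p ≤_) (trans (cong₂ _+_ (sym 1+n≡2t) (sym 1+n≡2t)) (cong suc (+-suc n n))) p+2≤4t))) 2n≤m
    2t≤m : t + t ≤ m
    2t≤m = ≤-trans (<⇒≤ 2t<p) p≤m
    m∸2t<p : m ∸ (t + t) < p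
    m∸2t<p = <-trans (subst (_≤ t + t) (+-∸-assoc 1 2t≤m) (≤-trans (∸-monoˡ-≤ (t + t) m<4t) (≤-reflexive (m+n∸m≡n (t + t) (t + t))))) 2t<p

  prime≢2⇒3≤ : ∀ {p} → Prime p → p ≢ 2 → 3 ≤ p
  prime≢2⇒3≤ pr p≢2 = ≤∧≢⇒< (prime>1 pr) (p≢2 ∘′ sym)
    where
    _∘′_ : ∀ {A B C : Set} → (B → C) → (A → B) → A → C
    (f ∘′ g) x = f (g x)

  -- For t = 1 the coefficient is C(2n,2) = n (2n - 1), and every prime factor of the odd number 2n
  -- - 1 ≥ 3 is greater than 2t = 2.
  witness₀ : ∀ n t → 2 ≤ n → 1 ≤ t → t + t ≤ suc n → Witness (b (2 * n)) (2 * n) n t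
  witness₀ n (suc zero) 2≤n 1≤t 2t≤ with prime-divisor (pred (2 * n)) 1<
    where
    1< : 1 < pred (2 * n)
    1< = pred-mono-≤ (≤-trans (n≤1+n 3) (*-monoʳ-≤ 2 2≤n))
  ... | p , pr , d = witness-even n 1 2≤n 1≤t 2t≤ p pr 3≤p
    (prime∣m∸i⇒∣mCk {i = 1} pr (*-monoʳ-≤ 2 (≤-trans (n≤1+n 1) 2≤n)) 3≤p (s≤s (s≤s z≤n)) d)
    where
    3≤p : 3 ≤ p
    3≤p = prime≢2⇒3≤ pr λ { refl → prime∤1 prime[2] (∣m+n∣m⇒∣n (subst (2 ∣_) (trans (sym (m+[n∸m]≡n (≤-trans (≤-trans (n≤1+n 1) 2≤n) (m≤m+n n (n + 0))))) (+-comm 1 _)) (m∣m*n n)) d) }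
  witness₀ n t@(suc (suc _)) 2≤n 1≤t 2t≤ with good (2 * n) n t (s≤s (s≤s z≤n)) 2t≤
      (+-monoʳ-≤ n (m≤m+n n 0)) (m≤n⇒m≤1+n (≤-reflexive (cong (n +_) (+-identityʳ n))))
  ... | p , pr , 2t<p , _ , d = witness-even n t 2≤n 1≤t 2t≤ p pr 2t<p d

  -- For t = 1 and n ≥ 2 the prime divides the part of m prime to 3; it is odd and not 3, so it
  -- meets the demand p ≥ 4 that `witness-odd` makes for k = 2. If that part is 1, then m is a power
  -- of 3, with exponent at least 2 because m ≥ 5.
  witness₁ : ∀ n t → 1 ≤ n → (∀ k → 2 ≤ k → suc (2 * n) ≢ 3 ^ k) → 1 ≤ t → t + t ≤ suc n → Witness (b (suc (2 * n))) (suc (2 * n)) n t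
  -- For m = 3 the prime 3 = C(3,2) is large enough, because k ≤ n = 1.
  witness₁ (suc zero) (suc zero) _ _ 1≤t 2t≤ = witness-odd 1 1 1≤t 2t≤ 3 (from-yes (prime? 3)) ≤-refl (λ k _ k≤1 → +-monoʳ-≤ 2 k≤1) (divides 1 refl)
  witness₁ n@(suc (suc n″)) (suc zero) _ ≢3^ 1≤t 2t≤ with prime-split (from-yes (prime? 3)) (suc (2 * n)) z<s
  ... | e , zero , m≡ , 3∤ = contradiction (3 ∣0) 3∤
  ... | e , suc zero , m≡ , 3∤ = contradiction (trans m≡ (*-identityʳ (3 ^ e))) (≢3^ e (2≤e e m≡))
    where
    2≤e : ∀ e → suc (2 * n) ≡ 3 ^ e * 1 → 2 ≤ e
    2≤e zero ()
    2≤e (suc zero) eq = contradiction (≤-trans (s≤s (*-monoʳ-≤ 2 {2} {n} (s≤s (s≤s z≤n)))) (≤-reflexive eq)) (<⇒≱ (≤ᵇ⇒≤ 4 5 tt))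
    2≤e (suc (suc e)) _ = s≤s (s≤s z≤n)
  ... | e , m′@(suc (suc _)) , m≡ , 3∤ with prime-divisor m′ (s≤s (s≤s z≤n))
  ...   | p , pr , p∣m′ = witness-odd n 1 1≤t 2t≤ p pr (≤-trans (n≤1+n 3) 4≤p) (λ k k≤2 _ → ≤-trans (+-monoʳ-≤ 2 k≤2) 4≤p)
          (prime∣m∸i⇒∣mCk {i = 0} pr (s≤s (s≤s z≤n)) (≤-trans (n≤1+n 3) 4≤p) z<s p∣m)
    where
    p∣m : p ∣ suc (2 * n)
    p∣m = subst (p ∣_) (sym m≡) (∣n⇒∣m*n (3 ^ e) p∣m′)
    4≤p : 4 ≤ p
    4≤p = ≤∧≢⇒< (prime≢2⇒3≤ pr λ { refl → 2∤1+2* n p∣m }) λ { refl → 3∤ p∣m′ }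
  witness₁ n t@(suc (suc _)) _ _ 1≤t 2t≤ with good (suc (2 * n)) n t (s≤s (s≤s z≤n)) 2t≤
      (m≤n⇒m≤1+n (+-monoʳ-≤ n (m≤m+n n 0))) (s≤s (≤-reflexive (cong (n +_) (+-identityʳ n))))
  ... | p , pr , 2t<p , big , d = witness-odd n t 1≤t 2t≤ p pr 2t<p big d

-- The commutative ring of polynomials over a commutative ring

module PolynomialRing {c ℓ} (R : CommutativeRing c ℓ) where

  import Algebra.Properties.CommutativeSemigroup as CommutativeSemigroupProperties
  import Algebra.Properties.Ring as RingProperties
  open import Data.List.Base using ([]; _∷_; map)
  open import Data.Nat.Base using (zero; suc)
  open import Data.Product.Base using (_,_)
  import Defs

  open CommutativeRing R
  open RingProperties ring using (-0#≈0#)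
  open Defs.Polynomial (Semiring.rawSemiring semiring) using (Poly; coeff; _≈ₚ_; _+ₚ_; _*ₚ_; _•_)

  infix 4 _≋_

  -- A record, so that f and g can be inferred from a proof of f ≋ g.
  record _≋_ (f g : Poly) : Set ℓ where
    constructor ⟨_⟩
    field at : f ≈ₚ g

  open _≋_ public

  -ₚ_ : Poly → Poly
  -ₚ_ = map (-_)

  ≋-refl : ∀ {f} → f ≋ f
  ≋-refl = ⟨ (λ k → refl) ⟩

  ≋-sym : ∀ {f g} → f ≋ g → g ≋ f
  ≋-sym p = ⟨ (λ k → sym (at p k)) ⟩

  ≋-trans : ∀ {f g h} → f ≋ g → g ≋ h → f ≋ h
  ≋-trans p q = ⟨ (λ k → trans (at p k) (at q k)) ⟩

  ∷-cong : ∀ {a b f g} → a ≈ b → f ≋ g → (a ∷ f) ≋ (b ∷ g)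
  ∷-cong p q = ⟨ (λ { zero → p ; (suc k) → at q k }) ⟩

  coeff-+ : ∀ f g k → coeff (f +ₚ g) k ≈ coeff f k + coeff g k
  coeff-+ []      g       k       = sym (+-identityˡ _)
  coeff-+ (a ∷ f) []      k       = sym (+-identityʳ _)
  coeff-+ (a ∷ f) (b ∷ g) zero    = refl
  coeff-+ (a ∷ f) (b ∷ g) (suc k) = coeff-+ f g k

  coeff-• : ∀ a f k → coeff (a • f) k ≈ a * coeff f k
  coeff-• a []      k       = sym (zeroʳ a)
  coeff-• a (b ∷ f) zero    = refl
  coeff-• a (b ∷ f) (suc k) = coeff-• a f k

  coeff-neg : ∀ f k → coeff (-ₚ f) k ≈ - coeff f k
  coeff-neg []      k       = sym -0#≈0#
  coeff-neg (b ∷ f) zero    = refl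
  coeff-neg (b ∷ f) (suc k) = coeff-neg f k

  +ₚ-cong : ∀ {f f′ g g′} → f ≋ f′ → g ≋ g′ → (f +ₚ g) ≋ (f′ +ₚ g′)
  +ₚ-cong {f} {f′} {g} {g′} p q = ⟨ (λ k → trans (coeff-+ f g k) (trans (+-cong (at p k) (at q k)) (sym (coeff-+ f′ g′ k)))) ⟩

  +ₚ-assoc : ∀ f g h → ((f +ₚ g) +ₚ h) ≋ (f +ₚ (g +ₚ h))
  +ₚ-assoc f g h = ⟨ (λ k → trans (coeff-+ (f +ₚ g) h k) (trans (+-congʳ (coeff-+ f g k)) (trans (+-assoc _ _ _)
    (sym (trans (coeff-+ f (g +ₚ h) k) (+-congˡ (coeff-+ g h k))))))) ⟩

  +ₚ-comm : ∀ f g → (f +ₚ g) ≋ (g +ₚ f)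
  +ₚ-comm f g = ⟨ (λ k → trans (coeff-+ f g k) (trans (+-comm _ _) (sym (coeff-+ g f k)))) ⟩

  +ₚ-identityˡ : ∀ f → ([] +ₚ f) ≋ f
  +ₚ-identityˡ f = ≋-refl

  +ₚ-identityʳ : ∀ f → (f +ₚ []) ≋ f
  +ₚ-identityʳ f = +ₚ-comm f []

  -ₚ-cong : ∀ {f g} → f ≋ g → (-ₚ f) ≋ (-ₚ g)
  -ₚ-cong {f} {g} p = ⟨ (λ k → trans (coeff-neg f k) (trans (-‿cong (at p k)) (sym (coeff-neg g k)))) ⟩

  -ₚ-inverseʳ : ∀ f → (f +ₚ (-ₚ f)) ≋ []
  -ₚ-inverseʳ f = ⟨ (λ k → trans (coeff-+ f (-ₚ f) k) (trans (+-congˡ (coeff-neg f k)) (-‿inverseʳ _))) ⟩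

  -ₚ-inverseˡ : ∀ f → ((-ₚ f) +ₚ f) ≋ []
  -ₚ-inverseˡ f = ≋-trans (+ₚ-comm (-ₚ f) f) (-ₚ-inverseʳ f)

  •-cong : ∀ {a b f g} → a ≈ b → f ≋ g → (a • f) ≋ (b • g)
  •-cong {a} {b} {f} {g} p q = ⟨ (λ k → trans (coeff-• a f k) (trans (*-cong p (at q k)) (sym (coeff-• b g k)))) ⟩

  •-distribˡ : ∀ a f g → (a • (f +ₚ g)) ≋ ((a • f) +ₚ (a • g))
  •-distribˡ a f g = ⟨ (λ k → trans (coeff-• a (f +ₚ g) k) (trans (*-congˡ (coeff-+ f g k)) (trans (distribˡ _ _ _)
    (sym (trans (coeff-+ (a • f) (a • g) k) (+-cong (coeff-• a f k) (coeff-• a g k))))))) ⟩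

  •-distribʳ : ∀ a b f → ((a + b) • f) ≋ ((a • f) +ₚ (b • f))
  •-distribʳ a b f = ⟨ (λ k → trans (coeff-• (a + b) f k) (trans (distribʳ _ _ _)
    (sym (trans (coeff-+ (a • f) (b • f) k) (+-cong (coeff-• a f k) (coeff-• b f k)))))) ⟩

  •-assoc : ∀ a b f → ((a * b) • f) ≋ (a • (b • f))
  •-assoc a b f = ⟨ (λ k → trans (coeff-• (a * b) f k) (trans (*-assoc _ _ _)
    (sym (trans (coeff-• a (b • f) k) (*-congˡ (coeff-• b f k)))))) ⟩

  •-zeroˡ : ∀ f → (0# • f) ≋ []
  •-zeroˡ f = ⟨ (λ k → trans (coeff-• 0# f k) (zeroˡ _)) ⟩

  •-identityˡ : ∀ f → (1# • f) ≋ f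
  •-identityˡ f = ⟨ (λ k → trans (coeff-• 1# f k) (*-identityˡ _)) ⟩

  0∷[]≋[] : (0# ∷ []) ≋ []
  0∷[]≋[] = ⟨ (λ { zero → refl ; (suc k) → refl }) ⟩

  +ₚ-commutativeSemigroup : CommutativeSemigroup c ℓ
  +ₚ-commutativeSemigroup = record
    { isCommutativeSemigroup = record
      { isSemigroup = record
        { isMagma = record
          { isEquivalence = record { refl = λ {f} → ≋-refl {f} ; sym = ≋-sym ; trans = ≋-trans }
          ; ∙-cong = +ₚ-cong }
        ; assoc = +ₚ-assoc }
      ; comm = +ₚ-comm } }

  open CommutativeSemigroupProperties +ₚ-commutativeSemigroup using (interchange; x∙yz≈y∙xz)

  *ₚ-zeroʳ : ∀ f → (f *ₚ []) ≋ []
  *ₚ-zeroʳ []      = ≋-refl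
  *ₚ-zeroʳ (a ∷ f) = ≋-trans (∷-cong refl (*ₚ-zeroʳ f)) 0∷[]≋[]

  *ₚ-congˡ : ∀ f {g g′} → g ≋ g′ → (f *ₚ g) ≋ (f *ₚ g′)
  *ₚ-congˡ []      p = ≋-refl
  *ₚ-congˡ (a ∷ f) p = +ₚ-cong (•-cong refl p) (∷-cong refl (*ₚ-congˡ f p))

  -- The mirror image of the defining clause of the product; commutativity is the comparison of the
  -- two.
  *ₚ-∷ʳ : ∀ f b g → (f *ₚ (b ∷ g)) ≋ ((b • f) +ₚ (0# ∷ (f *ₚ g)))
  *ₚ-∷ʳ []      b g = ≋-sym 0∷[]≋[]
  *ₚ-∷ʳ (a ∷ f) b g = ∷-cong (+-congʳ (*-comm a b))
    (≋-trans (+ₚ-cong ≋-refl (*ₚ-∷ʳ f b g)) (x∙yz≈y∙xz (a • g) (b • f) (0# ∷ (f *ₚ g))))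

  *ₚ-comm : ∀ f g → (f *ₚ g) ≋ (g *ₚ f)
  *ₚ-comm []      g = ≋-sym (*ₚ-zeroʳ g)
  *ₚ-comm (a ∷ f) g = ≋-trans (+ₚ-cong ≋-refl (∷-cong refl (*ₚ-comm f g))) (≋-sym (*ₚ-∷ʳ g a f))

  *ₚ-cong : ∀ {f f′ g g′} → f ≋ f′ → g ≋ g′ → (f *ₚ g) ≋ (f′ *ₚ g′)
  *ₚ-cong {f} {f′} {g} {g′} p q = ≋-trans (*ₚ-congˡ f q)
    (≋-trans (*ₚ-comm f g′) (≋-trans (*ₚ-congˡ g′ p) (*ₚ-comm g′ f′)))

  0∷-+ : ∀ f g → (0# ∷ (f +ₚ g)) ≋ ((0# ∷ f) +ₚ (0# ∷ g))
  0∷-+ f g = ∷-cong (sym (+-identityˡ 0#)) ≋-refl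

  *ₚ-distribʳ : ∀ h f g → ((f +ₚ g) *ₚ h) ≋ ((f *ₚ h) +ₚ (g *ₚ h))
  *ₚ-distribʳ h []      g       = ≋-refl
  *ₚ-distribʳ h (a ∷ f) []      = ≋-sym (+ₚ-identityʳ _)
  *ₚ-distribʳ h (a ∷ f) (b ∷ g) = ≋-trans
    (+ₚ-cong (•-distribʳ a b h) (≋-trans (∷-cong refl (*ₚ-distribʳ h f g)) (0∷-+ (f *ₚ h) (g *ₚ h))))
    (interchange (a • h) (b • h) (0# ∷ (f *ₚ h)) (0# ∷ (g *ₚ h)))

  *ₚ-distribˡ : ∀ h f g → (h *ₚ (f +ₚ g)) ≋ ((h *ₚ f) +ₚ (h *ₚ g))
  *ₚ-distribˡ h f g = ≋-trans (*ₚ-comm h (f +ₚ g)) (≋-trans (*ₚ-distribʳ h f g) (+ₚ-cong (*ₚ-comm f h) (*ₚ-comm g h)))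

  •-0∷ : ∀ a f → (a • (0# ∷ f)) ≋ (0# ∷ (a • f))
  •-0∷ a f = ∷-cong (zeroʳ a) ≋-refl

  •-*ₚ : ∀ a f g → ((a • f) *ₚ g) ≋ (a • (f *ₚ g))
  •-*ₚ a []      g = ≋-refl
  •-*ₚ a (b ∷ f) g = ≋-trans
    (+ₚ-cong (•-assoc a b g) (≋-trans (∷-cong refl (•-*ₚ a f g)) (≋-sym (•-0∷ a (f *ₚ g)))))
    (≋-sym (•-distribˡ a (b • g) (0# ∷ (f *ₚ g))))

  *ₚ-• : ∀ a f g → (f *ₚ (a • g)) ≋ (a • (f *ₚ g))
  *ₚ-• a f g = ≋-trans (*ₚ-comm f (a • g)) (≋-trans (•-*ₚ a g f) (•-cong refl (*ₚ-comm g f)))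

  0∷-*ₚ : ∀ f g → ((0# ∷ f) *ₚ g) ≋ (0# ∷ (f *ₚ g))
  0∷-*ₚ f g = +ₚ-cong (•-zeroˡ g) ≋-refl

  *ₚ-assoc : ∀ f g h → ((f *ₚ g) *ₚ h) ≋ (f *ₚ (g *ₚ h))
  *ₚ-assoc []      g h = ≋-refl
  *ₚ-assoc (a ∷ f) g h = ≋-trans (*ₚ-distribʳ h (a • g) (0# ∷ (f *ₚ g)))
    (+ₚ-cong (•-*ₚ a g h) (≋-trans (0∷-*ₚ (f *ₚ g) h) (∷-cong refl (*ₚ-assoc f g h))))

  [a]*ₚ : ∀ a f → ((a ∷ []) *ₚ f) ≋ (a • f)
  [a]*ₚ a f = ≋-trans (+ₚ-cong ≋-refl 0∷[]≋[]) (+ₚ-identityʳ (a • f))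

  *ₚ-identityˡ : ∀ f → ((1# ∷ []) *ₚ f) ≋ f
  *ₚ-identityˡ f = ≋-trans ([a]*ₚ 1# f) (•-identityˡ f)

  polynomialRing : CommutativeRing c ℓ
  polynomialRing = record
    { Carrier = Poly ; _≈_ = _≋_ ; _+_ = _+ₚ_ ; _*_ = _*ₚ_ ; -_ = -ₚ_ ; 0# = [] ; 1# = 1# ∷ []
    ; isCommutativeRing = record
      { isRing = record
        { +-isAbelianGroup = record
          { isGroup = record
            { isMonoid = record
              { isSemigroup = record
                { isMagma = record
                  { isEquivalence = record { refl = λ {f} → ≋-refl {f} ; sym = ≋-sym ; trans = ≋-trans }
                  ; ∙-cong = +ₚ-cong }
                ; assoc = +ₚ-assoc }
              ; identity = +ₚ-identityˡ , +ₚ-identityʳ }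
            ; inverse = -ₚ-inverseˡ , -ₚ-inverseʳ
            ; ⁻¹-cong = -ₚ-cong }
          ; comm = +ₚ-comm }
        ; *-cong = *ₚ-cong
        ; *-assoc = *ₚ-assoc
        ; *-identity = *ₚ-identityˡ , λ f → ≋-trans (*ₚ-comm f (1# ∷ [])) (*ₚ-identityˡ f)
        ; distrib = *ₚ-distribˡ , *ₚ-distribʳ }
      ; *-comm = *ₚ-comm } }

-- Newton polygons with respect to p and φ

module NewtonPolygon where

  import Algebra.Properties.Semiring.Exp as Exp
  import Algebra.Properties.Ring as RingProperties
  import Algebra.Solver.Ring.NaturalCoefficients.Default as NatSolver
  open import Data.Empty using (⊥)
  open import Data.List.Base using (List; []; _∷_)
  open import Data.Maybe.Base using (Maybe; just; nothing)
  open import Data.Nat.Base as ℕ using (ℕ; zero; suc; _≤_; _<_; s≤s; z≤n)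
  import Data.Nat.Properties as ℕ
  open import Data.Nat.Tactic.RingSolver using (solve-∀)
  open import Data.Product.Base using (∃; ∃₂; _×_; _,_)
  open import Data.Sum.Base using (_⊎_; inj₁; inj₂)
  open import Level using (_⊔_)
  open import Relation.Binary.PropositionalEquality.Core as ≡ using (_≡_)
  open import Relation.Nullary using (¬_; contradiction)

  module WeightArithmetic (W w : ℕ) where

    -- The weight of the monomial p^a φ^b. In `Above` and `AtLeast` ties of weight are broken by the
    -- exponent of φ; `Beyond v j` says that the monomial lies in the ideal (p^(v+1), φ^(j+1)),
    -- which the monomial p^v φ^j is to avoid.
    wt : ℕ → ℕ → ℕ
    wt a b = W ℕ.* a ℕ.+ w ℕ.* b

    Above : ℕ → ℕ → ℕ → ℕ → Set
    Above α j a b = α < wt a b ⊎ (α ≡ wt a b × j < b)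

    AtLeast : ℕ → ℕ → ℕ → ℕ → Set
    AtLeast α j a b = α < wt a b ⊎ (α ≡ wt a b × j ≤ b)

    Beyond : ℕ → ℕ → ℕ → ℕ → Set
    Beyond v j a b = v < a ⊎ j < b

    wt-+ : ∀ a b c d → wt (a ℕ.+ c) (b ℕ.+ d) ≡ wt a b ℕ.+ wt c d
    wt-+ = r W w
      where
      r : ∀ W w a b c d → W ℕ.* (a ℕ.+ c) ℕ.+ w ℕ.* (b ℕ.+ d) ≡ W ℕ.* a ℕ.+ w ℕ.* b ℕ.+ (W ℕ.* c ℕ.+ w ℕ.* d)
      r = solve-∀

    wt-mono : ∀ {a b c d} → a ≤ c → b ≤ d → wt a b ≤ wt c d
    wt-mono a≤c b≤d = ℕ.+-mono-≤ (ℕ.*-monoʳ-≤ W a≤c) (ℕ.*-monoʳ-≤ w b≤d)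

    wt-suc : ∀ a b → wt a (suc b) ≡ wt a b ℕ.+ w
    wt-suc = r W w
      where
      r : ∀ W w a b → W ℕ.* a ℕ.+ w ℕ.* suc b ≡ W ℕ.* a ℕ.+ w ℕ.* b ℕ.+ w
      r = solve-∀

    beyond-heavy : ∀ {v j a b} → wt v j < wt a b → Beyond v j a b
    beyond-heavy {v} {j} {a} {b} lt with ℕ.≤-<-connex a v | ℕ.≤-<-connex b j
    ... | inj₂ v<a | _        = inj₁ v<a
    ... | inj₁ _   | inj₂ j<b = inj₂ j<b
    ... | inj₁ a≤v | inj₁ b≤j = contradiction lt (ℕ.≤⇒≯ (wt-mono a≤v b≤j))

    above⇒atLeast : ∀ {α j a b} → Above α j a b → AtLeast α j a b
    above⇒atLeast (inj₁ lt)       = inj₁ lt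
    above⇒atLeast (inj₂ (eq , lt)) = inj₂ (eq , ℕ.<⇒≤ lt)

    -- This is what makes least monomials multiply: a cross term is heavier than the product of the
    -- least monomials or, at equal weight, has a larger exponent of φ, so it falls into the ideal
    -- avoided by that product.
    above+atLeast : ∀ {v₁ j₁ v₂ j₂} a b c d → Above (wt v₁ j₁) j₁ a b → AtLeast (wt v₂ j₂) j₂ c d →
                    Beyond (v₁ ℕ.+ v₂) (j₁ ℕ.+ j₂) (a ℕ.+ c) (b ℕ.+ d)
    above+atLeast {v₁} {j₁} {v₂} {j₂} a b c d P Q = cases P Q
      where
      heavy : wt v₁ j₁ ℕ.+ wt v₂ j₂ < wt a b ℕ.+ wt c d → Beyond (v₁ ℕ.+ v₂) (j₁ ℕ.+ j₂) (a ℕ.+ c) (b ℕ.+ d)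
      heavy lt = beyond-heavy (≡.subst₂ _<_ (≡.sym (wt-+ v₁ j₁ v₂ j₂)) (≡.sym (wt-+ a b c d)) lt)
      cases : Above (wt v₁ j₁) j₁ a b → AtLeast (wt v₂ j₂) j₂ c d → Beyond (v₁ ℕ.+ v₂) (j₁ ℕ.+ j₂) (a ℕ.+ c) (b ℕ.+ d)
      cases (inj₁ lt)       (inj₁ lt′)       = heavy (ℕ.+-mono-< lt lt′)
      cases (inj₁ lt)       (inj₂ (eq , _))  = heavy (ℕ.+-mono-<-≤ lt (ℕ.≤-reflexive eq))
      cases (inj₂ (eq , _)) (inj₁ lt)        = heavy (ℕ.+-mono-≤-< (ℕ.≤-reflexive eq) lt)
      cases (inj₂ (_ , lt)) (inj₂ (_ , le))  = inj₂ (ℕ.+-mono-<-≤ lt le)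

  module KeyPolynomial {c ℓ} (A : CommutativeRing c ℓ) (p φ : CommutativeRing.Carrier A) where

    open CommutativeRing A
    open Exp semiring public using (_^_)
    open Exp semiring using (^-homo-*)
    open RingProperties ring using (-‿distribʳ-*; -‿+-comm)
    open NatSolver commutativeSemiring using (solve; _:=_; _:+_; _:*_; con)

    +-∸ : ∀ {a b c} → a ≈ b + c → a + - c ≈ b
    +-∸ {a} {b} {c} eq = trans (+-congʳ eq) (trans (+-assoc b c (- c)) (trans (+-congˡ (-‿inverseʳ c)) (+-identityʳ b)))

    ∸-+ : ∀ {a b c} → a + - c ≈ b → a ≈ b + c
    ∸-+ {a} {b} {c} eq = sym (trans (+-congʳ (sym eq)) (trans (+-assoc a (- c) c) (trans (+-congˡ (-‿inverseˡ c)) (+-identityʳ a))))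

    *-∸ : ∀ x y z → x * (y + - z) ≈ x * y + - (x * z)
    *-∸ x y z = trans (distribˡ x y (- z)) (+-congˡ (sym (-‿distribʳ-* x z)))

    -- The ideal (p^a, φ^b).
    record I (a b : ℕ) (f : Carrier) : Set (c ⊔ ℓ) where
      constructor inI
      field
        {u v} : Carrier
        split : f ≈ p ^ a * u + φ ^ b * v

    I-resp : ∀ {a b f g} → f ≈ g → I a b f → I a b g
    I-resp eq (inI s) = inI (trans (sym eq) s)

    I-+ : ∀ {a b f g} → I a b f → I a b g → I a b (f + g)
    I-+ {a} {b} (inI {u} {v} s) (inI {u′} {v′} s′) = inI (trans (+-cong s s′)
      (solve 6 (λ P Q u v u′ v′ → (P :* u :+ Q :* v) :+ (P :* u′ :+ Q :* v′) := P :* (u :+ u′) :+ Q :* (v :+ v′)) refl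
        (p ^ a) (φ ^ b) u v u′ v′))

    I-* : ∀ {a b f} g → I a b f → I a b (g * f)
    I-* {a} {b} g (inI {u} {v} s) = inI (trans (*-congˡ s)
      (solve 5 (λ P Q u v g → g :* (P :* u :+ Q :* v) := P :* (g :* u) :+ Q :* (g :* v)) refl (p ^ a) (φ ^ b) u v g))

    I-neg : ∀ {a b f} → I a b f → I a b (- f)
    I-neg {a} {b} (inI {u} {v} s) = inI {u = - u} {v = - v} (trans (-‿cong s)
      (trans (sym (-‿+-comm _ _)) (+-cong (-‿distribʳ-* _ _) (-‿distribʳ-* _ _))))

    I-cancelʳ : ∀ {a b f g} → I a b (f + g) → I a b g → I a b f
    I-cancelʳ x y = I-resp (+-∸ refl) (I-+ x (I-neg y))

    I-cancelˡ : ∀ {a b f g} → I a b (f + g) → I a b f → I a b g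
    I-cancelˡ {f = f} {g} x y = I-cancelʳ (I-resp (+-comm f g) x) y

    ^-+ : ∀ x m n → x ^ (m ℕ.+ n) ≈ x ^ m * x ^ n
    ^-+ = ^-homo-*

    ^-≤ : ∀ x {m n} → m ≤ n → x ^ n ≈ x ^ m * x ^ (n ℕ.∸ m)
    ^-≤ x {m} {n} m≤n = trans (reflexive (≡.cong (x ^_) (≡.sym (ℕ.m+[n∸m]≡n m≤n)))) (^-+ x m (n ℕ.∸ m))

    I-p : ∀ {a b m} h → a ≤ m → I a b (p ^ m * h)
    I-p {a} {b} {m} h a≤m = inI {u = p ^ (m ℕ.∸ a) * h} {v = 0#} (trans (*-congʳ (^-≤ p a≤m))
      (trans (*-assoc _ _ _) (sym (trans (+-congˡ (zeroʳ _)) (+-identityʳ _)))))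

    I-φ : ∀ {a b m} h → b ≤ m → I a b (φ ^ m * h)
    I-φ {a} {b} {m} h b≤m = inI {u = 0#} {v = φ ^ (m ℕ.∸ b) * h} (trans (*-congʳ (^-≤ φ b≤m))
      (trans (*-assoc _ _ _) (sym (trans (+-congʳ (zeroʳ _)) (+-identityˡ _)))))

    I-anti : ∀ {a b a′ b′ f} → a ≤ a′ → b ≤ b′ → I a′ b′ f → I a b f
    I-anti a≤ b≤ (inI {u} {v} s) = I-resp (sym s) (I-+ (I-p u a≤) (I-φ v b≤))

    I-0 : ∀ {a b} → I a b 0#
    I-0 = I-resp (zeroʳ _) (I-p 0# ℕ.≤-refl)

    I-*-1 : ∀ {a a′ f g} → I a 1 f → I a′ 1 g → I (a ℕ.+ a′) 1 (f * g)
    I-*-1 {a} {a′} (inI {u} {v} s) (inI {u′} {v′} s′) = inI (trans (*-cong s s′) (trans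
      (solve 7 (λ P P′ Q u v u′ v′ → (P :* u :+ Q :* v) :* (P′ :* u′ :+ Q :* v′)
        := (P :* P′) :* (u :* u′) :+ Q :* (v :* (P′ :* u′ :+ Q :* v′) :+ P :* u :* v′)) refl
        (p ^ a) (p ^ a′) (φ ^ 1) u v u′ v′)
      (+-congʳ (*-congʳ (sym (^-+ p a a′))))))

    -- Sums of monomials p^a φ^b with arbitrary cofactors h. There is no constructor for the empty
    -- sum, so 0 enters as a monomial with cofactor 0.
    data Span (P : ℕ → ℕ → Set) : Carrier → Set (c ⊔ ℓ) where
      mono : ∀ {f} a b h → P a b → f ≈ p ^ a * (φ ^ b * h) → Span P f
      plus : ∀ {f g h} → Span P g → Span P h → f ≈ g + h → Span P f

    Span-⊆ : ∀ {P Q f} → (∀ a b → P a b → Q a b) → Span P f → Span Q f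
    Span-⊆ s (mono a b h Pab eq) = mono a b h (s a b Pab) eq
    Span-⊆ s (plus x y eq)       = plus (Span-⊆ s x) (Span-⊆ s y) eq

    Span-resp : ∀ {P f g} → f ≈ g → Span P f → Span P g
    Span-resp eq (mono a b h Pab e) = mono a b h Pab (trans (sym eq) e)
    Span-resp eq (plus x y e)       = plus x y (trans (sym eq) e)

    Span-* : ∀ {P Q S f g} → (∀ a b c d → P a b → Q c d → S (a ℕ.+ c) (b ℕ.+ d)) → Span P f → Span Q g → Span S (f * g)
    Span-* s (plus x y eq) z = plus (Span-* s x z) (Span-* s y z) (trans (*-congʳ eq) (distribʳ _ _ _))
    Span-* s x@(mono _ _ _ _ _) (plus y z eq) = plus (Span-* s x y) (Span-* s x z) (trans (*-congˡ eq) (distribˡ _ _ _))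
    Span-* s (mono a b h Pab eq) (mono c d h′ Qcd eq′) = mono (a ℕ.+ c) (b ℕ.+ d) (h * h′) (s a b c d Pab Qcd)
      (trans (*-cong eq eq′) (trans
        (solve 6 (λ P Q P′ Q′ h h′ → (P :* (Q :* h)) :* (P′ :* (Q′ :* h′)) := (P :* P′) :* ((Q :* Q′) :* (h :* h′))) refl
          (p ^ a) (φ ^ b) (p ^ c) (φ ^ d) h h′)
        (sym (*-cong (^-+ p a c) (*-congʳ (^-+ φ b d))))))

    Span-scale : ∀ {P f} g → Span P f → Span P (g * f)
    Span-scale g (plus x y eq) = plus (Span-scale g x) (Span-scale g y) (trans (*-congˡ eq) (distribˡ _ _ _))
    Span-scale g (mono a b h Pab eq) = mono a b (g * h) Pab (trans (*-congˡ eq)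
      (solve 4 (λ g P Q h → g :* (P :* (Q :* h)) := P :* (Q :* (g :* h))) refl g (p ^ a) (φ ^ b) h))

    Span-φ : ∀ {P Q f} → (∀ a b → P a b → Q a (suc b)) → Span P f → Span Q (φ * f)
    Span-φ s (plus x y eq) = plus (Span-φ s x) (Span-φ s y) (trans (*-congˡ eq) (distribˡ _ _ _))
    Span-φ s (mono a b h Pab eq) = mono a (suc b) h (s a b Pab) (trans (*-congˡ eq)
      (solve 4 (λ φ P Q h → φ :* (P :* (Q :* h)) := P :* ((φ :* Q) :* h)) refl φ (p ^ a) (φ ^ b) h))

    Span-I : ∀ {P v j f} → (∀ a b → P a b → v < a ⊎ j < b) → Span P f → I (suc v) (suc j) f
    Span-I s (plus x y eq) = I-resp (sym eq) (I-+ (Span-I s x) (Span-I s y))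
    Span-I s (mono a b h Pab eq) with s a b Pab
    ... | inj₁ v<a = I-resp (sym eq) (I-p (φ ^ b * h) v<a)
    ... | inj₂ j<b = I-resp (sym (trans eq (solve 3 (λ P Q h → P :* (Q :* h) := Q :* (P :* h)) refl (p ^ a) (φ ^ b) h))) (I-φ (p ^ a * h) j<b)

    -- A digit p^e κ is stored as (e , κ), the digit 0 as nothing.
    Digit : Set c
    Digit = Maybe (ℕ × Carrier)

    digit : Digit → Carrier
    digit nothing        = 0#
    digit (just (e , κ)) = p ^ e * κ

    value : List Digit → Carrier
    value []      = 0#
    value (d ∷ L) = digit d + φ * value L

    data At : List Digit → ℕ → ℕ → Carrier → Set c where
      here  : ∀ {e κ L} → At (just (e , κ) ∷ L) 0 e κ
      there : ∀ {d L i e κ} → At L i e κ → At (d ∷ L) (suc i) e κ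

    -- The cofactor κ of a digit p^e κ avoids (p, φ), so e is the exact order of the digit.
    Reduced : List Digit → Set (c ⊔ ℓ)
    Reduced L = ∀ {i e κ} → At L i e κ → ¬ I 1 1 κ

    module Valuation (W w : ℕ) where

      open WeightArithmetic W w

      record Leading (f : Carrier) (L : List Digit) : Set (c ⊔ ℓ) where
        field
          v j      : ℕ
          κ R      : Carrier
          κ∉I      : ¬ I 1 1 κ
          expand   : f ≈ p ^ v * (φ ^ j * κ) + R
          R-above  : Span (Above (wt v j) j) R
          minimal  : ∀ {i e κ′} → At L i e κ′ → wt v j ≤ wt e i

      -- Among the digits of least weight, the one of least index.
      leading : ∀ L → Reduced L → (value L ≈ 0# × (∀ {i e κ} → ¬ At L i e κ)) ⊎ Leading (value L) L
      leading [] red = inj₁ (refl , λ ())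
      leading (nothing ∷ L) red with leading L (λ x → red (there x))
      ... | inj₁ (eq , none) = inj₁ (trans (+-identityˡ _) (trans (*-congˡ eq) (zeroʳ φ)) , λ { (there x) → none x })
      ... | inj₂ ld = inj₂ record
        { v = v ; j = suc j ; κ = κ ; R = φ * R ; κ∉I = κ∉I
        ; expand = trans (+-identityˡ _) (trans (*-congˡ expand)
            (solve 5 (λ φ P Q κ R → φ :* (P :* (Q :* κ) :+ R) := P :* ((φ :* Q) :* κ) :+ φ :* R) refl φ (p ^ v) (φ ^ j) κ R))
        ; R-above = Span-φ shift R-above
        ; minimal = λ { (there {i = i} {e} x) → ≡.subst₂ _≤_ (≡.sym (wt-suc v j)) (≡.sym (wt-suc e i)) (ℕ.+-monoˡ-≤ w (minimal x)) } }
        where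
        open Leading ld
        shift : ∀ a b → Above (wt v j) j a b → Above (wt v (suc j)) (suc j) a (suc b)
        shift a b (inj₁ lt)        = inj₁ (≡.subst₂ _<_ (≡.sym (wt-suc v j)) (≡.sym (wt-suc a b)) (ℕ.+-monoˡ-< w lt))
        shift a b (inj₂ (eq , lt)) = inj₂ (≡.trans (wt-suc v j) (≡.trans (≡.cong (ℕ._+ w) eq) (≡.sym (wt-suc a b))) , s≤s lt)
      leading (just (e , κ₀) ∷ L) red with leading L (λ x → red (there x))
      ... | inj₁ (eq , none) = inj₂ record
        { v = e ; j = 0 ; κ = κ₀ ; R = φ * value L ; κ∉I = red here
        ; expand = +-congʳ (*-congˡ (sym (*-identityˡ κ₀)))
        ; R-above = plus (zero-span) (zero-span) (trans (*-congˡ eq) (trans (zeroʳ φ) (sym (+-identityˡ 0#))))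
        ; minimal = λ { here → ℕ.≤-refl ; (there x) → contradiction x none } }
        where
        zero-span : Span (Above (wt e 0) 0) 0#
        zero-span = mono e 1 0# (above₁ (ℕ.m≤n⇒m<n∨m≡n (wt-mono {e} {0} {e} {1} ℕ.≤-refl z≤n))) (sym (trans (*-congˡ (zeroʳ _)) (zeroʳ _)))
          where
          above₁ : wt e 0 < wt e 1 ⊎ wt e 0 ≡ wt e 1 → Above (wt e 0) 0 e 1
          above₁ (inj₁ lt) = inj₁ lt
          above₁ (inj₂ eq) = inj₂ (eq , s≤s z≤n)
      -- The new constant digit also wins a tie, since its index 0 is the least.
      ... | inj₂ ld with ℕ.≤-<-connex (wt e 0) (wt (Leading.v ld) (suc (Leading.j ld)))
      ...   | inj₁ le = inj₂ record
        { v = e ; j = 0 ; κ = κ₀ ; R = φ * value L ; κ∉I = red here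
        ; expand = +-congʳ (*-congˡ (sym (*-identityˡ κ₀)))
        ; R-above = Span-resp (sym (*-congˡ expand)) (Span-φ shift (plus (mono v j κ (inj₂ (≡.refl , ℕ.≤-refl)) refl) (Span-⊆ (λ a b → above⇒atLeast) R-above) refl))
        ; minimal = λ { here → ℕ.≤-refl ; (there {i = i} {e′} x) → ℕ.≤-trans le (≡.subst₂ _≤_ (≡.sym (wt-suc v j)) (≡.sym (wt-suc e′ i)) (ℕ.+-monoˡ-≤ w (minimal x))) } }
        where
        open Leading ld
        shift : ∀ a b → AtLeast (wt v j) j a b → Above (wt e 0) 0 a (suc b)
        shift a b ab = result (ℕ.m≤n⇒m<n∨m≡n (ℕ.≤-trans le (≡.subst₂ _≤_ (≡.sym (wt-suc v j)) (≡.sym (wt-suc a b)) (ℕ.+-monoˡ-≤ w (weight ab)))))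
          where
          weight : AtLeast (wt v j) j a b → wt v j ≤ wt a b
          weight (inj₁ lt)       = ℕ.<⇒≤ lt
          weight (inj₂ (eq , _)) = ℕ.≤-reflexive eq
          result : wt e 0 < wt a (suc b) ⊎ wt e 0 ≡ wt a (suc b) → Above (wt e 0) 0 a (suc b)
          result (inj₁ lt) = inj₁ lt
          result (inj₂ eq) = inj₂ (eq , s≤s z≤n)
      ...   | inj₂ gt = inj₂ record
        { v = v ; j = suc j ; κ = κ ; R = p ^ e * κ₀ + φ * R ; κ∉I = κ∉I
        ; expand = trans (+-congˡ (*-congˡ expand))
            (solve 6 (λ D φ P Q κ R → D :+ φ :* (P :* (Q :* κ) :+ R) := P :* ((φ :* Q) :* κ) :+ (D :+ φ :* R)) refl (p ^ e * κ₀) φ (p ^ v) (φ ^ j) κ R)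
        ; R-above = plus (mono e 0 κ₀ (inj₁ gt) (*-congˡ (sym (*-identityˡ κ₀)))) (Span-φ shift R-above) refl
        ; minimal = λ { here → ℕ.<⇒≤ gt ; (there {i = i} {e′} x) → ≡.subst₂ _≤_ (≡.sym (wt-suc v j)) (≡.sym (wt-suc e′ i)) (ℕ.+-monoˡ-≤ w (minimal x)) } }
        where
        open Leading ld
        shift : ∀ a b → Above (wt v j) j a b → Above (wt v (suc j)) (suc j) a (suc b)
        shift a b (inj₁ lt)        = inj₁ (≡.subst₂ _<_ (≡.sym (wt-suc v j)) (≡.sym (wt-suc a b)) (ℕ.+-monoˡ-< w lt))
        shift a b (inj₂ (eq , lt)) = inj₂ (≡.trans (wt-suc v j) (≡.trans (≡.cong (ℕ._+ w) eq) (≡.sym (wt-suc a b))) , s≤s lt)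

    -- Consequences of p, φ being a regular sequence with (p, φ) prime

    module Regular (p-cancel : ∀ {x y} → p * x ≈ p * y → x ≈ y)
                   (φ-regular : ∀ {x y} → φ * x ≈ p * y → ∃ λ z → x ≈ p * z)
                   (I-prime : ∀ {f g} → ¬ I 1 1 f → I 1 1 (f * g) → I 1 1 g) where

      p^-cancel : ∀ v {x y} → p ^ v * x ≈ p ^ v * y → x ≈ y
      p^-cancel zero    eq = trans (sym (*-identityˡ _)) (trans eq (*-identityˡ _))
      p^-cancel (suc v) eq = p^-cancel v (p-cancel (trans (sym (*-assoc _ _ _)) (trans eq (*-assoc _ _ _))))

      φ^-regular : ∀ j {x y} → φ ^ j * x ≈ p * y → ∃ λ z → x ≈ p * z
      φ^-regular zero    {y = y} eq = y , trans (sym (*-identityˡ _)) eq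
      φ^-regular (suc j) eq with φ-regular (trans (sym (*-assoc _ _ _)) eq)
      ... | z , eq′ = φ^-regular j eq′

      φ^-p^-regular : ∀ j v {x y} → φ ^ j * x ≈ p ^ v * y → ∃ λ z → x ≈ p ^ v * z
      φ^-p^-regular j zero    {x} eq = x , sym (*-identityˡ x)
      φ^-p^-regular j (suc v) {x} {y} eq with φ^-regular j (trans eq (*-assoc p (p ^ v) y))
      ... | z , x≈pz = lift (φ^-p^-regular j v (p-cancel smaller))
        where
        smaller : p * (φ ^ j * z) ≈ p * (p ^ v * y)
        smaller = trans (solve 3 (λ p Q z → p :* (Q :* z) := Q :* (p :* z)) refl p (φ ^ j) z)
          (trans (*-congˡ (sym x≈pz)) (trans eq (*-assoc p (p ^ v) y)))
        lift : (∃ λ z′ → z ≈ p ^ v * z′) → ∃ λ z′ → x ≈ p ^ suc v * z′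
        lift (z′ , z≈) = z′ , trans x≈pz (trans (*-congˡ z≈) (sym (*-assoc p (p ^ v) z′)))

      -- From p^v φ^j h = p^(v+1) x + φ^(j+1) y regularity gives y = p^v y′. After cancelling p^v
      -- the difference h - φ y′, multiplied by φ^j, is a multiple of p, hence it is one itself.
      I-colon : ∀ v j {h} → I (suc v) (suc j) (p ^ v * (φ ^ j * h)) → I 1 1 h
      I-colon v j {h} (inI {x} {y} s) = step₁ (φ^-p^-regular (suc j) v y-eq)
        where
        y-eq : φ ^ suc j * y ≈ p ^ v * (φ ^ j * h + - (p * x))
        y-eq = sym (trans (*-∸ (p ^ v) (φ ^ j * h) (p * x)) (+-∸ (trans s (trans (+-comm _ _)
          (+-congˡ (solve 3 (λ p P x → (p :* P) :* x := P :* (p :* x)) refl p (p ^ v) x))))))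
        step₂ : ∀ y′ → (∃ λ z → h + - (φ * y′) ≈ p * z) → I 1 1 h
        step₂ y′ (z , eq) = inI {u = z} {v = y′} (trans (∸-+ eq) (+-cong (*-congʳ (sym (*-identityʳ p))) (*-congʳ (sym (*-identityʳ φ)))))
        step₁ : (∃ λ y′ → y ≈ p ^ v * y′) → I 1 1 h
        step₁ (y′ , y≈) = step₂ y′ (φ^-regular j (trans (*-∸ (φ ^ j) h (φ * y′)) (+-∸ cancelled)))
          where
          cancelled : φ ^ j * h ≈ p * x + φ ^ j * (φ * y′)
          cancelled = p^-cancel v (trans s (trans (+-congˡ (*-congˡ y≈))
            (solve 6 (λ p P x φ Q y → (p :* P) :* x :+ (φ :* Q) :* (P :* y) := P :* (p :* x :+ Q :* (φ :* y))) refl p (p ^ v) x φ (φ ^ j) y′)))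

      -- Modulo p: if φ does not divide f and φ^E divides f g, then φ^E divides g. In the induction
      -- g = p A + φ^E B, and `I-colon` with v = 0 reduces the next power of φ to f B ∈ (p, φ),
      -- where primality applies.
      I-φ^-transfer : ∀ E {f g} → ¬ I 1 1 f → I 1 E (f * g) → I 1 E g
      I-φ^-transfer zero    f∉I _  = I-resp (*-identityˡ _) (I-φ {m = 0} _ z≤n)
      I-φ^-transfer (suc E) {f} {g} f∉I fg∈I = descend (I-φ^-transfer E f∉I (I-anti ℕ.≤-refl (ℕ.n≤1+n E) fg∈I))
        where
        descend : I 1 E g → I 1 (suc E) g
        descend (inI {A₁} {B} s) = step (I-prime f∉I (I-colon 0 E (I-resp (sym (*-identityˡ _)) fB)))
          where
          fg : f * g ≈ p ^ 1 * (f * A₁) + φ ^ E * (f * B)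
          fg = trans (*-congˡ s) (solve 5 (λ P Q f A B → f :* (P :* A :+ Q :* B) := P :* (f :* A) :+ Q :* (f :* B)) refl (p ^ 1) (φ ^ E) f A₁ B)
          fB : I 1 (suc E) (φ ^ E * (f * B))
          fB = I-cancelˡ (I-resp fg fg∈I) (I-p (f * A₁) ℕ.≤-refl)
          step : I 1 1 B → I 1 (suc E) g
          step (inI {C} {D} sB) = inI (trans s (trans (+-congˡ (*-congˡ sB))
            (solve 6 (λ P Q φ A C D → P :* A :+ Q :* (P :* C :+ (φ :* con 1) :* D) := P :* (A :+ Q :* C) :+ (φ :* Q) :* D) refl (p ^ 1) (φ ^ E) φ A₁ C D)))

      module _ (W w : ℕ) where

        open WeightArithmetic W w
        open Valuation W w

        -- Newton polygon argument: the leading monomial of f g would have weight less than W V.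
        no-factorisation : ∀ {f g L M V i κ₀} → Reduced L → Reduced M → f ≈ value L → g ≈ value M → I 1 1 f →
                           At L i 0 κ₀ → w ℕ.* i < W → ¬ I (suc V) 1 (f * g) → Span (λ a b → W ℕ.* V ≤ wt a b) (f * g) → ⊥
        no-factorisation {f} {g} {L} {M} {V} {i} redL redM f≈ g≈ f∈I at wi<W fg∉I heavy
          with leading L redL | leading M redM
        ... | inj₁ (_ , none) | _ = none at
        ... | inj₂ _ | inj₁ (M≈0 , _) = fg∉I (I-resp (sym (trans (*-congˡ (trans g≈ M≈0)) (zeroʳ f))) I-0)
        ... | inj₂ lf | inj₂ lg = κκ′∉I (I-colon (v ℕ.+ v′) (j ℕ.+ j′) main)
          where
          open Leading lf
          open Leading lg renaming (v to v′; j to j′; κ to κ′; R to R′; κ∉I to κ′∉I; expand to expand′; R-above to R′-above; minimal to minimal′)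
          κκ′∉I : ¬ I 1 1 (κ * κ′)
          κκ′∉I x = κ′∉I (I-prime κ∉I x)
          constant : ∀ N f → f ≈ value N → Reduced N → (∀ {n} → I n 1 f) ⊎ (∃₂ λ e κ → At N 0 e κ × I e 1 f × ¬ I 1 1 κ)
          constant [] f f≈ red = inj₁ (I-resp (sym f≈) I-0)
          constant (nothing ∷ N) f f≈ red = inj₁ (I-resp (sym (trans f≈ (trans (+-identityˡ _) (*-congʳ (sym (*-identityʳ φ)))))) (I-φ (value N) ℕ.≤-refl))
          constant (just (e , κ) ∷ N) f f≈ red = inj₂ (e , κ , here ,
            I-resp (sym (trans f≈ (+-congˡ (*-congʳ (sym (*-identityʳ φ)))))) (I-+ (I-p κ ℕ.≤-refl) (I-φ (value N) ℕ.≤-refl)) , red here)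
          positive : ∀ N f → f ≈ value N → I 1 1 f → ∀ {e κ} → At N 0 e κ → ¬ I 1 1 κ → 0 < e
          positive (just (suc e , κ) ∷ N) f f≈ f∈I here κ∉I = s≤s z≤n
          positive (just (zero , κ) ∷ N) f f≈ f∈I here κ∉I = contradiction
            (I-resp (*-identityˡ κ) (I-cancelʳ (I-resp f≈ f∈I) (I-resp (*-congʳ (*-identityʳ φ)) (I-φ (value N) ℕ.≤-refl)))) κ∉I
          -- The leading weight of f is at most w i < W by the unit digit, while its constant digit
          -- has order x ≥ 1 because f ∈ (p, φ). The leading weight of g is at most W y by its
          -- constant digit. Finally x + y ≤ V because f g is outside (p^(V+1), φ).
          light : wt v j ℕ.+ wt v′ j′ < W ℕ.* V
          light with constant L f f≈ redL | constant M g g≈ redM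
          ... | inj₁ all | _ = contradiction (I-resp (*-comm g f) (I-* g (all {suc V}))) fg∉I
          ... | inj₂ _ | inj₁ all = contradiction (I-* f (all {suc V})) fg∉I
          ... | inj₂ (x , _ , atx , fx , κx) | inj₂ (y , _ , aty , gy , _) = begin-strict
            wt v j ℕ.+ wt v′ j′         <⟨ ℕ.+-mono-<-≤ v<x (minimal′ aty) ⟩
            W ℕ.* x ℕ.+ wt y 0          ≡⟨ r W w x y ⟩
            W ℕ.* (x ℕ.+ y)             ≤⟨ ℕ.*-monoʳ-≤ W x+y≤V ⟩
            W ℕ.* V                     ∎
            where
            open ℕ.≤-Reasoning
            r : ∀ W w x y → W ℕ.* x ℕ.+ (W ℕ.* y ℕ.+ w ℕ.* 0) ≡ W ℕ.* (x ℕ.+ y)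
            r = solve-∀
            v<x : wt v j < W ℕ.* x
            v<x = ℕ.<-≤-trans (ℕ.≤-<-trans (minimal at) (≡.subst (_< W) (≡.cong (ℕ._+ w ℕ.* i) (≡.sym (ℕ.*-zeroʳ W))) wi<W))
              (≡.subst (_≤ W ℕ.* x) (ℕ.*-identityʳ W) (ℕ.*-monoʳ-≤ W (positive L f f≈ f∈I atx κx)))
            x+y≤V : x ℕ.+ y ≤ V
            x+y≤V with ℕ.≤-<-connex (x ℕ.+ y) V
            ... | inj₁ le = le
            ... | inj₂ gt = contradiction (I-anti gt ℕ.≤-refl (I-*-1 fx gy)) fg∉I
          fg∈ : I (suc (v ℕ.+ v′)) (suc (j ℕ.+ j′)) (f * g)
          fg∈ = Span-I (λ a b le → beyond-heavy (ℕ.<-≤-trans (≡.subst (_< W ℕ.* V) (≡.sym (wt-+ v j v′ j′)) light) le)) heavy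
          lead lead′ : Carrier
          lead  = p ^ v * (φ ^ j * κ)
          lead′ = p ^ v′ * (φ ^ j′ * κ′)
          lead-span : Span (AtLeast (wt v j) j) lead
          lead-span = mono v j κ (inj₂ (≡.refl , ℕ.≤-refl)) refl
          g-span : Span (AtLeast (wt v′ j′) j′) (lead′ + R′)
          g-span = plus (mono v′ j′ κ′ (inj₂ (≡.refl , ℕ.≤-refl)) refl) (Span-⊆ (λ a b → above⇒atLeast) R′-above) refl
          RG∈ : I (suc (v ℕ.+ v′)) (suc (j ℕ.+ j′)) (R * (lead′ + R′))
          RG∈ = Span-I (λ a b x → x) (Span-* (λ a b c d → above+atLeast a b c d) R-above g-span)
          R′lead∈ : I (suc (v ℕ.+ v′)) (suc (j ℕ.+ j′)) (R′ * lead)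
          R′lead∈ = Span-I (λ a b x → x) (Span-* swapped R′-above lead-span)
            where
            swapped : ∀ a b c d → Above (wt v′ j′) j′ a b → AtLeast (wt v j) j c d → Beyond (v ℕ.+ v′) (j ℕ.+ j′) (a ℕ.+ c) (b ℕ.+ d)
            swapped a b c d P Q = ≡.subst₂ (λ x y → Beyond x y (a ℕ.+ c) (b ℕ.+ d)) (ℕ.+-comm v′ v) (ℕ.+-comm j′ j) (above+atLeast a b c d P Q)
          product : f * g ≈ lead * lead′ + (R′ * lead + R * (lead′ + R′))
          product = trans (*-cong (trans f≈ expand) (trans g≈ expand′))
            (solve 4 (λ l r l′ r′ → (l :+ r) :* (l′ :+ r′) := l :* l′ :+ (r′ :* l :+ r :* (l′ :+ r′))) refl lead R lead′ R′)
          main : I (suc (v ℕ.+ v′)) (suc (j ℕ.+ j′)) (p ^ (v ℕ.+ v′) * (φ ^ (j ℕ.+ j′) * (κ * κ′)))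
          main = I-resp (trans
            (solve 6 (λ P Q κ P′ Q′ κ′ → (P :* (Q :* κ)) :* (P′ :* (Q′ :* κ′)) := (P :* P′) :* ((Q :* Q′) :* (κ :* κ′))) refl (p ^ v) (φ ^ j) κ (p ^ v′) (φ ^ j′) κ′)
            (sym (*-cong (^-+ p v v′) (*-congʳ (^-+ φ j j′)))))
            (I-cancelʳ (I-resp product fg∈) (I-+ R′lead∈ RG∈))

-- Irreducibility of integer polynomials

module IntegerPolynomials where

  open Arithmetic using (prime>0; prime>1; prime∤1; even⊎odd; Witness; b)
  open NewtonPolygon
  open import Algebra.Definitions.RawMagma using (module _∣ʳ_)
  import Algebra.Definitions.RawSemiring as RawSemiringDefs
  import Algebra.Solver.Ring.NaturalCoefficients.Default as NatSolver
  open import Data.Empty using (⊥; ⊥-elim)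
  open import Data.Fin.Base using (Fin; zero; suc; toℕ)
  import Data.Fin.Properties as Fin
  open import Data.Integer.Base as ℤ using (ℤ; +_; 0ℤ; 1ℤ; -1ℤ)
  open import Data.Integer.Divisibility.Signed as ℤD using (_∣_; divides; _∣?_; 0∣⇒≡0)
  import Data.Integer.Properties as ℤ
  open import Data.Integer.Tactic.RingSolver using (solve-∀)
  open import Data.List.Base using (List; []; _∷_; map)
  open import Data.Maybe.Base using (just; nothing)
  open import Data.Nat.Base as ℕ using (ℕ; zero; suc; _≤_; _<_; _∸_; s≤s; z≤n; ⌊_/2⌋)
  open import Data.Nat.Coprimality using (coprime-Bézout)
  import Data.Nat.Divisibility as ℕD
  open import Data.Nat.DivMod using (_/_; _%_; m≡m%n+[m/n]*n; m%n<n; m/n*n≤m)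
  open import Data.Nat.GCD using (gcd-greatest; module Bézout)
  open import Data.Nat.Induction using (<-rec)
  open import Data.Nat.Primality using (Prime; prime[2]; euclidsLemma; prime⇒irreducible; prime⇒nonZero)
  import Data.Nat.Properties as ℕ
  import Data.Nat.Tactic.RingSolver as ℕSolver
  open import Data.Product.Base using (∃; ∃₂; _×_; _,_; proj₁; proj₂)
  open import Data.Rational.Base as ℚ using (ℚ; mkℚ; toℚᵘ; 0ℚ; 1ℚ)
  import Data.Rational.Properties as ℚ
  open import Data.Rational.Unnormalised.Base as ℚᵘ using (mkℚᵘ; *≡*; _≃_)
  import Data.Rational.Unnormalised.Properties as ℚᵘ
  open import Data.Sum.Base using (_⊎_; inj₁; inj₂; [_,_]′)
  open import Defs
  open import Function.Base using (_∘_)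
  open import Relation.Binary.Construct.Add.Infimum.Strict _<_ using ([_])
  open import Relation.Binary.Definitions using (tri<; tri≈; tri>)
  open import Relation.Binary.PropositionalEquality hiding ([_])
  open import Relation.Nullary using (¬_; contradiction; yes; no)
  open import Relation.Nullary.Construct.Add.Infimum using (⊥₋; [_]; []-injective)

  open ℤ[x] using (coeff; _+ₚ_; _^_; sum)
  open PolynomialRing ℤ.+-*-commutativeRing

  -- Polynomials modulo N

  infix 4 _∤_

  _∤_ : ℤ → ℤ → Set
  m ∤ n = ¬ (m ∣ n)

  Below : ℤ → ℕ → ℤPoly → Set
  Below N n f = ∀ i → n ≤ i → N ∣ coeff f i

  Zero : ℤ → ℤPoly → Set
  Zero N f = ∀ i → N ∣ coeff f i

  -- N is 0 or a prime: for N = 0 this is the degree over ℤ, for N = p the degree of the reduction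
  -- modulo p. Both are `PrimeLike`, so one proof of additivity under products serves for both.
  Top : ℤ → ℤPoly → ℕ → Set
  Top N f a = N ∤ coeff f a × Below N (suc a) f

  PrimeLike : ℤ → Set
  PrimeLike N = ∀ x y → N ∣ x ℤ.* y → N ∣ x ⊎ N ∣ y

  N∣0 : ∀ {N} → N ∣ 0ℤ
  N∣0 {N} = divides 0ℤ refl

  ≡0⇒∣ : ∀ {N x} → x ≡ 0ℤ → N ∣ x
  ≡0⇒∣ refl = N∣0

  primeLike-0 : PrimeLike 0ℤ
  primeLike-0 x y d with ℤ.i*j≡0⇒i≡0∨j≡0 x (0∣⇒≡0 d)
  ... | inj₁ refl = inj₁ N∣0
  ... | inj₂ refl = inj₂ N∣0

  primeLike-p : ∀ {p} → Prime p → PrimeLike (+ p)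
  primeLike-p {p} pr x y d with euclidsLemma ℤ.∣ x ∣ ℤ.∣ y ∣ pr (subst (p ℕD.∣_) (ℤ.abs-* x y) (ℤD.∣⇒∣ᵤ d))
  ... | inj₁ q = inj₁ (ℤD.∣ᵤ⇒∣ q)
  ... | inj₂ q = inj₂ (ℤD.∣ᵤ⇒∣ q)

  Zero-resp : ∀ {N f g} → f ≋ g → Zero N f → Zero N g
  Zero-resp eq z i = subst (_ ∣_) (at eq i) (z i)

  Top-resp : ∀ {N f g a} → f ≋ g → Top N f a → Top N g a
  Top-resp eq (n , b) = (λ d → n (subst (_ ∣_) (sym (at eq _)) d)) , λ i le → subst (_ ∣_) (at eq i) (b i le)

  Zero-+ : ∀ {N} f g → Zero N f → Zero N g → Zero N (f +ₚ g)
  Zero-+ f g zf zg i = subst (_ ∣_) (sym (coeff-+ f g i)) (ℤD.∣m∣n⇒∣m+n (zf i) (zg i))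

  Zero-• : ∀ {N} x f → Zero N f → Zero N (x • f)
  Zero-• x f z i = subst (_ ∣_) (sym (coeff-• x f i)) (ℤD.∣n⇒∣m*n x (z i))

  Zero-*ʳ : ∀ {N} f g → Zero N g → Zero N (f *ₚ g)
  Zero-*ʳ []      g z i = N∣0
  Zero-*ʳ (x ∷ f) g z = Zero-+ (x • g) _ (Zero-• x g z) λ { zero → N∣0 ; (suc i) → Zero-*ʳ f g z i }

  Zero-*ˡ : ∀ {N} f g → Zero N f → Zero N (f *ₚ g)
  Zero-*ˡ f g z = Zero-resp (*ₚ-comm g f) (Zero-*ʳ g f z)

  zero⊎top : ∀ N f → Zero N f ⊎ ∃ (Top N f)
  zero⊎top N [] = inj₁ λ i → N∣0
  zero⊎top N (x ∷ f) with zero⊎top N f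
  ... | inj₂ (a , n , b) = inj₂ (suc a , n , λ { zero () ; (suc i) (s≤s le) → b i le })
  ... | inj₁ z with N ∣? x
  ...   | yes d = inj₁ λ { zero → d ; (suc i) → z i }
  ...   | no ¬d = inj₂ (0 , ¬d , λ { zero () ; (suc i) _ → z i })

  Top-unique : ∀ {N} f {a b} → Top N f a → Top N f b → a ≡ b
  Top-unique f {a} {b} (na , ba) (nb , bb) with ℕ.≤-<-connex a b
  ... | inj₂ b<a = contradiction (bb a b<a) na
  ... | inj₁ a≤b with ℕ.m≤n⇒m<n∨m≡n a≤b
  ...   | inj₁ a<b  = contradiction (ba b a<b) nb
  ...   | inj₂ a≡b = a≡b

  product-coeff : ∀ {N} f g a b → Below N (suc a) f → Below N (suc b) g →
                  N ∣ coeff (f *ₚ g) (a ℕ.+ b) ℤ.- coeff f a ℤ.* coeff g b × Below N (suc (a ℕ.+ b)) (f *ₚ g)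
  product-coeff {N} [] g a b bf bg = N∣0 , λ i _ → N∣0
  product-coeff {N} (x ∷ f) g zero b bf bg = top , below
    where
    zf : Zero N (0ℤ ∷ (f *ₚ g))
    zf zero    = N∣0
    zf (suc i) = Zero-*ˡ f g (λ i → bf (suc i) (s≤s z≤n)) i
    r : ∀ x y → x ℤ.+ y ℤ.- x ≡ y
    r = solve-∀
    top : N ∣ coeff ((x • g) +ₚ (0ℤ ∷ (f *ₚ g))) b ℤ.- x ℤ.* coeff g b
    top = subst (N ∣_) (sym (trans (cong (ℤ._- x ℤ.* coeff g b) (trans (coeff-+ (x • g) _ b) (cong (ℤ._+ coeff (0ℤ ∷ (f *ₚ g)) b) (coeff-• x g b)))) (r (x ℤ.* coeff g b) _))) (zf b)
    below : Below N (suc b) ((x • g) +ₚ (0ℤ ∷ (f *ₚ g)))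
    below i le = subst (N ∣_) (sym (coeff-+ (x • g) _ i)) (ℤD.∣m∣n⇒∣m+n (subst (N ∣_) (sym (coeff-• x g i)) (ℤD.∣n⇒∣m*n x (bg i le))) (zf i))
  product-coeff {N} (x ∷ f) g (suc a) b bf bg with product-coeff f g a b (λ i le → bf (suc i) (s≤s le)) bg
  ... | top′ , below′ = top , below
    where
    xg : ∀ i → suc (a ℕ.+ b) ≤ i → N ∣ coeff (x • g) i
    xg i le = subst (N ∣_) (sym (coeff-• x g i)) (ℤD.∣n⇒∣m*n x (bg i (ℕ.≤-trans (s≤s (ℕ.m≤n+m b a)) le)))
    top : N ∣ coeff ((x • g) +ₚ (0ℤ ∷ (f *ₚ g))) (suc (a ℕ.+ b)) ℤ.- coeff f a ℤ.* coeff g b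
    top = subst (N ∣_) (sym (trans (cong (ℤ._- coeff f a ℤ.* coeff g b) (coeff-+ (x • g) (0ℤ ∷ (f *ₚ g)) (suc (a ℕ.+ b)))) (ℤ.+-assoc (coeff (x • g) (suc (a ℕ.+ b))) (coeff (f *ₚ g) (a ℕ.+ b)) _)))
      (ℤD.∣m∣n⇒∣m+n (xg _ ℕ.≤-refl) top′)
    below : Below N (suc (suc (a ℕ.+ b))) ((x • g) +ₚ (0ℤ ∷ (f *ₚ g)))
    below (suc i) (s≤s le) = subst (N ∣_) (sym (coeff-+ (x • g) _ (suc i))) (ℤD.∣m∣n⇒∣m+n (xg (suc i) (ℕ.≤-trans (ℕ.n≤1+n _) (s≤s le))) (below′ i le))

  Top-* : ∀ {N} → PrimeLike N → ∀ f g {a b} → Top N f a → Top N g b → Top N (f *ₚ g) (a ℕ.+ b)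
  Top-* {N} pl f g {a} {b} (nf , bf) (ng , bg) with product-coeff f g a b bf bg
  ... | top , below = n , below
    where
    r : ∀ x y → x ℤ.- y ℤ.- x ≡ ℤ.- y
    r = solve-∀
    n : N ∤ coeff (f *ₚ g) (a ℕ.+ b)
    n d with pl (coeff f a) (coeff g b) (subst (N ∣_) (ℤ.neg-involutive _) (ℤD.∣m⇒∣-m (subst (N ∣_) (r (coeff (f *ₚ g) (a ℕ.+ b)) (coeff f a ℤ.* coeff g b)) (ℤD.∣m∣n⇒∣m-n top d))))
    ... | inj₁ x = nf x
    ... | inj₂ y = ng y

  record IsMonic (g : ℤPoly) (e : ℕ) : Set where
    constructor monic
    field
      leading≡1 : coeff g e ≡ 1ℤ
      beyond≡0  : ∀ i → e < i → coeff g i ≡ 0ℤ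

  open IsMonic

  ∤1 : ∀ {p} → Prime p → + p ∤ 1ℤ
  ∤1 pr d = prime∤1 pr (ℤD.∣⇒∣ᵤ d)

  monic-Top : ∀ {N g e} → N ∤ 1ℤ → IsMonic g e → Top N g e
  monic-Top n (monic l b) = (λ d → n (subst (_ ∣_) l d)) , λ i le → ≡0⇒∣ (b i le)

  0∤1 : 0ℤ ∤ 1ℤ
  0∤1 d with 0∣⇒≡0 d
  ... | ()

  divide : ∀ g e → IsMonic g e → ∀ f → ∃₂ λ q s → f ≋ ((g *ₚ q) +ₚ s) × (∀ i → e ≤ i → coeff s i ≡ 0ℤ)
  divide g e mon [] = [] , [] , ≋-sym (≋-trans (+ₚ-identityʳ (g *ₚ [])) (*ₚ-zeroʳ g)) , λ i _ → refl
  divide g e mon (x ∷ f) with divide g e mon f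
  ... | q , s , eq , small = t ∷ q , s′ , eq′ , small′
    where
    -- Prefixing x raises the degree of the remainder to at most e; subtracting t times the monic g
    -- removes the coefficient at e.
    t = coeff (x ∷ s) e
    s′ = (x ∷ s) +ₚ (-ₚ (t • g))
    coeff-s′ : ∀ i → coeff s′ i ≡ coeff (x ∷ s) i ℤ.- t ℤ.* coeff g i
    coeff-s′ i = trans (coeff-+ (x ∷ s) (-ₚ (t • g)) i) (cong (λ z → coeff (x ∷ s) i ℤ.+ z) (trans (coeff-neg (t • g) i) (cong ℤ.-_ (coeff-• t g i))))
    small′ : ∀ i → e ≤ i → coeff s′ i ≡ 0ℤ
    small′ i e≤i with ℕ.m≤n⇒m<n∨m≡n e≤i
    ... | inj₂ refl = trans (coeff-s′ e) (trans (cong (λ z → t ℤ.- t ℤ.* z) (leading≡1 mon)) (r t))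
      where
      r : ∀ t → t ℤ.- t ℤ.* 1ℤ ≡ 0ℤ
      r = solve-∀
    small′ (suc i) _ | inj₁ e<i = trans (coeff-s′ (suc i)) (trans (cong₂ (λ y z → y ℤ.- t ℤ.* z) (small i (ℕ.s≤s⁻¹ e<i)) (beyond≡0 mon (suc i) e<i)) (r t))
      where
      r : ∀ t → 0ℤ ℤ.- t ℤ.* 0ℤ ≡ 0ℤ
      r = solve-∀
    gq = g *ₚ q
    eq′ : (x ∷ f) ≋ ((g *ₚ (t ∷ q)) +ₚ s′)
    eq′ = ⟨ (λ i → sym (trans (coeff-+ (g *ₚ (t ∷ q)) s′ i) (trans (cong₂ ℤ._+_ (trans (at (*ₚ-∷ʳ g t q) i) (trans (coeff-+ (t • g) (0ℤ ∷ gq) i) (cong (ℤ._+ coeff (0ℤ ∷ gq) i) (coeff-• t g i)))) (coeff-s′ i))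
         (trans (r (t ℤ.* coeff g i) (coeff (0ℤ ∷ gq) i) (coeff (x ∷ s) i)) (shift i))))) ⟩
      where
      r : ∀ a b c → a ℤ.+ b ℤ.+ (c ℤ.- a) ≡ b ℤ.+ c
      r = solve-∀
      shift : ∀ i → coeff (0ℤ ∷ gq) i ℤ.+ coeff (x ∷ s) i ≡ coeff (x ∷ f) i
      shift zero    = ℤ.+-identityˡ x
      shift (suc i) = trans (sym (coeff-+ gq s i)) (sym (at eq i))

  -- Applied to ℓ • r, where ℓ inverts the top coefficient of r modulo p, this yields a polynomial
  -- that is congruent to ℓ r modulo p and monic over ℤ, so that `divide` can be used.
  monicise : ℕ → ℤPoly → ℤPoly
  monicise zero    f       = 1ℤ ∷ []
  monicise (suc e) []      = 0ℤ ∷ monicise e []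
  monicise (suc e) (x ∷ f) = x ∷ monicise e f

  monicise-low : ∀ e f i → i < e → coeff (monicise e f) i ≡ coeff f i
  monicise-low (suc e) []      zero    _        = refl
  monicise-low (suc e) []      (suc i) (s≤s lt) = monicise-low e [] i lt
  monicise-low (suc e) (x ∷ f) zero    _        = refl
  monicise-low (suc e) (x ∷ f) (suc i) (s≤s lt) = monicise-low e f i lt

  monicise-monic : ∀ e f → IsMonic (monicise e f) e
  monicise-monic zero    f       = monic refl λ { zero () ; (suc i) _ → refl }
  monicise-monic (suc e) []      = monic (leading≡1 (monicise-monic e [])) λ { zero () ; (suc i) (s≤s lt) → beyond≡0 (monicise-monic e []) i lt }
  monicise-monic (suc e) (x ∷ f) = monic (leading≡1 (monicise-monic e f)) λ { zero () ; (suc i) (s≤s lt) → beyond≡0 (monicise-monic e f) i lt }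

  mod-inverse : ∀ {p} → Prime p → ∀ x → + p ∤ x → ∃ λ y → + p ∣ 1ℤ ℤ.- y ℤ.* x
  mod-inverse {p} pr x p∤x = adjust x (bezout (coprime-Bézout coprime))
    where
    n = ℤ.∣ x ∣
    coprime : ∀ {d} → d ℕD.∣ n × d ℕD.∣ p → d ≡ 1
    coprime (d∣n , d∣p) with prime⇒irreducible pr d∣p
    ... | inj₁ d≡1 = d≡1
    ... | inj₂ refl = contradiction (ℤD.∣ᵤ⇒∣ d∣n) p∤x
    bezout : Bézout.Identity 1 n p → ∃ λ y → + p ∣ 1ℤ ℤ.- y ℤ.* + n
    bezout (Bézout.+- y k eq) = + y , divides (ℤ.- + k) (begin
      1ℤ ℤ.- + y ℤ.* + n              ≡⟨ cong (λ z → 1ℤ ℤ.- z) (trans (sym (ℤ.pos-* y n)) (trans (cong +_ (sym eq)) (trans (ℤ.pos-+ 1 (k ℕ.* p)) (cong (λ z → 1ℤ ℤ.+ z) (ℤ.pos-* k p))))) ⟩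
      1ℤ ℤ.- (1ℤ ℤ.+ + k ℤ.* + p)     ≡⟨ r (+ k) (+ p) ⟩
      ℤ.- + k ℤ.* + p                 ∎)
      where
      open ≡-Reasoning
      r : ∀ k p → 1ℤ ℤ.- (1ℤ ℤ.+ k ℤ.* p) ≡ ℤ.- k ℤ.* p
      r = solve-∀
    bezout (Bézout.-+ y k eq) = ℤ.- + y , divides (+ k) (begin
      1ℤ ℤ.- ℤ.- + y ℤ.* + n          ≡⟨ r (+ y) (+ n) ⟩
      1ℤ ℤ.+ + y ℤ.* + n              ≡⟨ trans (cong (λ z → 1ℤ ℤ.+ z) (sym (ℤ.pos-* y n))) (trans (sym (ℤ.pos-+ 1 (y ℕ.* n))) (trans (cong +_ eq) (ℤ.pos-* k p))) ⟩
      + k ℤ.* + p                     ∎)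
      where
      open ≡-Reasoning
      r : ∀ y n → 1ℤ ℤ.- ℤ.- y ℤ.* n ≡ 1ℤ ℤ.+ y ℤ.* n
      r = solve-∀
    adjust : ∀ x → (∃ λ y → + p ∣ 1ℤ ℤ.- y ℤ.* + ℤ.∣ x ∣) → ∃ λ y → + p ∣ 1ℤ ℤ.- y ℤ.* x
    adjust (+ n) h = h
    adjust (ℤ.-[1+ n ]) (y , d) = ℤ.- y , subst (λ z → + p ∣ 1ℤ ℤ.- z) (r y (+ suc n)) d
      where
      r : ∀ y n → y ℤ.* n ≡ ℤ.- y ℤ.* ℤ.- n
      r = solve-∀

  quotient-p : ∀ {p} f → Zero (+ p) f → ∃ λ g → f ≋ ((+ p) • g)
  quotient-p [] z = [] , ≋-refl
  quotient-p {p} (x ∷ f) z with z 0 | quotient-p {p} f (λ i → z (suc i))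
  ... | divides q eq | g , eq′ = q ∷ g , ∷-cong (trans eq (ℤ.*-comm q (+ p))) eq′

  -- Arithmetic modulo (p, φ)

  -- Reduction modulo p keeps the lists, so the operations agree on the nose.
  +ₚ-mod : ∀ p f g → Polynomial._+ₚ_ (ℤ/ p) f g ≡ f +ₚ g
  +ₚ-mod p []      g       = refl
  +ₚ-mod p (x ∷ f) []      = refl
  +ₚ-mod p (x ∷ f) (y ∷ g) = cong (x ℤ.+ y ∷_) (+ₚ-mod p f g)

  *ₚ-mod : ∀ p f g → Polynomial._*ₚ_ (ℤ/ p) f g ≡ f *ₚ g
  *ₚ-mod p []      g = refl
  *ₚ-mod p (x ∷ f) g = trans (+ₚ-mod p (x • g) _) (cong (λ z → (x • g) +ₚ (0ℤ ∷ z)) (*ₚ-mod p f g))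

  coeff-mod : ∀ p f k → Polynomial.coeff (ℤ/ p) f k ≡ coeff f k
  coeff-mod p []      k       = refl
  coeff-mod p (x ∷ f) zero    = refl
  coeff-mod p (x ∷ f) (suc k) = coeff-mod p f k

  module _ (p : ℕ) (φ : ℤPoly) where

    private
      _≡-mod_ : ℤPoly → ℤPoly → Set
      f ≡-mod g = ∀ k → + p ∣ coeff f k ℤ.- coeff g k

      to-mod : ∀ {f} g h → f ≡-mod (g *ₚ h) → Polynomial._≈ₚ_ (ℤ/ p) f (Polynomial._*ₚ_ (ℤ/ p) g h)
      to-mod {f} g h eq k = subst₂ (λ x y → p ℕD.∣ ℤ.∣ x ℤ.- y ∣) (sym (coeff-mod p f k))
        (sym (trans (coeff-mod p (Polynomial._*ₚ_ (ℤ/ p) g h) k) (cong (λ z → coeff z k) (*ₚ-mod p g h)))) (ℤD.∣⇒∣ᵤ (eq k))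

      from-mod : ∀ f g {h} → Polynomial._≈ₚ_ (ℤ/ p) (Polynomial._*ₚ_ (ℤ/ p) f g) h → (f *ₚ g) ≡-mod h
      from-mod f g {h} eq k = ℤD.∣ᵤ⇒∣ (subst₂ (λ x y → p ℕD.∣ ℤ.∣ x ℤ.- y ∣)
        (trans (coeff-mod p (Polynomial._*ₚ_ (ℤ/ p) f g) k) (cong (λ z → coeff z k) (*ₚ-mod p f g))) (coeff-mod p h k) (eq k))

    irreducible-mod : IrreducibleMod p φ → ∀ f g → φ ≡-mod (f *ₚ g) →
      (∃ λ h → (h *ₚ f) ≡-mod (1ℤ ∷ [])) ⊎ (∃ λ h → (h *ₚ g) ≡-mod (1ℤ ∷ []))
    irreducible-mod irr f g eq with RawSemiringDefs.Irreducible.split-∣1 irr {f} {g} (to-mod {φ} f g eq)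
    ... | inj₁ d = inj₁ (_∣ʳ_.quotient d , from-mod (_∣ʳ_.quotient d) f {1ℤ ∷ []} (_∣ʳ_.equality d))
    ... | inj₂ d = inj₂ (_∣ʳ_.quotient d , from-mod (_∣ʳ_.quotient d) g {1ℤ ∷ []} (_∣ʳ_.equality d))

    -- A monic φ of degree 0 is 1.
    nonconstant : IrreducibleMod p φ → ∀ {d} → IsMonic φ d → 0 < d
    nonconstant irr {suc d} mon = s≤s z≤n
    nonconstant irr {zero} mon = contradiction (record { quotient = 1ℤ ∷ [] ; equality = λ k → subst (λ z → p ℕD.∣ ℤ.∣ z ∣)
        (sym (trans (cong₂ ℤ._-_ (trans (coeff-mod p (Polynomial._*ₚ_ (ℤ/ p) (1ℤ ∷ []) φ) k) (trans (cong (λ z → coeff z k) (*ₚ-mod p (1ℤ ∷ []) φ))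
          (trans (at (*ₚ-identityˡ φ) k) (φ≡1 k)))) (coeff-mod p (1ℤ ∷ []) k)) (ℤ.+-inverseʳ (coeff (1ℤ ∷ []) k)))) (p ℕD.∣0) })
      (RawSemiringDefs.Irreducible.p∤1 irr)
      where
      φ≡1 : ∀ k → coeff φ k ≡ coeff (1ℤ ∷ []) k
      φ≡1 zero    = IsMonic.leading≡1 mon
      φ≡1 (suc k) = IsMonic.beyond≡0 mon (suc k) (s≤s z≤n)

  A : CommutativeRing _ _
  A = polynomialRing

  module Local {p : ℕ} (pr : Prime p) {φ : ℤPoly} {d : ℕ} (φ-monic : IsMonic φ d) (irr : IrreducibleMod p φ) where

    P : ℤPoly
    P = + p ∷ []

    -- The constant polynomial −1; with it the identities below hold in semirings.
    M : ℤPoly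
    M = -1ℤ ∷ []

    open KeyPolynomial A P φ public renaming (_^_ to _^^_)
    open NatSolver (CommutativeRing.commutativeSemiring A) using (solve; _:=_; _:+_; _:*_)

    pl : PrimeLike (+ p)
    pl = primeLike-p pr

    φ-Top : Top (+ p) φ d
    φ-Top = monic-Top (∤1 pr) φ-monic

    φ^-monic-Top : ∀ {N} → PrimeLike N → N ∤ 1ℤ → ∀ E → Top N (φ ^^ E) (E ℕ.* d)
    φ^-monic-Top pl n zero    = n , λ { zero () ; (suc i) _ → N∣0 }
    φ^-monic-Top pl n (suc E) = Top-* pl φ (φ ^^ E) (monic-Top n φ-monic) (φ^-monic-Top pl n E)

    P-Zero : Zero (+ p) P
    P-Zero zero    = ℤD.∣-refl
    P-Zero (suc i) = N∣0

    Zero-P^ : ∀ v f → Zero (+ p) ((P ^^ suc v) *ₚ f)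
    Zero-P^ v f = Zero-*ˡ (P ^^ suc v) f (Zero-*ˡ P (P ^^ v) P-Zero)

    Zero⇒P* : ∀ f → Zero (+ p) f → ∃ λ g → f ≋ P *ₚ g
    Zero⇒P* f z with quotient-p f z
    ... | g , eq = g , ≋-trans eq (≋-sym ([a]*ₚ (+ p) g))

    Zero⇒I : ∀ {b f} → Zero (+ p) f → I 1 b f
    Zero⇒I {b} {f} z with Zero⇒P* f z
    ... | g , eq = I-resp (≋-trans (*ₚ-cong (≋-trans (*ₚ-comm P (1ℤ ∷ [])) (*ₚ-identityˡ P)) (≋-refl {g})) (≋-sym eq)) (I-p {m = 1} g ℕ.≤-refl)

    φ*⇒I : ∀ f → I 1 1 (φ *ₚ f)
    φ*⇒I f = I-resp (*ₚ-cong (≋-trans (*ₚ-comm φ (1ℤ ∷ [])) (*ₚ-identityˡ φ)) (≋-refl {f})) (I-φ {m = 1} f ℕ.≤-refl)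

    M-cancel : ∀ f → (f +ₚ (M *ₚ f)) ≋ []
    M-cancel f = ⟨ (λ k → trans (coeff-+ f (M *ₚ f) k) (trans (cong (λ z → coeff f k ℤ.+ z) (trans (at ([a]*ₚ -1ℤ f) k) (coeff-• -1ℤ f k))) (r (coeff f k)))) ⟩
      where
      r : ∀ x → x ℤ.+ -1ℤ ℤ.* x ≡ 0ℤ
      r = solve-∀

    coeff-M : ∀ f g k → coeff (f +ₚ (M *ₚ g)) k ≡ coeff f k ℤ.- coeff g k
    coeff-M f g k = trans (coeff-+ f (M *ₚ g) k) (cong (λ z → coeff f k ℤ.+ z) (trans (at ([a]*ₚ -1ℤ g) k) (trans (coeff-• -1ℤ g k) (ℤ.-1*i≡-i (coeff g k)))))

    Unit : ℤPoly → Set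
    Unit r = ∃ λ r′ → I 1 1 ((r *ₚ r′) +ₚ M)

    minus-one : ∀ f → (∀ k → + p ∣ coeff f k ℤ.- coeff (1ℤ ∷ []) k) → Zero (+ p) (f +ₚ M)
    minus-one f h k = subst (+ p ∣_) (trans (cong (λ z → coeff f k ℤ.+ z) (sgn k)) (sym (coeff-+ f M k))) (h k)
      where
      sgn : ∀ k → ℤ.- coeff (1ℤ ∷ []) k ≡ coeff M k
      sgn zero    = refl
      sgn (suc k) = refl

    -- A Euclidean descent on the degree: φ is divided by the monic ρ ≡ ℓ r modulo p, giving φ = ρ q
    -- + s. If s is nonzero modulo p, it has an inverse s′ by induction and - ℓ q s′ inverts r.
    -- Otherwise φ ≡ ρ q modulo p, and irreducibility makes ρ or q a unit.
    top⇒unit : ∀ e → e < d → ∀ r → Top (+ p) r e → Unit r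
    top⇒unit = <-rec _ go
      where
      go : ∀ e → (∀ {i} → i < e → i < d → ∀ r → Top (+ p) r i → Unit r) → e < d → ∀ r → Top (+ p) r e → Unit r
      go e rec e<d r (n , below) with mod-inverse pr (coeff r e) n
      ... | ℓ , ℓ-inv = result (divide ρ e ρ-monic φ)
        where
        L ρ : ℤPoly
        L = ℓ ∷ []
        ρ = monicise e (ℓ • r)
        ρ-monic : IsMonic ρ e
        ρ-monic = monicise-monic e (ℓ • r)
        ρ≡ : Zero (+ p) (ρ +ₚ (M *ₚ (L *ₚ r)))
        ρ≡ k = subst (+ p ∣_) (sym (trans (coeff-M ρ (L *ₚ r) k) (cong (λ z → coeff ρ k ℤ.- z) (trans (at ([a]*ₚ ℓ r) k) (coeff-• ℓ r k))))) (cases (ℕ.<-cmp k e))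
          where
          cases : _ → + p ∣ coeff ρ k ℤ.- ℓ ℤ.* coeff r k
          cases (tri< k<e _ _) = ≡0⇒∣ (trans (cong (ℤ._- ℓ ℤ.* coeff r k) (trans (monicise-low e (ℓ • r) k k<e) (coeff-• ℓ r k))) (ℤ.+-inverseʳ (ℓ ℤ.* coeff r k)))
          cases (tri≈ _ refl _) = subst (λ z → + p ∣ z ℤ.- ℓ ℤ.* coeff r k) (sym (IsMonic.leading≡1 ρ-monic)) ℓ-inv
          cases (tri> _ _ e<k) = subst (λ z → + p ∣ z ℤ.- ℓ ℤ.* coeff r k) (sym (IsMonic.beyond≡0 ρ-monic k e<k))
            (subst (+ p ∣_) (sym (ℤ.+-identityˡ _)) (ℤD.∣m⇒∣-m (ℤD.∣n⇒∣m*n ℓ (below k e<k))))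
        result : (∃₂ λ q s → φ ≋ ((ρ *ₚ q) +ₚ s) × (∀ i → e ≤ i → coeff s i ≡ 0ℤ)) → Unit r
        result (q , s , eq , small) with zero⊎top (+ p) s
        ... | inj₂ (e′ , top-s) = descend (rec e′<e (ℕ.<-trans e′<e e<d) s top-s)
          where
          e′<e : e′ < e
          e′<e with ℕ.≤-<-connex e e′
          ... | inj₂ lt = lt
          ... | inj₁ le = contradiction (≡0⇒∣ (small e′ le)) (proj₁ top-s)
          descend : Unit s → Unit r
          descend (s′ , ss′) = ((M *ₚ L) *ₚ q) *ₚ s′ , I-cancelʳ (I-resp
              (solve 7 (λ M L q s r s′ ρ → (q :* s′) :* (ρ :+ M :* (L :* r)) :+ (s :* s′ :+ M)
                 := (r :* (((M :* L) :* q) :* s′) :+ M) :+ (ρ :* q :+ s) :* s′) ≋-refl M L q s r s′ ρ)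
              (I-+ (I-* (q *ₚ s′) (Zero⇒I {f = ρ +ₚ (M *ₚ (L *ₚ r))} ρ≡)) ss′))
            (I-resp (*ₚ-cong eq (≋-refl {s′})) (φ*⇒I s′))
        ... | inj₁ zero-s with irreducible-mod p φ irr ρ q (λ k → subst (+ p ∣_) (sym (trans (cong (ℤ._- coeff (ρ *ₚ q) k) (trans (at eq k) (coeff-+ (ρ *ₚ q) s k))) (cancel (coeff (ρ *ₚ q) k) (coeff s k)))) (zero-s k))
          where
          cancel : ∀ a b → a ℤ.+ b ℤ.- a ≡ b
          cancel = solve-∀
        ...   | inj₁ (y , yρ≡1) = L *ₚ y , I-cancelʳ (I-resp
                (solve 5 (λ M L r y ρ → (y :* ρ :+ M) :+ (r :* (L :* y) :+ M :* (r :* (L :* y)))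
                   := (r :* (L :* y) :+ M) :+ y :* (ρ :+ M :* (L :* r))) ≋-refl M L r y ρ)
                (I-+ (Zero⇒I {f = (y *ₚ ρ) +ₚ M} (minus-one (y *ₚ ρ) yρ≡1)) (I-resp (≋-sym (M-cancel (r *ₚ (L *ₚ y)))) I-0)))
              (I-* y (Zero⇒I {f = ρ +ₚ (M *ₚ (L *ₚ r))} ρ≡))
        -- If q is the unit, then ρ ≡ φ y modulo p, which the degree e < d of ρ does not allow.
        ...   | inj₂ (y , yq≡1) = contradiction e<d (impossible (zero⊎top (+ p) y))
          where
          φy : Zero (+ p) ((φ *ₚ y) +ₚ (M *ₚ ρ))
          φy = Zero-resp (≋-trans (solve 5 (λ M ρ q s y → ρ :* (y :* q :+ M) :+ s :* y := (ρ :* q :+ s) :* y :+ M :* ρ) ≋-refl M ρ q s y)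
                 (+ₚ-cong (*ₚ-cong (≋-sym eq) (≋-refl {y})) (≋-refl {M *ₚ ρ})))
               (Zero-+ (ρ *ₚ ((y *ₚ q) +ₚ M)) (s *ₚ y) (Zero-*ʳ ρ _ (minus-one (y *ₚ q) yq≡1)) (Zero-*ˡ s y zero-s))
          transfer : ∀ k → + p ∣ coeff (φ *ₚ y) k → + p ∣ coeff ρ k
          transfer k h = subst (+ p ∣_) (neg (coeff (φ *ₚ y) k) (coeff ρ k)) (ℤD.∣m∣n⇒∣m-n h (subst (+ p ∣_) (coeff-M (φ *ₚ y) ρ k) (φy k)))
            where
            neg : ∀ a b → a ℤ.- (a ℤ.- b) ≡ b
            neg = solve-∀
          ρ-top : Top (+ p) ρ e
          ρ-top = monic-Top (∤1 pr) ρ-monic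
          impossible : Zero (+ p) y ⊎ ∃ (Top (+ p) y) → ¬ (e < d)
          impossible (inj₁ zy) _ = proj₁ ρ-top (transfer e (Zero-*ʳ φ y zy e))
          impossible (inj₂ (b , top-y)) e<d = proj₁ top (untransfer (d ℕ.+ b) (proj₂ ρ-top (d ℕ.+ b) (ℕ.<-≤-trans e<d (ℕ.m≤m+n d b))))
            where
            top : Top (+ p) (φ *ₚ y) (d ℕ.+ b)
            top = Top-* pl φ y φ-Top top-y
            untransfer : ∀ k → + p ∣ coeff ρ k → + p ∣ coeff (φ *ₚ y) k
            untransfer k h = ℤD.∣m+n∣n⇒∣m {m = coeff (φ *ₚ y) k} (subst (+ p ∣_) (coeff-M (φ *ₚ y) ρ k) (φy k)) (ℤD.∣m⇒∣-m h)

    I⊎unit : ∀ f → I 1 1 f ⊎ Unit f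
    I⊎unit f with divide φ d φ-monic f
    ... | q , r , eq , small with zero⊎top (+ p) r
    ...   | inj₁ z = inj₁ (I-resp (≋-sym eq) (I-+ (φ*⇒I q) (Zero⇒I z)))
    ...   | inj₂ (e , top) with top⇒unit e e<d r top
      where
      e<d : e < d
      e<d with ℕ.≤-<-connex d e
      ... | inj₂ lt = lt
      ... | inj₁ le = contradiction (≡0⇒∣ (small e le)) (proj₁ top)
    ...     | r′ , u = inj₂ (r′ , I-resp (≋-trans (solve 5 (λ φ q r r′ M → φ :* (q :* r′) :+ (r :* r′ :+ M) := (φ :* q :+ r) :* r′ :+ M) ≋-refl φ q r r′ M)
                (+ₚ-cong (*ₚ-cong (≋-sym eq) (≋-refl {r′})) (≋-refl {M}))) (I-+ (φ*⇒I (q *ₚ r′)) u))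

    I-prime : ∀ {f g} → ¬ I 1 1 f → I 1 1 (f *ₚ g) → I 1 1 g
    I-prime {f} {g} f∉I fg∈I with I⊎unit f
    ... | inj₁ f∈I = contradiction f∈I f∉I
    ... | inj₂ (r , u) = I-cancelʳ (I-resp (≋-sym (M-cancel g)) I-0)
      (I-cancelˡ (I-resp (solve 4 (λ f g r M → g :* (f :* r :+ M) := r :* (f :* g) :+ M :* g) ≋-refl f g r M) (I-* g u)) (I-* r fg∈I))

    p-cancel : ∀ {x y} → (P *ₚ x) ≋ (P *ₚ y) → x ≋ y
    p-cancel {x} {y} eq = ⟨ (λ k → ℤ.*-cancelˡ-≡ (+ p) (coeff x k) (coeff y k) {{prime⇒nonZero pr}}
      (trans (sym (trans (at ([a]*ₚ (+ p) x) k) (coeff-• (+ p) x k))) (trans (at eq k) (trans (at ([a]*ₚ (+ p) y) k) (coeff-• (+ p) y k))))) ⟩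

    Zero-φ : ∀ f → Zero (+ p) (φ *ₚ f) → Zero (+ p) f
    Zero-φ f z with zero⊎top (+ p) f
    ... | inj₁ zf = zf
    ... | inj₂ (b , top) = contradiction (z (d ℕ.+ b)) (proj₁ (Top-* pl φ f φ-Top top))

    φ-regular : ∀ {x y} → (φ *ₚ x) ≋ (P *ₚ y) → ∃ λ z → x ≋ (P *ₚ z)
    φ-regular {x} {y} eq = Zero⇒P* x (Zero-φ x (Zero-resp (≋-sym eq) (Zero-*ˡ P y P-Zero)))

    open Regular p-cancel φ-regular I-prime public

    -- Expansions in powers of φ with the powers of p split off

    I⇒Zero : ∀ {κ} → Below 0ℤ d κ → I 1 1 κ → Zero (+ p) κ
    I⇒Zero {κ} below (inI {u} {v} s) with zero⊎top (+ p) v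
    ... | inj₁ zv = Zero-resp (≋-sym s) (Zero-+ ((P ^^ 1) *ₚ u) ((φ ^^ 1) *ₚ v) (Zero-P^ 0 u) (Zero-*ʳ (φ ^^ 1) v zv))
    -- If v were nonzero modulo p, the multiple φ v would have degree at least d modulo p, beyond
    -- the degree of κ.
    ... | inj₂ (b , top) = contradiction (Zero-top (d ℕ.+ b) (≡0⇒∣ (0∣⇒≡0 (below (d ℕ.+ b) (ℕ.m≤m+n d b)))))
        (subst (λ n → + p ∤ coeff ((φ ^^ 1) *ₚ v) n) (cong (ℕ._+ b) (ℕ.*-identityˡ d)) (proj₁ (Top-* pl (φ ^^ 1) v (φ^-monic-Top pl (∤1 pr) 1) top)))
      where
      Zero-top : ∀ k → + p ∣ coeff κ k → + p ∣ coeff ((φ ^^ 1) *ₚ v) k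
      Zero-top k h = ℤD.∣m+n∣m⇒∣n (subst (+ p ∣_) (trans (at s k) (coeff-+ ((P ^^ 1) *ₚ u) ((φ ^^ 1) *ₚ v) k)) h) (Zero-P^ 0 u k)

    -- The nonzero coefficient at i drives the recursion: its absolute value, bounded by n, shrinks
    -- with each division by p.
    p-content : ∀ n r i → coeff r i ≢ 0ℤ → ℤ.∣ coeff r i ∣ ≤ n → Below 0ℤ d r →
                ∃₂ λ e κ → r ≋ ((P ^^ e) *ₚ κ) × ¬ Zero (+ p) κ × Below 0ℤ d κ
    p-content n r i r≢0 le below with zero⊎top (+ p) r
    ... | inj₂ (b , top) = 0 , r , ≋-sym (*ₚ-identityˡ r) , (λ z → proj₁ top (z b)) , below
    p-content zero r i r≢0 le below | inj₁ z = contradiction (ℤ.∣i∣≡0⇒i≡0 (ℕ.n≤0⇒n≡0 le)) r≢0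
    p-content (suc n) r i r≢0 le below | inj₁ z with quotient-p r z
    ... | r₁ , eq with p-content n r₁ i r₁≢0 smaller below₁
      where
      coeff-r : ∀ k → coeff r k ≡ + p ℤ.* coeff r₁ k
      coeff-r k = trans (at eq k) (coeff-• (+ p) r₁ k)
      r₁≢0 : coeff r₁ i ≢ 0ℤ
      r₁≢0 r₁≡0 = r≢0 (trans (coeff-r i) (trans (cong (λ z → + p ℤ.* z) r₁≡0) (ℤ.*-zeroʳ (+ p))))
      smaller : ℤ.∣ coeff r₁ i ∣ ≤ n
      smaller = ℕ.s≤s⁻¹ (ℕ.<-≤-trans (subst (ℤ.∣ coeff r₁ i ∣ <_) (sym (trans (cong ℤ.∣_∣ (coeff-r i)) (ℤ.abs-* (+ p) (coeff r₁ i))))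
        (subst (ℤ.∣ coeff r₁ i ∣ <_) (ℕ.*-comm ℤ.∣ coeff r₁ i ∣ p) (ℕ.m<m*n ℤ.∣ coeff r₁ i ∣ p {{ℕ.≢-nonZero (λ a → r₁≢0 (ℤ.∣i∣≡0⇒i≡0 a))}} (prime>1 pr)))) le)
      below₁ : Below 0ℤ d r₁
      below₁ k d≤k with ℤ.i*j≡0⇒i≡0∨j≡0 (+ p) (trans (sym (coeff-r k)) (0∣⇒≡0 (below k d≤k)))
      ... | inj₁ p≡0 = contradiction (ℤ.+-injective p≡0) (λ { refl → ℕ.<⇒≱ (prime>0 pr) z≤n })
      ... | inj₂ eq₀ = ≡0⇒∣ eq₀
    ...   | e , κ , eq₁ , nz , belowκ = suc e , κ , ≋-trans eq (≋-trans (≋-sym ([a]*ₚ (+ p) r₁))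
              (≋-trans (*ₚ-cong (≋-refl {P}) eq₁) (≋-sym (*ₚ-assoc P (P ^^ e) κ)))) , nz , belowκ

    -- Digits are remainders modulo φ. Once its power of p is split off, such a remainder is nonzero
    -- modulo p and of degree below d, hence outside (p, φ) by `I⇒Zero`. The bound on the indices is
    -- what later limits the φ-degree of a factor.
    digits : ∀ n f → Below 0ℤ (n ℕ.* d) f → ∃ λ L → f ≋ value L × Reduced L × (∀ {i e κ} → At L i e κ → i < n)
    digits zero f below = [] , ⟨ (λ k → 0∣⇒≡0 (below k z≤n)) ⟩ , (λ ()) , λ ()
    digits (suc n) f below with divide φ d φ-monic f
    ... | q , r , eq , small with digits n q belowq
      where
      belowq : Below 0ℤ (n ℕ.* d) q
      belowq with zero⊎top 0ℤ q
      ... | inj₁ z = λ i _ → z i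
      ... | inj₂ (b , top) = λ i le → proj₂ top i (ℕ.<-≤-trans b<nd le)
        where
        b<nd : b < n ℕ.* d
        b<nd with ℕ.≤-<-connex (n ℕ.* d) b
        ... | inj₂ lt = lt
        ... | inj₁ le = contradiction (subst (0ℤ ∣_) (trans (at eq (d ℕ.+ b)) (trans (coeff-+ (φ *ₚ q) r (d ℕ.+ b)) (trans (cong (λ z → coeff (φ *ₚ q) (d ℕ.+ b) ℤ.+ z) (small (d ℕ.+ b) (ℕ.m≤m+n d b))) (ℤ.+-identityʳ _))))
              (below (d ℕ.+ b) (ℕ.+-monoʳ-≤ d le))) (proj₁ (Top-* primeLike-0 φ q (monic-Top 0∤1 φ-monic) top))
    ...   | L , q≈ , red , short with zero⊎top 0ℤ r
    ...     | inj₁ z = nothing ∷ L , ≋-trans eq (≋-trans (+ₚ-cong (*ₚ-cong (≋-refl {φ}) q≈) (⟨ (λ k → 0∣⇒≡0 (z k)) ⟩)) (+ₚ-comm (φ *ₚ value L) [])) ,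
                (λ { (there x) → red x }) , λ { (there x) → s≤s (short x) }
    ...     | inj₂ (b , top) with p-content ℤ.∣ coeff r b ∣ r b (λ e → proj₁ top (≡0⇒∣ e)) ℕ.≤-refl (λ i le → ≡0⇒∣ (small i le))
    ...       | e , κ , r≈ , nz , belowκ = just (e , κ) ∷ L , ≋-trans eq (≋-trans (+ₚ-cong (*ₚ-cong (≋-refl {φ}) q≈) r≈) (+ₚ-comm (φ *ₚ value L) ((P ^^ e) *ₚ κ))) ,
                (λ { here → λ κ∈I → nz (I⇒Zero belowκ κ∈I) ; (there x) → red x }) , λ { here → s≤s z≤n ; (there x) → s≤s (short x) }

    zero⊎unit-digit : ∀ L → Zero (+ p) (value L) ⊎ ∃₂ λ i κ → At L i 0 κ
    zero⊎unit-digit [] = inj₁ λ k → N∣0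
    zero⊎unit-digit (just (zero , κ) ∷ L) = inj₂ (0 , κ , here)
    zero⊎unit-digit (nothing ∷ L) with zero⊎unit-digit L
    ... | inj₁ z = inj₁ (Zero-*ʳ φ (value L) z)
    ... | inj₂ (i , κ , x) = inj₂ (suc i , κ , there x)
    zero⊎unit-digit (just (suc e , κ) ∷ L) with zero⊎unit-digit L
    ... | inj₁ z = inj₁ (Zero-+ ((P ^^ suc e) *ₚ κ) (φ *ₚ value L) (Zero-P^ e κ) (Zero-*ʳ φ (value L) z))
    ... | inj₂ (i , κ′ , x) = inj₂ (suc i , κ′ , there x)

  -- The factors of F

  -- H m φ c a without the factor φ that occurs for odd m.
  F : (ℕ → ℕ) → ℕ → ℤPoly → ℤ → (ℕ → ℤPoly) → ℤPoly
  F β n φ c a = c • (φ ^ (2 ℕ.* n)) +ₚ sum {n} λ i →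
    + β (suc (toℕ i)) • (a (n ∸ suc (toℕ i)) *ₚ φ ^ (2 ℕ.* n ∸ 2 ℕ.* suc (toℕ i)))

  sum-closed : (Q : ℤPoly → Set) → Q [] → (∀ {f g} → Q f → Q g → Q (f +ₚ g)) →
               ∀ n (f : Fin n → ℤPoly) → (∀ i → Q (f i)) → Q (sum f)
  sum-closed Q q₀ q₊ zero    f h = q₀
  sum-closed Q q₀ q₊ (suc n) f h = q₊ (h zero) (sum-closed Q q₀ q₊ n (f ∘ suc) (h ∘ suc))

  -- Serves to isolate the constant term of the φ-expansion: all other summands of F are multiples
  -- of φ.
  sum-last : (Q : ℤPoly → Set) → (∀ {f g} → f ≋ g → Q f → Q g) → (∀ {f g} → Q (f +ₚ g) → Q f → Q g) →
             ∀ n (f : Fin (suc n) → ℤPoly) → (∀ i → toℕ i < n → Q (f i)) → Q (sum f) → ∃ λ i → toℕ i ≡ n × Q (f i)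
  sum-last Q resp cancel zero f h q = zero , refl , resp (+ₚ-identityʳ (f zero)) q
  sum-last Q resp cancel (suc n) f h q with sum-last Q resp cancel n (f ∘ suc) (λ i lt → h (suc i) (s≤s lt)) (cancel q (h zero (s≤s z≤n)))
  ... | i , eq , qi = suc i , cong suc eq , qi

  monic-* : ∀ {f g a e} → IsMonic f a → IsMonic g e → IsMonic (f *ₚ g) (a ℕ.+ e)
  monic-* {f} {g} {a} {e} (monic l bf) (monic l′ bg) with product-coeff {0ℤ} f g a e (λ i le → ≡0⇒∣ (bf i le)) (λ i le → ≡0⇒∣ (bg i le))
  ... | top , below = monic (trans (ℤ.i-j≡0⇒i≡j _ _ (0∣⇒≡0 top)) (cong₂ ℤ._*_ l l′)) λ i le → 0∣⇒≡0 (below i le)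

  monic-^ : ∀ {f a} → IsMonic f a → ∀ k → IsMonic (f ^ k) (k ℕ.* a)
  monic-^ mon zero    = monic refl λ { zero () ; (suc i) _ → refl }
  monic-^ mon (suc k) = monic-* mon (monic-^ mon k)

  Top-• : ∀ {N} → PrimeLike N → ∀ x f {a} → N ∤ x → Top N f a → Top N (x • f) a
  Top-• {N} pl x f {a} n (nf , bf) = (λ d → [ n , nf ]′ (pl x (coeff f a) (subst (N ∣_) (coeff-• x f a) d))) ,
    λ i le → subst (N ∣_) (sym (coeff-• x f i)) (ℤD.∣n⇒∣m*n x (bf i le))

  Top-≤ : ∀ {N} f {a e} → Top N f a → Top 0ℤ f e → a ≤ e
  Top-≤ f {a} {e} (n , _) (_ , below) with ℕ.≤-<-connex a e
  ... | inj₁ le = le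
  ... | inj₂ gt = contradiction (≡0⇒∣ (0∣⇒≡0 (below a gt))) n

  •-cancel : ∀ {p} → Prime p → ∀ f g → ((+ p) • f) ≋ ((+ p) • g) → f ≋ g
  •-cancel {p} pr f g eq = ⟨ (λ k → ℤ.*-cancelˡ-≡ (+ p) (coeff f k) (coeff g k) {{prime⇒nonZero pr}}
    (trans (sym (coeff-• (+ p) f k)) (trans (at eq k) (coeff-• (+ p) g k)))) ⟩

  Top-÷ : ∀ {p} → Prime p → ∀ {f g a} → f ≋ ((+ p) • g) → Top 0ℤ f a → Top 0ℤ g a
  Top-÷ {p} pr {f} {g} {a} eq (n , below) = (λ d → n (≡0⇒∣ (trans (c a) (trans (cong (λ z → + p ℤ.* z) (0∣⇒≡0 d)) (ℤ.*-zeroʳ (+ p)))))) , below′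
    where
    c : ∀ k → coeff f k ≡ + p ℤ.* coeff g k
    c k = trans (at eq k) (coeff-• (+ p) g k)
    below′ : Below 0ℤ (suc a) g
    below′ i le with ℤ.i*j≡0⇒i≡0∨j≡0 (+ p) (trans (sym (c i)) (0∣⇒≡0 (below i le)))
    ... | inj₂ eq₀ = ≡0⇒∣ eq₀
    ... | inj₁ p≡0 = contradiction (ℤ.+-injective p≡0) λ { refl → ℕ.<⇒≱ (prime>0 pr) z≤n }

  -- Gauss's lemma localised at p: only the p-part of the denominator D is cancelled.
  record Primitive (p : ℕ) (f g h : ℤPoly) : Set where
    field
      D     : ℤ
      g′ h′ : ℤPoly
      p∤D   : + p ∤ D
      eq    : (D • f) ≋ (g′ *ₚ h′)
      top-g : ∀ {a} → Top 0ℤ g a → Top 0ℤ g′ a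
      top-h : ∀ {a} → Top 0ℤ h a → Top 0ℤ h′ a

  -- Descent on |D|: if p divides D then it divides g h, and comparing top coefficients modulo p it
  -- divides g or h, so one factor p can be cancelled. Dividing by p does not change degrees over ℤ.
  gauss : ∀ {p} → Prime p → ∀ n D f g h → ℤ.∣ D ∣ ≤ n → D ≢ 0ℤ → (D • f) ≋ (g *ₚ h) → Primitive p f g h
  gauss {p} pr n D f g h le D≢0 eq with + p ∣? D
  ... | no p∤D = record { D = D ; g′ = g ; h′ = h ; p∤D = p∤D ; eq = eq ; top-g = λ t → t ; top-h = λ t → t }
  gauss pr zero D f g h le D≢0 eq | yes _ = contradiction (ℤ.∣i∣≡0⇒i≡0 (ℕ.n≤0⇒n≡0 le)) D≢0
  gauss {p} pr (suc n) D f g h le D≢0 eq | yes (divides q D≡qp) = split (zero⊎top (+ p) g) (zero⊎top (+ p) h)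
    where
    D≡pq : D ≡ + p ℤ.* q
    D≡pq = trans D≡qp (ℤ.*-comm q (+ p))
    q≢0 : q ≢ 0ℤ
    q≢0 refl = D≢0 D≡qp
    smaller : ℤ.∣ q ∣ ≤ n
    smaller = ℕ.s≤s⁻¹ (ℕ.<-≤-trans (subst (ℤ.∣ q ∣ <_) (sym (trans (cong ℤ.∣_∣ D≡qp) (ℤ.abs-* q (+ p))))
      (ℕ.m<m*n ℤ.∣ q ∣ p {{ℕ.≢-nonZero (q≢0 ∘ ℤ.∣i∣≡0⇒i≡0)}} (prime>1 pr))) le)
    pqf : (D • f) ≋ ((+ p) • (q • f))
    pqf = ≋-trans (•-cong D≡pq ≋-refl) (•-assoc (+ p) q f)
    split : Zero (+ p) g ⊎ ∃ (Top (+ p) g) → Zero (+ p) h ⊎ ∃ (Top (+ p) h) → Primitive p f g h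
    split (inj₁ zg) _ with quotient-p g zg
    ... | g₁ , g≈ = record { Primitive rec ; top-g = λ t → Primitive.top-g rec (Top-÷ pr g≈ t) ; top-h = Primitive.top-h rec }
      where
      rec : Primitive p f g₁ h
      rec = gauss pr n q f g₁ h smaller q≢0 (•-cancel pr (q • f) (g₁ *ₚ h)
        (≋-trans (≋-sym pqf) (≋-trans eq (≋-trans (*ₚ-cong g≈ (≋-refl {h})) (•-*ₚ (+ p) g₁ h)))))
    split (inj₂ _) (inj₁ zh) with quotient-p h zh
    ... | h₁ , h≈ = record { Primitive rec ; top-g = Primitive.top-g rec ; top-h = λ t → Primitive.top-h rec (Top-÷ pr h≈ t) }
      where
      rec : Primitive p f g h₁
      rec = gauss pr n q f g h₁ smaller q≢0 (•-cancel pr (q • f) (g *ₚ h₁)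
        (≋-trans (≋-sym pqf) (≋-trans eq (≋-trans (*ₚ-cong (≋-refl {g}) h≈) (*ₚ-• (+ p) g h₁)))))
    split (inj₂ (a , tg)) (inj₂ (e , th)) = contradiction
      (Zero-resp (≋-trans (≋-sym pqf) eq) (λ i → subst (+ p ∣_) (sym (coeff-• (+ p) (q • f) i)) (ℤD.∣m⇒∣m*n (coeff (q • f) i) ℤD.∣-refl)) (a ℕ.+ e))
      (proj₁ (Top-* (primeLike-p pr) g h tg th))

  2*-∸ : ∀ n j → 2 ℕ.* n ∸ 2 ℕ.* j ≡ 2 ℕ.* (n ∸ j)
  2*-∸ n j = sym (ℕ.*-distribˡ-∸ 2 n j)

  module _ (β : ℕ → ℕ) (m n : ℕ) {φ : ℤPoly} {d : ℕ} (φ-monic : IsMonic φ d) (d>0 : 0 < d) (n>0 : 0 < n)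
           (β0≡1 : β 0 ≡ 1) {c : ℤ} (c≢0 : c ≢ 0ℤ) (a : ℕ → ℤPoly) (a-low : ∀ i → i < n → Below 0ℤ d (a i)) where

    private
      G : ℤPoly
      G = F β n φ c a
      N : ℕ
      N = 2 ℕ.* n
      term : Fin n → ℤPoly
      term i = + β (suc (toℕ i)) • (a (n ∸ suc (toℕ i)) *ₚ φ ^ (N ∸ 2 ℕ.* suc (toℕ i)))
      lead : ℤPoly
      lead = c • (φ ^ N)

    idx< : ∀ (i : Fin n) → n ∸ suc (toℕ i) < n
    idx< i = ℕ.∸-monoʳ-< {m = n} {n = suc (toℕ i)} {o = 0} (s≤s z≤n) (Fin.toℕ<n i)

    term-low : ∀ i → Below 0ℤ (N ℕ.* d) (term i)
    term-low i k le = subst (0ℤ ∣_) (sym (coeff-• (+ β (suc (toℕ i))) (a (n ∸ suc (toℕ i)) *ₚ φ ^ (N ∸ 2 ℕ.* suc (toℕ i))) k)) (ℤD.∣n⇒∣m*n (+ β (suc (toℕ i)))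
      (proj₂ (product-coeff {0ℤ} (a (n ∸ suc (toℕ i))) (φ ^ e) (d ∸ 1) (e ℕ.* d) (subst (λ z → Below 0ℤ z (a (n ∸ suc (toℕ i)))) (sym d≡) (a-low _ (idx< i)))
        (λ i le → ≡0⇒∣ (IsMonic.beyond≡0 (monic-^ φ-monic e) i le))) k bound))
      where
      e = N ∸ 2 ℕ.* suc (toℕ i)
      d≡ : suc (d ∸ 1) ≡ d
      d≡ = ℕ.m+[n∸m]≡n d>0
      e< : suc e ≤ N
      e< = ℕ.∸-monoʳ-< {m = N} {n = 2 ℕ.* suc (toℕ i)} {o = 0} (s≤s z≤n) (ℕ.*-monoʳ-≤ 2 (Fin.toℕ<n i))
      bound : suc (d ∸ 1 ℕ.+ e ℕ.* d) ≤ k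
      bound = ℕ.≤-trans (ℕ.≤-reflexive (cong (ℕ._+ e ℕ.* d) d≡)) (ℕ.≤-trans (ℕ.*-monoˡ-≤ d e<) le)

    sum-low : Below 0ℤ (N ℕ.* d) (sum term)
    sum-low = sum-closed (Below 0ℤ (N ℕ.* d)) (λ i _ → N∣0) (λ {f} {g} bf bg i le → subst (0ℤ ∣_) (sym (coeff-+ f g i)) (ℤD.∣m∣n⇒∣m+n (bf i le) (bg i le))) n term term-low

    F-Top : ∀ {N′} → N′ ∤ c → Top N′ G (N ℕ.* d)
    F-Top {N′} n = (λ d′ → n (subst (N′ ∣_) top d′)) , λ i le → ≡0⇒∣ (trans (coeff-+ lead (sum term) i)
        (cong₂ ℤ._+_ (trans (coeff-• c (φ ^ N) i) (trans (cong (c ℤ.*_) (IsMonic.beyond≡0 (monic-^ φ-monic N) i le)) (ℤ.*-zeroʳ c))) (0∣⇒≡0 (sum-low i (ℕ.<⇒≤ le)))))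
      where
      top : coeff G (N ℕ.* d) ≡ c
      top = trans (coeff-+ lead (sum term) (N ℕ.* d)) (trans (cong₂ ℤ._+_ (trans (coeff-• c (φ ^ N) (N ℕ.* d))
          (trans (cong (c ℤ.*_) (IsMonic.leading≡1 (monic-^ φ-monic N))) (ℤ.*-identityʳ c))) (0∣⇒≡0 (sum-low (N ℕ.* d) ℕ.≤-refl))) (ℤ.+-identityʳ c))

    F-Top₀ : Top 0ℤ G (N ℕ.* d)
    F-Top₀ = F-Top (c≢0 ∘ 0∣⇒≡0)

    module _ {t : ℕ} (wit : Witness β m n t) (t≥1 : 1 ≤ t) (2t≤1+n : t ℕ.+ t ≤ suc n)
             (irr : IrreducibleMod (Witness.p wit) φ) (p∤c : + Witness.p wit ∤ c) (a₀≢0 : ¬ Zero (+ Witness.p wit) (a 0)) where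

      open Witness wit
      open Local p-prime φ-monic irr
      open WeightArithmetic W w using (wt)

      ^^≡^ : ∀ f k → f ^^ k ≡ f ^ k
      ^^≡^ f zero    = refl
      ^^≡^ f (suc k) = cong (f *ₚ_) (^^≡^ f k)

      P^-coeff : ∀ e f → ((+ (p ℕ.^ e)) • f) ≋ ((P ^^ e) *ₚ f)
      P^-coeff zero f = ≋-trans (•-identityˡ f) (≋-sym (*ₚ-identityˡ f))
      P^-coeff (suc e) f = ≋-trans (•-cong (ℤ.pos-* p (p ℕ.^ e)) ≋-refl) (≋-trans (•-assoc (+ p) (+ (p ℕ.^ e)) f)
        (≋-trans (•-cong {a = + p} refl (P^-coeff e f)) (≋-trans (≋-sym ([a]*ₚ (+ p) ((P ^^ e) *ₚ f))) (≋-sym (*ₚ-assoc P (P ^^ e) f)))))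

      summand : ∀ e x (f : ℤPoly) k → p ℕ.^ e ℕD.∣ x → ∃ λ y → x ≡ y ℕ.* p ℕ.^ e × ((+ x) • (f *ₚ φ ^ k)) ≋ ((P ^^ e) *ₚ ((φ ^^ k) *ₚ ((+ y) • f)))
      summand e x f k (ℕD.divides y eq) = y , eq , ≋-trans (•-cong (trans (cong +_ (trans eq (ℕ.*-comm y (p ℕ.^ e)))) (ℤ.pos-* (p ℕ.^ e) y)) ≋-refl)
        (≋-trans (•-assoc (+ (p ℕ.^ e)) (+ y) (f *ₚ φ ^ k)) (≋-trans (P^-coeff e ((+ y) • (f *ₚ φ ^ k))) (*ₚ-cong (≋-refl {P ^^ e})
          (≋-trans (≋-sym (•-*ₚ (+ y) f (φ ^ k))) (≋-trans (*ₚ-comm ((+ y) • f) (φ ^ k)) (*ₚ-cong (subst (φ ^ k ≋_) (sym (^^≡^ φ k)) (≋-refl {φ ^ k})) (≋-refl {(+ y) • f})))))))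

      scale : ∀ x f → (x • f) ≋ ((x ∷ []) *ₚ f)
      scale x f = ≋-sym ([a]*ₚ x f)

      E : ℕ
      E = N ∸ 2 ℕ.* (t ∸ 1)

      lead≈ : lead ≋ ((φ ^^ N) *ₚ (c ∷ []))
      lead≈ = ≋-trans (scale c (φ ^ N)) (≋-trans (*ₚ-comm (c ∷ []) (φ ^ N)) (*ₚ-cong (subst (φ ^ N ≋_) (sym (^^≡^ φ N)) (≋-refl {φ ^ N})) (≋-refl {c ∷ []})))

      term-φ : ∀ i → ∃ λ h → term i ≋ ((φ ^^ (N ∸ 2 ℕ.* suc (toℕ i))) *ₚ h)
      term-φ i with summand 0 (β (suc (toℕ i))) (a (n ∸ suc (toℕ i))) (N ∸ 2 ℕ.* suc (toℕ i)) (ℕD.1∣ _)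
      ... | y , _ , eq = _ , ≋-trans eq (*ₚ-identityˡ _)

      -- The summands with j ≥ t vanish modulo p; in the others and in the leading term the exponent
      -- of φ is at least N - 2 (t - 1), its value at j = t - 1.
      F∈I : I 1 E G
      F∈I = I-+ (I-resp (≋-sym lead≈) (I-φ (c ∷ []) (ℕ.m∸n≤m N (2 ℕ.* (t ∸ 1)))))
        (sum-closed (I 1 E) I-0 I-+ n term member)
        where
        body : Fin n → ℤPoly
        body i = a (n ∸ suc (toℕ i)) *ₚ φ ^ (N ∸ 2 ℕ.* suc (toℕ i))
        member : ∀ i → I 1 E (term i)
        member i with ℕ.≤-<-connex t (suc (toℕ i))
        ... | inj₁ t≤j = Zero⇒I λ k → subst (+ p ∣_) (sym (coeff-• (+ β (suc (toℕ i))) (body i) k)) (ℤD.∣m⇒∣m*n {m = + β (suc (toℕ i))} (coeff (body i) k) (ℤD.∣ᵤ⇒∣ (p∣β (suc (toℕ i)) t≤j)))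
        ... | inj₂ j<t with term-φ i
        ...   | h , eq = I-resp (≋-sym eq) (I-φ h (ℕ.∸-monoʳ-≤ N (ℕ.*-monoʳ-≤ 2 (ℕ.∸-monoˡ-≤ 1 j<t))))

      F-heavy : Span (λ x y → W ℕ.* V ≤ wt x y) G
      F-heavy = plus lead-heavy (sum-closed (Span (λ x y → W ℕ.* V ≤ wt x y)) zero-heavy (λ x y → plus x y ≋-refl) n term member) ≋-refl
        where
        -- As β 0 = 1, the order that `heavy` provides at j = 0 can only be 0, so φ^N alone carries
        -- the weight.
        lead-weight : W ℕ.* V ≤ wt 0 N
        lead-weight with heavy 0 n refl n>0
        ... | zero , _ , le = le
        ... | suc e , p^∣1 , _ = contradiction (subst (p ℕD.∣_) β0≡1 (ℕD.m*n∣⇒m∣ p (p ℕ.^ e) p^∣1)) (prime∤1 p-prime)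
        zero-heavy : Span (λ x y → W ℕ.* V ≤ wt x y) []
        zero-heavy = mono 0 N [] lead-weight (≋-sym (≋-trans (*ₚ-identityˡ _) (*ₚ-zeroʳ (φ ^^ N))))
        lead-heavy : Span (λ x y → W ℕ.* V ≤ wt x y) lead
        lead-heavy = mono 0 N (c ∷ []) lead-weight (≋-trans lead≈ (≋-sym (*ₚ-identityˡ _)))
        member : ∀ i → Span (λ x y → W ℕ.* V ≤ wt x y) (term i)
        member i = cases (n ∸ suc (toℕ i)) refl
          where
          j = suc (toℕ i)
          j+≡n : j ℕ.+ (n ∸ j) ≡ n
          j+≡n = ℕ.m+[n∸m]≡n (Fin.toℕ<n i)
          build : ∀ e → p ℕ.^ e ℕD.∣ β j → W ℕ.* V ≤ W ℕ.* e ℕ.+ w ℕ.* (2 ℕ.* (n ∸ j)) → Span (λ x y → W ℕ.* V ≤ wt x y) (term i)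
          build e d le with summand e (β j) (a (n ∸ j)) (N ∸ 2 ℕ.* j) d
          ... | y , _ , eq = mono e (N ∸ 2 ℕ.* j) _ (subst (λ z → W ℕ.* V ≤ W ℕ.* e ℕ.+ w ℕ.* z) (sym (2*-∸ n j)) le) eq
          cases : ∀ k → n ∸ j ≡ k → Span (λ x y → W ℕ.* V ≤ wt x y) (term i)
          cases zero eq = build V (subst (λ z → p ℕ.^ V ℕD.∣ β z) (sym (trans (sym (ℕ.+-identityʳ j)) (trans (cong (j ℕ.+_) (sym eq)) j+≡n))) V∣β) (ℕ.m≤m+n _ _)
          cases (suc k) eq with heavy j (n ∸ j) j+≡n (subst (0 <_) (sym eq) (s≤s z≤n))
          ... | e , d , le = build e d le

      -- The constant term D b_n a₀ has content exactly divisible by p^V.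
      DF∉I : ∀ D → + p ∤ D → ¬ I (suc V) 1 ((D ∷ []) *ₚ G)
      DF∉I D p∤D DF∈I = impossible (sum-last (λ f → I (suc V) 1 ((D ∷ []) *ₚ f))
          (λ {f} {g} eq x → I-resp (*ₚ-cong (≋-refl {D ∷ []}) eq) x)
          (λ {f} {g} x y → I-cancelˡ (I-resp (*ₚ-distribˡ (D ∷ []) f g) x) y) n-1 termℓ rest whole)
        where
        n-1 = ℕ.pred n
        n≡ : suc n-1 ≡ n
        n≡ = ℕ.suc-pred n {{ℕ.>-nonZero n>0}}
        termℓ : Fin (suc n-1) → ℤPoly
        termℓ = subst (λ z → Fin z → ℤPoly) (sym n≡) term
        termℓ≡ : ∀ {k} (eq : n ≡ k) (i : Fin k) → ∃ λ i′ → toℕ i′ ≡ toℕ i × subst (λ z → Fin z → ℤPoly) eq term i ≡ term i′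
        termℓ≡ refl i = i , refl , refl
        sumℓ≡ : ∀ {k} (eq : n ≡ k) → sum (subst (λ z → Fin z → ℤPoly) eq term) ≡ sum term
        sumℓ≡ refl = refl
        in-φ : ∀ k h {f} → 1 ≤ k → f ≋ ((φ ^^ k) *ₚ h) → I (suc V) 1 ((D ∷ []) *ₚ f)
        in-φ k h 1≤k eq = I-* (D ∷ []) (I-resp (≋-sym eq) (I-φ h 1≤k))
        whole : I (suc V) 1 ((D ∷ []) *ₚ sum termℓ)
        whole = subst (λ z → I (suc V) 1 ((D ∷ []) *ₚ z)) (sym (sumℓ≡ (sym n≡)))
          (I-cancelˡ (I-resp (*ₚ-distribˡ (D ∷ []) lead (sum term)) DF∈I) (in-φ N (c ∷ []) (ℕ.≤-trans n>0 (ℕ.m≤m+n n (n ℕ.+ 0))) lead≈))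
        rest : ∀ i → toℕ i < n-1 → I (suc V) 1 ((D ∷ []) *ₚ termℓ i)
        rest i lt with termℓ≡ (sym n≡) i
        ... | i′ , eq , eq′ with term-φ i′
        ...   | h , eq″ = subst (λ z → I (suc V) 1 ((D ∷ []) *ₚ z)) (sym eq′) (in-φ _ h 1≤ eq″)
          where
          1≤ : 1 ≤ N ∸ 2 ℕ.* suc (toℕ i′)
          1≤ = subst (1 ≤_) (sym (2*-∸ n (suc (toℕ i′)))) (ℕ.≤-trans (ℕ.m<n⇒0<n∸m (subst (suc (toℕ i′) <_) n≡ (s≤s (subst (_< n-1) (sym eq) lt)))) (ℕ.m≤m+n (n ∸ suc (toℕ i′)) _))
        impossible : (∃ λ i → toℕ i ≡ n-1 × I (suc V) 1 ((D ∷ []) *ₚ termℓ i)) → ⊥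
        impossible (i , i≡ , mem) with termℓ≡ (sym n≡) i
        ... | i′ , eq , eq′ = final (summand V (β n) (a 0) 0 V∣β)
          where
          j≡n : suc (toℕ i′) ≡ n
          j≡n = trans (cong suc (trans eq i≡)) n≡
          term≡ : term i′ ≡ + β n • (a 0 *ₚ φ ^ 0)
          term≡ = trans (cong (λ z → + β z • (a (n ∸ z) *ₚ φ ^ (N ∸ 2 ℕ.* z))) j≡n)
            (cong₂ (λ x y → + β n • (a x *ₚ φ ^ y)) (ℕ.n∸n≡0 n) (ℕ.n∸n≡0 N))
          final : (∃ λ y → β n ≡ y ℕ.* p ℕ.^ V × ((+ β n) • (a 0 *ₚ φ ^ 0)) ≋ ((P ^^ V) *ₚ ((φ ^^ 0) *ₚ ((+ y) • a 0)))) → ⊥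
          final (y , b≡ , shape) = a₀≢0 λ k → strip k (I⇒Zero {h} low unit∈I k)
            where
            h : ℤPoly
            h = (D ∷ []) *ₚ ((+ y) • a 0)
            h-coeff : ∀ k → coeff h k ≡ D ℤ.* (+ y ℤ.* coeff (a 0) k)
            h-coeff k = trans (at ([a]*ₚ D ((+ y) • a 0)) k) (trans (coeff-• D ((+ y) • a 0) k) (cong (D ℤ.*_) (coeff-• (+ y) (a 0) k)))
            low : Below 0ℤ d h
            low k le = subst (0ℤ ∣_) (sym (h-coeff k)) (ℤD.∣n⇒∣m*n D (ℤD.∣n⇒∣m*n (+ y) (a-low 0 n>0 k le)))
            moved : ((D ∷ []) *ₚ ((P ^^ V) *ₚ ((φ ^^ 0) *ₚ ((+ y) • a 0)))) ≋ ((P ^^ V) *ₚ ((φ ^^ 0) *ₚ h))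
            moved = ≋-trans (x∙yz≈y∙xz (D ∷ []) (P ^^ V) _) (*ₚ-cong (≋-refl {P ^^ V}) (x∙yz≈y∙xz (D ∷ []) (φ ^^ 0) _))
              where
              x∙yz≈y∙xz : ∀ x y z → (x *ₚ (y *ₚ z)) ≋ (y *ₚ (x *ₚ z))
              x∙yz≈y∙xz x y z = ≋-trans (≋-sym (*ₚ-assoc x y z)) (≋-trans (*ₚ-cong (*ₚ-comm x y) (≋-refl {z})) (*ₚ-assoc y x z))
            unit∈I : I 1 1 h
            unit∈I = I-colon V 0 (I-resp (≋-trans (*ₚ-cong (≋-refl {D ∷ []}) shape) moved) (subst (λ z → I (suc V) 1 ((D ∷ []) *ₚ z)) (trans eq′ term≡) mem))
            p∤y : + p ∤ + y
            p∤y p∣y = V∤β (subst (p ℕ.* p ℕ.^ V ℕD.∣_) (sym b≡) (ℕD.*-monoˡ-∣ (p ℕ.^ V) (ℤD.∣⇒∣ᵤ p∣y)))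
            strip : ∀ k → + p ∣ coeff h k → + p ∣ coeff (a 0) k
            strip k div with pl D (+ y ℤ.* coeff (a 0) k) (subst (+ p ∣_) (h-coeff k) div)
            ... | inj₁ x = contradiction x p∤D
            ... | inj₂ x with pl (+ y) (coeff (a 0) k) x
            ...   | inj₁ x′ = contradiction x′ p∤y
            ...   | inj₂ x′ = x′

      -- Modulo p, φ must divide f: otherwise φ^E would divide g, whose degree is less than E d by
      -- the lower bound on δ. But if φ divides f, the expansion of f, nonzero modulo p, has a unit
      -- digit at an index i ≤ δ / d ≤ min (2t, n). By `light` this has weight less than W, against
      -- `no-factorisation`.
      no-small-factor : ∀ f₀ g₀ → Primitive p G f₀ g₀ → ∀ {δ δ′} → Top 0ℤ f₀ δ → Top 0ℤ g₀ δ′ →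
                        δ ℕ.+ δ′ ≡ N ℕ.* d → (2 ℕ.* (t ∸ 1)) ℕ.* d < δ → δ ≤ (t ℕ.+ t) ℕ.* d → δ ≤ n ℕ.* d → ⊥
      no-small-factor f₀ g₀ pm {δ} {δ′} topf₀ topg₀ δ+δ′ lower upper δ≤nd = transfer
        where
        open Primitive pm renaming (g′ to f; h′ to g)
        instance
          d≢0 : ℕ.NonZero d
          d≢0 = ℕ.>-nonZero d>0
        topf : Top 0ℤ f δ
        topf = top-g topf₀
        topg : Top 0ℤ g δ′
        topg = top-h topg₀
        prod : ((D ∷ []) *ₚ G) ≋ (f *ₚ g)
        prod = ≋-trans ([a]*ₚ D G) eq
        top-fg : Top (+ p) (f *ₚ g) (N ℕ.* d)
        top-fg = Top-resp eq (Top-• pl D G p∤D (F-Top p∤c))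
        exists-top : ∀ h k → Zero (+ p) h ⊎ ∃ (Top (+ p) h) → (Zero (+ p) h → Zero (+ p) (f *ₚ g)) → Top 0ℤ h k → ∃ λ e → Top (+ p) h e × e ≤ k
        exists-top h k (inj₁ z) zero-product _ = contradiction (zero-product z (N ℕ.* d)) (proj₁ top-fg)
        exists-top h k (inj₂ (e , top)) _ top₀ = e , top , Top-≤ h top top₀
        -- Degrees can only drop modulo p, and their sum is still N d because p divides neither D
        -- nor c; so neither drops.
        tops : Top (+ p) f δ × Top (+ p) g δ′
        tops with exists-top f δ (zero⊎top (+ p) f) (Zero-*ˡ f g) topf | exists-top g δ′ (zero⊎top (+ p) g) (Zero-*ʳ f g) topg
        ... | e , tf , e≤δ | e′ , tg , e′≤δ′ = subst (Top (+ p) f) e≡ tf , subst (Top (+ p) g) e′≡ tg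
          where
          total : e ℕ.+ e′ ≡ δ ℕ.+ δ′
          total = trans (Top-unique (f *ₚ g) (Top-* pl f g tf tg) top-fg) (sym δ+δ′)
          e≡ : e ≡ δ
          e≡ = ℕ.≤-antisym e≤δ (ℕ.+-cancelʳ-≤ e′ δ e (ℕ.≤-trans (ℕ.+-monoʳ-≤ δ e′≤δ′) (ℕ.≤-reflexive (sym total))))
          e′≡ : e′ ≡ δ′
          e′≡ = ℕ.+-cancelˡ-≡ δ e′ δ′ (trans (cong (ℕ._+ e′) (sym e≡)) total)
        Expansion : ℤPoly → ℕ → Set
        Expansion h k = ∃ λ L → h ≋ value L × Reduced L × (∀ {i e κ} → At L i e κ → i < k)
        contradictory : I 1 1 f → Expansion f (suc (δ / d)) → Expansion g (suc δ′) → ⊥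
        contradictory f∈I (L , f≈ , redL , short) (K , g≈ , redK , _) = unit-digit (zero⊎unit-digit L)
          where
          id≤δ : ∀ {i} → i < suc (δ / d) → i ℕ.* d ≤ δ
          id≤δ lt = ℕ.≤-trans (ℕ.*-monoˡ-≤ d (ℕ.s≤s⁻¹ lt)) (m/n*n≤m δ d)
          unit-digit : Zero (+ p) (value L) ⊎ (∃₂ λ i κ → At L i 0 κ) → ⊥
          unit-digit (inj₁ z) = proj₁ (proj₁ tops) (Zero-resp (≋-sym f≈) z δ)
          unit-digit (inj₂ (i , κ , x)) = no-factorisation W w {f} {g} {L} {K} {V} redL redK f≈ g≈ f∈I x
            (subst (_< W) (ℕ.*-comm i w) (light i (ℕ.*-cancelʳ-≤ i (t ℕ.+ t) d (ℕ.≤-trans (id≤δ (short x)) upper)) (ℕ.*-cancelʳ-≤ i n d (ℕ.≤-trans (id≤δ (short x)) δ≤nd))))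
            (λ y → DF∉I D p∤D (I-resp (≋-sym prod) y))
            (Span-resp prod (Span-scale (D ∷ []) F-heavy))
        f∉I : ¬ I 1 1 f
        f∉I f∈I = contradictory f∈I (digits (suc (δ / d)) f (λ i le → proj₂ topf i (ℕ.<-≤-trans δ< le)))
                                    (digits (suc δ′) g (λ i le → proj₂ topg i (ℕ.≤-trans (ℕ.m≤m*n (suc δ′) d) le)))
          where
          δ< : δ < suc (δ / d) ℕ.* d
          δ< = subst (_< suc (δ / d) ℕ.* d) (sym (m≡m%n+[m/n]*n δ d)) (ℕ.+-monoˡ-< (δ / d ℕ.* d) (m%n<n δ d))
        transfer : ⊥
        transfer = finish (I-φ^-transfer E f∉I (I-resp prod (I-* (D ∷ []) F∈I)))
          where
          finish : I 1 E g → ⊥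
          finish (inI {u} {v} s) with zero⊎top (+ p) v
          ... | inj₁ zv = proj₁ (proj₂ tops) (Zero-resp (≋-sym s) (Zero-+ ((P ^^ 1) *ₚ u) ((φ ^^ E) *ₚ v) (Zero-P^ 0 u) (Zero-*ʳ (φ ^^ E) v zv)) δ′)
          ... | inj₂ (e , tv) = ℕ.<⇒≱ lower (ℕ.+-cancelʳ-≤ δ′ δ _ (begin
              δ ℕ.+ δ′                                   ≡⟨ δ+δ′ ⟩
              N ℕ.* d                                    ≡⟨ cong (ℕ._* d) (sym (ℕ.m+[n∸m]≡n 2t-2≤N)) ⟩
              (2 ℕ.* (t ∸ 1) ℕ.+ E) ℕ.* d                ≡⟨ ℕ.*-distribʳ-+ d (2 ℕ.* (t ∸ 1)) E ⟩
              2 ℕ.* (t ∸ 1) ℕ.* d ℕ.+ E ℕ.* d            ≤⟨ ℕ.+-monoʳ-≤ (2 ℕ.* (t ∸ 1) ℕ.* d) Ed≤δ′ ⟩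
              2 ℕ.* (t ∸ 1) ℕ.* d ℕ.+ δ′                 ∎))
            where
            open ℕ.≤-Reasoning
            2t-2≤N : 2 ℕ.* (t ∸ 1) ≤ N
            2t-2≤N = ℕ.*-monoʳ-≤ 2 (ℕ.≤-trans (ℕ.∸-monoˡ-≤ 1 (ℕ.≤-trans (ℕ.m≤m+n t t) 2t≤1+n)) ℕ.≤-refl)
            top-φv : Top (+ p) ((φ ^^ E) *ₚ v) (E ℕ.* d ℕ.+ e)
            top-φv = Top-* pl (φ ^^ E) v (φ^-monic-Top pl (∤1 p-prime) E) tv
            top-g′ : + p ∤ coeff g (E ℕ.* d ℕ.+ e)
            top-g′ div = proj₁ top-φv (ℤD.∣m+n∣m⇒∣n (subst (+ p ∣_) (trans (at s _) (coeff-+ ((P ^^ 1) *ₚ u) ((φ ^^ E) *ₚ v) _)) div) (Zero-P^ 0 u (E ℕ.* d ℕ.+ e)))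
            Ed≤δ′ : E ℕ.* d ≤ δ′
            Ed≤δ′ with ℕ.≤-<-connex (E ℕ.* d) δ′
            ... | inj₁ le = le
            ... | inj₂ gt = contradiction (proj₂ (proj₂ tops) (E ℕ.* d ℕ.+ e) (ℕ.<-≤-trans gt (ℕ.m≤m+n _ e))) top-g′

  -- From ℤ to ℚ

  module _ (β : ℕ → ℕ) (m n : ℕ) {φ : ℤPoly} {d : ℕ} (φ-monic : IsMonic φ d) (d>0 : 0 < d) (n>0 : 0 < n)
           (β0≡1 : β 0 ≡ 1) {c : ℤ} (c≢0 : c ≢ 0ℤ) (a : ℕ → ℤPoly) (a-low : ∀ i → i < n → Below 0ℤ d (a i))
           (irr : ∀ p → Prime p → p ≤ m → IrreducibleMod p φ)
           (p∤c : ∀ p → Prime p → p ≤ m → + p ∤ c) (a₀≢0 : ∀ p → Prime p → p ≤ m → ¬ Zero (+ p) (a 0))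
           (witness : ∀ t → 1 ≤ t → t ℕ.+ t ≤ suc n → Witness β m n t) where

    private
      G : ℤPoly
      G = F β n φ c a

    no-proper-factor : ∀ D f g → D ≢ 0ℤ → (D • G) ≋ (f *ₚ g) → ∀ {δ δ′} → Top 0ℤ f δ → Top 0ℤ g δ′ →
                       δ ℕ.+ δ′ ≡ 2 ℕ.* n ℕ.* d → 0 < δ → δ ≤ δ′ → ⊥
    no-proper-factor D f g D≢0 eq {δ} {δ′} topf topg total δ>0 δ≤δ′ =
      no-small-factor β m n φ-monic d>0 n>0 β0≡1 c≢0 a a-low {t} wit (s≤s z≤n) 2t≤1+n (irr _ (Witness.p-prime wit) (Witness.p≤m wit))
        (p∤c _ (Witness.p-prime wit) (Witness.p≤m wit)) (a₀≢0 _ (Witness.p-prime wit) (Witness.p≤m wit))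
        f g (gauss (Witness.p-prime wit) ℤ.∣ D ∣ D G f g ℕ.≤-refl D≢0 eq) topf topg total lower upper δ≤nd
      where
      open ℕ.≤-Reasoning
      instance
        2d≢0 : ℕ.NonZero (2 ℕ.* d)
        2d≢0 = ℕ.>-nonZero (ℕ.≤-trans d>0 (ℕ.m≤m+n d (d ℕ.+ 0)))
      -- This makes t = q + 1 the least t with δ ≤ 2t d. Minimality gives 2q d < δ ≤ n d, hence 2q <
      -- n and 2t ≤ n + 1.
      q = (δ ∸ 1) / (2 ℕ.* d)
      r = (δ ∸ 1) % (2 ℕ.* d)
      t = suc q
      δ≡ : δ ≡ suc (r ℕ.+ q ℕ.* (2 ℕ.* d))
      δ≡ = trans (sym (ℕ.m+[n∸m]≡n δ>0)) (cong suc (m≡m%n+[m/n]*n (δ ∸ 1) (2 ℕ.* d)))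
      lower : 2 ℕ.* q ℕ.* d < δ
      lower = begin-strict
        2 ℕ.* q ℕ.* d                   ≡⟨ s q d ⟩
        q ℕ.* (2 ℕ.* d)                 ≤⟨ ℕ.m≤n+m _ r ⟩
        r ℕ.+ q ℕ.* (2 ℕ.* d)           <⟨ ℕ.n<1+n _ ⟩
        suc (r ℕ.+ q ℕ.* (2 ℕ.* d))     ≡⟨ sym δ≡ ⟩
        δ                               ∎
        where
        s : ∀ q d → 2 ℕ.* q ℕ.* d ≡ q ℕ.* (2 ℕ.* d)
        s = ℕSolver.solve-∀
      upper : δ ≤ (t ℕ.+ t) ℕ.* d
      upper = begin
        δ                                ≡⟨ δ≡ ⟩
        suc r ℕ.+ q ℕ.* (2 ℕ.* d)        ≤⟨ ℕ.+-monoˡ-≤ (q ℕ.* (2 ℕ.* d)) (m%n<n (δ ∸ 1) (2 ℕ.* d)) ⟩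
        2 ℕ.* d ℕ.+ q ℕ.* (2 ℕ.* d)      ≡⟨ s q d ⟩
        (t ℕ.+ t) ℕ.* d                  ∎
        where
        s : ∀ q d → 2 ℕ.* d ℕ.+ q ℕ.* (2 ℕ.* d) ≡ (suc q ℕ.+ suc q) ℕ.* d
        s = ℕSolver.solve-∀
      δ≤nd : δ ≤ n ℕ.* d
      δ≤nd = ℕ.*-cancelˡ-≤ 2 (begin
        2 ℕ.* δ            ≡⟨ cong (δ ℕ.+_) (ℕ.+-identityʳ δ) ⟩
        δ ℕ.+ δ            ≤⟨ ℕ.+-monoʳ-≤ δ δ≤δ′ ⟩
        δ ℕ.+ δ′           ≡⟨ trans total (ℕ.*-assoc 2 n d) ⟩
        2 ℕ.* (n ℕ.* d)    ∎)
      2t≤1+n : t ℕ.+ t ≤ suc n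
      2t≤1+n = subst (_≤ suc n) (s q) (s≤s (ℕ.*-cancelʳ-< d (2 ℕ.* q) n (ℕ.<-≤-trans lower δ≤nd)))
        where
        s : ∀ q → suc (suc (2 ℕ.* q)) ≡ suc q ℕ.+ suc q
        s = ℕSolver.solve-∀
      wit : Witness β m n t
      wit = witness t (s≤s z≤n) 2t≤1+n

    factors-constant : ∀ D f g → D ≢ 0ℤ → (D • G) ≋ (f *ₚ g) → Top 0ℤ f 0 ⊎ Top 0ℤ g 0
    factors-constant D f g D≢0 eq = split (zero⊎top 0ℤ f) (zero⊎top 0ℤ g)
      where
      top-DG : Top 0ℤ (f *ₚ g) (2 ℕ.* n ℕ.* d)
      top-DG = Top-resp eq (Top-• primeLike-0 D G (D≢0 ∘ 0∣⇒≡0) (F-Top₀ β m n φ-monic d>0 n>0 β0≡1 c≢0 a a-low))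
      split : Zero 0ℤ f ⊎ ∃ (Top 0ℤ f) → Zero 0ℤ g ⊎ ∃ (Top 0ℤ g) → Top 0ℤ f 0 ⊎ Top 0ℤ g 0
      split (inj₁ zf) _ = contradiction (Zero-*ˡ f g zf _) (proj₁ top-DG)
      split (inj₂ _) (inj₁ zg) = contradiction (Zero-*ʳ f g zg _) (proj₁ top-DG)
      split (inj₂ (zero , tf)) _ = inj₁ tf
      split (inj₂ (suc δ , tf)) (inj₂ (zero , tg)) = inj₂ tg
      split (inj₂ (suc δ , tf)) (inj₂ (suc δ′ , tg)) = ⊥-elim (compare (ℕ.≤-total (suc δ) (suc δ′)))
        where
        total : suc δ ℕ.+ suc δ′ ≡ 2 ℕ.* n ℕ.* d
        total = Top-unique (f *ₚ g) (Top-* primeLike-0 f g tf tg) top-DG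
        compare : suc δ ≤ suc δ′ ⊎ suc δ′ ≤ suc δ → ⊥
        compare (inj₁ le) = no-proper-factor D f g D≢0 eq tf tg total (s≤s z≤n) le
        compare (inj₂ le) = no-proper-factor D g f D≢0 (≋-trans eq (*ₚ-comm f g)) tg tf (trans (ℕ.+-comm (suc δ′) (suc δ)) total) (s≤s z≤n) le

  ι : ℤ → ℚ
  ι x = x ℚ./ 1

  toℚᵘ-ι : ∀ x → toℚᵘ (ι x) ≃ mkℚᵘ x 0
  toℚᵘ-ι x = ℚ.toℚᵘ-fromℚᵘ (mkℚᵘ x 0)

  ι-+ : ∀ x y → ι (x ℤ.+ y) ≡ ι x ℚ.+ ι y
  ι-+ x y = ℚ.toℚᵘ-injective (ℚᵘ.≃-trans (toℚᵘ-ι (x ℤ.+ y)) (ℚᵘ.≃-trans (*≡* (r x y))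
    (ℚᵘ.≃-sym (ℚᵘ.≃-trans (ℚ.toℚᵘ-homo-+ (ι x) (ι y)) (ℚᵘ.+-cong (toℚᵘ-ι x) (toℚᵘ-ι y))))))
    where
    r : ∀ x y → (x ℤ.+ y) ℤ.* 1ℤ ≡ (x ℤ.* 1ℤ ℤ.+ y ℤ.* 1ℤ) ℤ.* 1ℤ
    r = solve-∀

  ι-* : ∀ x y → ι (x ℤ.* y) ≡ ι x ℚ.* ι y
  ι-* x y = ℚ.toℚᵘ-injective (ℚᵘ.≃-trans (toℚᵘ-ι (x ℤ.* y)) (ℚᵘ.≃-trans (*≡* refl)
    (ℚᵘ.≃-sym (ℚᵘ.≃-trans (ℚ.toℚᵘ-homo-* (ι x) (ι y)) (ℚᵘ.*-cong (toℚᵘ-ι x) (toℚᵘ-ι y))))))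

  ι-injective : ∀ {x y} → ι x ≡ ι y → x ≡ y
  ι-injective {x} {y} eq with ℚᵘ.≃-trans (ℚᵘ.≃-sym (toℚᵘ-ι x)) (ℚᵘ.≃-trans (ℚᵘ.≃-reflexive (cong toℚᵘ eq)) (toℚᵘ-ι y))
  ... | *≡* e = trans (sym (ℤ.*-identityʳ x)) (trans e (ℤ.*-identityʳ y))

  ι-clear : ∀ r → ∃₂ λ D x → D ≢ 0ℤ × ι D ℚ.* r ≡ ι x
  ι-clear r@(mkℚ x d-1 _) = + suc d-1 , x , (λ ()) , ℚ.toℚᵘ-injective
    (ℚᵘ.≃-trans (ℚ.toℚᵘ-homo-* (ι (+ suc d-1)) r) (ℚᵘ.≃-trans (ℚᵘ.*-cong (toℚᵘ-ι (+ suc d-1)) (ℚᵘ.≃-refl {mkℚᵘ x d-1}))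
      (ℚᵘ.≃-trans (*≡* (e x (+ suc d-1))) (ℚᵘ.≃-sym (toℚᵘ-ι x)))))
    where
    e : ∀ x d → (d ℤ.* x) ℤ.* 1ℤ ≡ x ℤ.* (1ℤ ℤ.* d)
    e = solve-∀

  module ℚ-Poly = PolynomialRing ℚ.+-*-commutativeRing
  open ℚ-Poly using () renaming (_≋_ to _≋ℚ_)

  ιₚ : ℤPoly → ℚ[x].Poly
  ιₚ = map (λ a → a ℚ./ 1)

  coeff-ι : ∀ f k → ℚ[x].coeff (ιₚ f) k ≡ ι (coeff f k)
  coeff-ι []      k       = refl
  coeff-ι (x ∷ f) zero    = refl
  coeff-ι (x ∷ f) (suc k) = coeff-ι f k

  ιₚ-+ : ∀ f g → ιₚ (f +ₚ g) ≡ ιₚ f ℚ[x].+ₚ ιₚ g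
  ιₚ-+ []      g       = refl
  ιₚ-+ (x ∷ f) []      = refl
  ιₚ-+ (x ∷ f) (y ∷ g) = cong₂ _∷_ (ι-+ x y) (ιₚ-+ f g)

  ιₚ-• : ∀ x f → ιₚ (x • f) ≡ ι x ℚ[x].• ιₚ f
  ιₚ-• x []      = refl
  ιₚ-• x (y ∷ f) = cong₂ _∷_ (ι-* x y) (ιₚ-• x f)

  ιₚ-* : ∀ f g → ιₚ (f *ₚ g) ≡ ιₚ f ℚ[x].*ₚ ιₚ g
  ιₚ-* []      g = refl
  ιₚ-* (x ∷ f) g = trans (ιₚ-+ (x • g) (0ℤ ∷ (f *ₚ g))) (cong₂ ℚ[x]._+ₚ_ (ιₚ-• x g) (cong (0ℚ ∷_) (ιₚ-* f g)))

  ιₚ-injective : ∀ {f g} → ιₚ f ≋ℚ ιₚ g → f ≋ g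
  ιₚ-injective {f} {g} eq = ⟨ (λ k → ι-injective (trans (sym (coeff-ι f k)) (trans (ℚ-Poly.at eq k) (coeff-ι g k)))) ⟩

  clear : ∀ x → ∃₂ λ D f → D ≢ 0ℤ × (ι D ℚ[x].• x) ≋ℚ ιₚ f
  clear [] = 1ℤ , [] , (λ ()) , ℚ-Poly.≋-refl
  clear (r ∷ x) with ι-clear r | clear x
  ... | D₁ , y , D₁≢0 , eq₁ | D₂ , f , D₂≢0 , eq₂ = D₁ ℤ.* D₂ , (D₂ ℤ.* y) ∷ (D₁ • f) , D≢0 , ℚ-Poly.∷-cong head tail
    where
    D≢0 : D₁ ℤ.* D₂ ≢ 0ℤ
    D≢0 eq with ℤ.i*j≡0⇒i≡0∨j≡0 D₁ eq
    ... | inj₁ e = D₁≢0 e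
    ... | inj₂ e = D₂≢0 e
    head : ι (D₁ ℤ.* D₂) ℚ.* r ≡ ι (D₂ ℤ.* y)
    head = trans (cong (λ z → ι z ℚ.* r) (ℤ.*-comm D₁ D₂)) (trans (cong (ℚ._* r) (ι-* D₂ D₁)) (trans (ℚ.*-assoc (ι D₂) (ι D₁) r) (trans (cong (ι D₂ ℚ.*_) eq₁) (sym (ι-* D₂ y)))))
    tail : (ι (D₁ ℤ.* D₂) ℚ[x].• x) ≋ℚ ιₚ (D₁ • f)
    tail = ℚ-Poly.≋-trans (ℚ-Poly.•-cong (ι-* D₁ D₂) (ℚ-Poly.≋-refl {x})) (ℚ-Poly.≋-trans (ℚ-Poly.•-assoc (ι D₁) (ι D₂) x)
      (ℚ-Poly.≋-trans (ℚ-Poly.•-cong {a = ι D₁} refl eq₂) (subst (_≋ℚ ιₚ (D₁ • f)) (ιₚ-• D₁ f) ℚ-Poly.≋-refl)))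

  -- Denominators of the two rational factors are cleared separately, which yields an integer
  -- factorisation of a multiple D f. A factor whose integer multiple has degree 0 is a nonzero
  -- constant, hence a unit over ℚ.
  irreducible-over-ℚ : ∀ {f N} → Top 0ℤ f N → 0 < N →
    (∀ D g h → D ≢ 0ℤ → (D • f) ≋ (g *ₚ h) → Top 0ℤ g 0 ⊎ Top 0ℤ h 0) → IrreducibleOverℚ f
  irreducible-over-ℚ {f} {N} topf N>0 factors = RawSemiringDefs.mkIrred nonunit split
    where
    open RawSemiringDefs ℚ[x].polynomialRing using () renaming (_∣_ to _∣ℚ_)

    unit : ∀ x D g → D ≢ 0ℤ → (ι D ℚ[x].• x) ≋ℚ ιₚ g → Top 0ℤ g 0 → x ∣ℚ (1ℚ ∷ [])
    unit x D g D≢0 eq (g₀≢0 , below) = record { quotient = (ι D ℚ.* s) ∷ [] ; equality = λ k → trans (ℚ-Poly.at (ℚ-Poly.[a]*ₚ (ι D ℚ.* s) x) k) (trans (ℚ-Poly.coeff-• (ι D ℚ.* s) x k) (eqs k)) }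
      where
      g₀ : ℚ
      g₀ = ι (coeff g 0)
      instance
        nz : ℚ.NonZero g₀
        nz = ℚ.≢-nonZero λ e → g₀≢0 (≡0⇒∣ (ι-injective e))
      s : ℚ
      s = ℚ.1/ g₀
      scaled : ∀ k → ι D ℚ.* ℚ[x].coeff x k ≡ ι (coeff g k)
      scaled k = trans (sym (ℚ-Poly.coeff-• (ι D) x k)) (trans (ℚ-Poly.at eq k) (coeff-ι g k))
      rearr : ∀ y → (ι D ℚ.* s) ℚ.* y ≡ s ℚ.* (ι D ℚ.* y)
      rearr y = trans (cong (ℚ._* y) (ℚ.*-comm (ι D) s)) (ℚ.*-assoc s (ι D) y)
      eqs : ∀ k → (ι D ℚ.* s) ℚ.* ℚ[x].coeff x k ≡ ℚ[x].coeff (1ℚ ∷ []) k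
      eqs zero    = trans (rearr _) (trans (cong (s ℚ.*_) (scaled 0)) (ℚ.*-inverseˡ g₀))
      eqs (suc k) = trans (rearr _) (trans (cong (s ℚ.*_) (trans (scaled (suc k)) (cong ι (0∣⇒≡0 (below (suc k) (s≤s z≤n)))))) (ℚ.*-zeroʳ s))

    nonunit : ¬ (ιₚ f ∣ℚ (1ℚ ∷ []))
    nonunit d with clear (_∣ʳ_.quotient d)
    ... | D , g , D≢0 , eq = impossible (zero⊎top 0ℤ g)
      where
      gf : (g *ₚ f) ≋ (D ∷ [])
      gf = ιₚ-injective (subst (_≋ℚ ιₚ (D ∷ [])) (sym (ιₚ-* g f)) (ℚ-Poly.≋-trans (ℚ-Poly.*ₚ-cong (ℚ-Poly.≋-sym eq) (ℚ-Poly.≋-refl {ιₚ f}))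
        (ℚ-Poly.≋-trans (ℚ-Poly.•-*ₚ (ι D) (_∣ʳ_.quotient d) (ιₚ f)) (ℚ-Poly.≋-trans (ℚ-Poly.•-cong {a = ι D} refl ℚ-Poly.⟨ _∣ʳ_.equality d ⟩)
          (ℚ-Poly.∷-cong (ℚ.*-identityʳ (ι D)) ℚ-Poly.≋-refl)))))
      impossible : Zero 0ℤ g ⊎ ∃ (Top 0ℤ g) → ⊥
      impossible (inj₁ z) = D≢0 (0∣⇒≡0 (subst (0ℤ ∣_) (at gf 0) (Zero-*ˡ g f z 0)))
      impossible (inj₂ (e , top)) = proj₁ (Top-* primeLike-0 g f top topf) (≡0⇒∣ (trans (at gf (e ℕ.+ N)) (constant (e ℕ.+ N) (ℕ.≤-trans N>0 (ℕ.m≤n+m N e)))))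
        where
        constant : ∀ k → 0 < k → coeff (D ∷ []) k ≡ 0ℤ
        constant (suc k) _ = refl

    split : ∀ {x y} → ιₚ f ℚ[x].≈ₚ (x ℚ[x].*ₚ y) → x ∣ℚ (1ℚ ∷ []) ⊎ y ∣ℚ (1ℚ ∷ [])
    split {x} {y} eq with clear x | clear y
    ... | D₁ , g , D₁≢0 , eq₁ | D₂ , h , D₂≢0 , eq₂ = result (factors (D₁ ℤ.* D₂) g h D≢0 product-eq)
      where
      D≢0 : D₁ ℤ.* D₂ ≢ 0ℤ
      D≢0 e with ℤ.i*j≡0⇒i≡0∨j≡0 D₁ e
      ... | inj₁ e₁ = D₁≢0 e₁
      ... | inj₂ e₂ = D₂≢0 e₂
      product-eq : ((D₁ ℤ.* D₂) • f) ≋ (g *ₚ h)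
      product-eq = ιₚ-injective (subst₂ _≋ℚ_ (sym (ιₚ-• (D₁ ℤ.* D₂) f)) (sym (ιₚ-* g h))
        (ℚ-Poly.≋-trans (ℚ-Poly.•-cong (ι-* D₁ D₂) ℚ-Poly.⟨ eq ⟩) (ℚ-Poly.≋-trans (ℚ-Poly.•-assoc (ι D₁) (ι D₂) (x ℚ[x].*ₚ y))
          (ℚ-Poly.≋-trans (ℚ-Poly.•-cong {a = ι D₁} refl (ℚ-Poly.≋-sym (ℚ-Poly.*ₚ-• (ι D₂) x y))) (ℚ-Poly.≋-trans (ℚ-Poly.≋-sym (ℚ-Poly.•-*ₚ (ι D₁) x (ι D₂ ℚ[x].• y))) (ℚ-Poly.*ₚ-cong eq₁ eq₂))))))
      result : Top 0ℤ g 0 ⊎ Top 0ℤ h 0 → x ∣ℚ (1ℚ ∷ []) ⊎ y ∣ℚ (1ℚ ∷ [])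
      result (inj₁ top) = inj₁ (unit x D₁ g D₁≢0 eq₁ top)
      result (inj₂ top) = inj₂ (unit y D₂ h D₂≢0 eq₂ top)

  -- Degree, content and the shape of H

  deg-spec : ∀ f → (deg f ≡ ⊥₋ × Zero 0ℤ f) ⊎ (∃ λ e → deg f ≡ [ e ] × Below 0ℤ (suc e) f)
  deg-spec [] = inj₁ (refl , λ i → N∣0)
  deg-spec (x ∷ f) with deg f | deg-spec f
  ... | [ e ] | inj₂ (.e , refl , below) = inj₂ (suc e , refl , λ { zero () ; (suc i) (s≤s le) → below i le })
  ... | ⊥₋ | inj₁ (refl , z) with x ℤ.≟ 0ℤ
  ...   | yes x≡0 = inj₁ (refl , λ { zero → ≡0⇒∣ x≡0 ; (suc i) → z i })
  ...   | no  _   = inj₂ (0 , refl , λ { zero () ; (suc i) _ → z i })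

  monic⇒IsMonic : ∀ {f} → Monic f → ∃ λ e → deg f ≡ [ e ] × IsMonic f e
  monic⇒IsMonic {f} (e , eq , lead) with deg-spec f
  ... | inj₁ (eq′ , _) = contradiction (trans (sym eq′) eq) λ ()
  ... | inj₂ (e′ , eq′ , below) = e , eq , monic lead λ i lt → 0∣⇒≡0 (below i (subst (λ z → suc z ≤ i) ([]-injective (trans (sym eq) eq′)) lt))

  deg<⇒Below : ∀ {f g e} → deg g ≡ [ e ] → deg f <₋ deg g → Below 0ℤ e f
  deg<⇒Below {f} {g} {e} eq lt with deg f | deg-spec f | deg g | eq | lt
  ... | ⊥₋ | inj₁ (_ , z) | _ | _ | _ = λ i _ → z i
  ... | [ k ] | inj₂ (.k , refl , below) | [ .e ] | refl | [ k<e ] = λ i le → below i (ℕ.≤-trans k<e le)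

  Zero⇒∣content : ∀ p f → Zero (+ p) f → p ℕD.∣ content f
  Zero⇒∣content p []      z = p ℕD.∣0
  Zero⇒∣content p (x ∷ f) z = gcd-greatest (ℤD.∣⇒∣ᵤ (z 0)) (Zero⇒∣content p f (λ i → z (suc i)))

  ⌊2*n/2⌋≡n : ∀ n → ⌊ 2 ℕ.* n /2⌋ ≡ n
  ⌊2*n/2⌋≡n n = trans (cong (λ z → ⌊ n ℕ.+ z /2⌋) (ℕ.+-identityʳ n)) (sym (ℕ.n≡⌊n+n/2⌋ n))

  ⌊1+2*n/2⌋≡n : ∀ n → ⌊ suc (2 ℕ.* n) /2⌋ ≡ n
  ⌊1+2*n/2⌋≡n zero    = refl
  ⌊1+2*n/2⌋≡n (suc n) = trans (cong (λ z → ⌊ suc z /2⌋) (2*suc n)) (cong suc (⌊1+2*n/2⌋≡n n))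
    where
    2*suc : ∀ n → 2 ℕ.* suc n ≡ suc (suc (2 ℕ.* n))
    2*suc = ℕSolver.solve-∀

  -- H with the number h of summands and the coefficients β generalised.
  expansion : (ℕ → ℕ) → ℕ → ℕ → ℤPoly → ℤ → (ℕ → ℤPoly) → ℤPoly
  expansion β m h φ c a = c • (φ ^ m) +ₚ sum {h} λ i →
    + β (suc (toℕ i)) • (a (h ∸ suc (toℕ i)) *ₚ φ ^ (m ∸ 2 ℕ.* suc (toℕ i)))

  H≡expansion : ∀ m φ c a → H m φ c a ≡ expansion (b m) m ⌊ m /2⌋ φ c a
  H≡expansion m φ c a = refl

  H-even : ∀ n φ c a → H (2 ℕ.* n) φ c a ≡ F (b (2 ℕ.* n)) n φ c a
  H-even n φ c a = trans (H≡expansion (2 ℕ.* n) φ c a) (cong (λ h → expansion (b (2 ℕ.* n)) (2 ℕ.* n) h φ c a) (⌊2*n/2⌋≡n n))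

  expansion-odd : ∀ β n φ c a → expansion β (suc (2 ℕ.* n)) n φ c a ≋ (φ *ₚ F β n φ c a)
  expansion-odd β n φ c a = ≋-trans (+ₚ-cong (≋-sym (*ₚ-• c φ (φ ^ (2 ℕ.* n)))) (pull n f g term))
    (≋-sym (*ₚ-distribˡ φ (c • (φ ^ (2 ℕ.* n))) (sum g)))
    where
    f g : Fin n → ℤPoly
    f i = + β (suc (toℕ i)) • (a (n ∸ suc (toℕ i)) *ₚ φ ^ (suc (2 ℕ.* n) ∸ 2 ℕ.* suc (toℕ i)))
    g i = + β (suc (toℕ i)) • (a (n ∸ suc (toℕ i)) *ₚ φ ^ (2 ℕ.* n ∸ 2 ℕ.* suc (toℕ i)))
    pull : ∀ k (f g : Fin k → ℤPoly) → (∀ i → f i ≋ (φ *ₚ g i)) → sum f ≋ (φ *ₚ sum g)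
    pull zero    f g h = ≋-sym (*ₚ-zeroʳ φ)
    pull (suc k) f g h = ≋-trans (+ₚ-cong (h zero) (pull k (f ∘ suc) (g ∘ suc) (h ∘ suc))) (≋-sym (*ₚ-distribˡ φ (g zero) (sum (g ∘ suc))))
    factor : ∀ x f k → (x • (f *ₚ (φ *ₚ φ ^ k))) ≋ (φ *ₚ (x • (f *ₚ φ ^ k)))
    factor x f k = ≋-trans (•-cong {a = x} refl (≋-trans (≋-sym (*ₚ-assoc f φ (φ ^ k))) (≋-trans (*ₚ-cong (*ₚ-comm f φ) (≋-refl {φ ^ k})) (*ₚ-assoc φ f (φ ^ k)))))
      (≋-sym (*ₚ-• x φ (f *ₚ φ ^ k)))
    term : ∀ i → f i ≋ (φ *ₚ g i)
    term i = subst (λ e → (+ β (suc (toℕ i)) • (a (n ∸ suc (toℕ i)) *ₚ φ ^ e)) ≋ (φ *ₚ g i))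
      (sym (ℕ.+-∸-assoc 1 (ℕ.*-monoʳ-≤ 2 (Fin.toℕ<n i)))) (factor (+ β (suc (toℕ i))) (a (n ∸ suc (toℕ i))) (2 ℕ.* n ∸ 2 ℕ.* suc (toℕ i)))

  H-odd : ∀ n φ c a → H (suc (2 ℕ.* n)) φ c a ≋ (φ *ₚ F (b (suc (2 ℕ.* n))) n φ c a)
  H-odd n φ c a = subst (_≋ (φ *ₚ F (b m) n φ c a)) (sym (trans (H≡expansion m φ c a) (cong (λ h → expansion (b m) m h φ c a) (⌊1+2*n/2⌋≡n n))))
    (expansion-odd (b m) n φ c a)
    where
    m = suc (2 ℕ.* n)

  module _ (m n : ℕ) (2≤m : 2 ≤ m) (n>0 : 0 < n) (⌊m/2⌋≡n : ⌊ m /2⌋ ≡ n) (φ : ℤPoly) (φ-monic : Monic φ)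
           (irr : ∀ p → Prime p → p ≤ m → IrreducibleMod p φ) (c : ℤ) (a : ℕ → ℤPoly)
           (a-deg : ∀ i → i < ⌊ m /2⌋ → deg (a i) <₋ deg φ)
           (content-coprime : ∀ p → Prime p → p ≤ m → p ℕD.∤ content (c • a 0))
           (witness : ∀ t → 1 ≤ t → t ℕ.+ t ≤ suc n → Witness (b m) m n t) where

    F-irreducible : IrreducibleOverℚ (F (b m) n φ c a)
    F-irreducible with monic⇒IsMonic {φ} φ-monic
    ... | d , deg≡ , mon = irreducible-over-ℚ (F-Top₀ (b m) m n mon d>0 n>0 refl c≢0 a a-low) N>0
          (factors-constant (b m) m n mon d>0 n>0 refl c≢0 a a-low irr p∤c a₀≢0 witness)
      where
      d>0 : 0 < d
      -- The prime 2 ≤ m supplies one modulus at which φ is irreducible, which rules out φ = 1; it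
      -- likewise shows that c is nonzero.
      d>0 = nonconstant 2 φ (irr 2 prime[2] 2≤m) mon
      N>0 : 0 < 2 ℕ.* n ℕ.* d
      N>0 = ℕ.*-mono-< (ℕ.≤-trans n>0 (ℕ.m≤m+n n (n ℕ.+ 0))) d>0
      a-low : ∀ i → i < n → Below 0ℤ d (a i)
      a-low i i<n = deg<⇒Below {a i} {φ} deg≡ (a-deg i (subst (i <_) (sym ⌊m/2⌋≡n) i<n))
      p∤c : ∀ p → Prime p → p ≤ m → + p ∤ c
      p∤c p pr p≤m p∣c = content-coprime p pr p≤m (Zero⇒∣content p (c • a 0) λ i → subst (+ p ∣_) (sym (coeff-• c (a 0) i)) (ℤD.∣m⇒∣m*n (coeff (a 0) i) p∣c))
      a₀≢0 : ∀ p → Prime p → p ≤ m → ¬ Zero (+ p) (a 0)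
      a₀≢0 p pr p≤m z = content-coprime p pr p≤m (Zero⇒∣content p (c • a 0) (Zero-• c (a 0) z))
      c≢0 : c ≢ 0ℤ
      c≢0 c≡0 = p∤c 2 prime[2] 2≤m (≡0⇒∣ c≡0)

  half-even : ∀ {m} → 3 ≤ m → 2 ℕD.∣ m → ∃ λ n → m ≡ 2 ℕ.* n × 2 ≤ n
  half-even {m} 3≤m (ℕD.divides n refl) = n , ℕ.*-comm n 2 , 2≤n n 3≤m
    where
    2≤n : ∀ n → 3 ≤ n ℕ.* 2 → 2 ≤ n
    2≤n (suc zero) (s≤s (s≤s ()))
    2≤n (suc (suc n)) _ = s≤s (s≤s z≤n)

  half-odd : ∀ {m} → 3 ≤ m → 2 ℕD.∤ m → ∃ λ n → m ≡ suc (2 ℕ.* n) × 1 ≤ n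
  half-odd {m} 3≤m 2∤m with even⊎odd m
  ... | n , inj₁ refl = contradiction (ℕD.divides n (trans (cong (n ℕ.+_) (sym (ℕ.+-identityʳ n))) (ℕ.*-comm 2 n))) 2∤m
  ... | zero , inj₂ refl = contradiction 3≤m λ { (s≤s ()) }
  ... | suc n , inj₂ refl = suc n , trans (ℕ.+-suc (suc n) (suc n)) (cong (λ z → suc (suc n ℕ.+ z)) (sym (ℕ.+-identityʳ (suc n)))) , s≤s z≤n

-- The two parities of m

open Arithmetic using (witness₀; witness₁; b)
open IntegerPolynomials using (F; F-irreducible; H-even; H-odd; half-even; half-odd; ⌊2*n/2⌋≡n; ⌊1+2*n/2⌋≡n)

open import Defs
open import Data.Integer.Base using (ℤ)
open import Data.Nat.Base using (ℕ; suc; _*_; _≤_; _<_; _^_; ⌊_/2⌋)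
open import Data.Nat.Divisibility using (_∣_; _∤_)
open import Data.Nat.Primality using (Prime)
open import Data.Nat.Properties using (≤-trans; n≤1+n)
open import Data.Product.Base using (∃; _×_; _,_)
open import Relation.Binary.PropositionalEquality.Core using (_≢_; refl; sym; subst)

theorem1p5 : (m : ℕ) → 3 ≤ m →
    (φ : ℤPoly) → Monic φ →
    (∀ p → Prime p → p ≤ m → IrreducibleMod p φ) →
    (c : ℤ) (a : ℕ → ℤPoly) →
    (∀ i → i < ⌊ m /2⌋ → deg (a i) <₋ deg φ) →
    (∀ p → Prime p → p ≤ m → p ∤ content (c • a 0)) →
    (2 ∣ m → IrreducibleOverℚ (H m φ c a)) ×
    (2 ∤ m → (∀ k → 2 ≤ k → m ≢ 3 ^ k) → ∃ λ g → (H m φ c a ≈ₚ φ *ₚ g) × IrreducibleOverℚ g)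
theorem1p5 m 3≤m φ φ-monic irr c a a-deg coprime = even , odd
  where
  even : 2 ∣ m → IrreducibleOverℚ (H m φ c a)
  even 2∣m with half-even 3≤m 2∣m
  ... | n , refl , 2≤n = subst IrreducibleOverℚ (sym (H-even n φ c a))
        (F-irreducible (2 * n) n (≤-trans (n≤1+n 2) 3≤m) (≤-trans (n≤1+n 1) 2≤n) (⌊2*n/2⌋≡n n)
          φ φ-monic irr c a a-deg coprime (λ t → witness₀ n t 2≤n))
  odd : 2 ∤ m → (∀ k → 2 ≤ k → m ≢ 3 ^ k) → ∃ λ g → (H m φ c a ≈ₚ φ *ₚ g) × IrreducibleOverℚ g
  odd 2∤m m≢3^ with half-odd 3≤m 2∤m
  ... | n , refl , 1≤n = F (b (suc (2 * n))) n φ c a , PolynomialRing.at (H-odd n φ c a) ,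
        F-irreducible (suc (2 * n)) n (≤-trans (n≤1+n 2) 3≤m) 1≤n (⌊1+2*n/2⌋≡n n)
          φ φ-monic irr c a a-deg coprime (λ t → witness₁ n t 1≤n m≢3^)
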